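{- For a positive integer $m$, let $b_m(n)$ denote the number of $m$-regular partitions of $n$ (partitions of $n$ with no part divisible by $m$), so that $\sum_{n\ge0}b_m(n)q^n=\prod_{i\ge1}\frac{1-q^{mi}}{1-q^i}$, and let $\delta^{[m]}=\lim_{x\to\infty}\#\{n\le x: b_m(n)\text{ odd}\}/x$. Assuming that $\delta^{[5]}$ and $\delta^{[20]}$ exist, we have $\delta^{[5]}=\delta^{[20]}/4$; in particular $\delta^{[5]}\le 1/4$. -}

module Defs where

open import Data.Bool using (Bool; true; false; if_then_else_)
open import Data.Nat as ℕ using (ℕ; zero; suc; _∸_; _≤ᵇ_; _%_)
open import Data.Nat.Divisibility using (_∣?_)
open import Data.Nat.ListAction using (sum)
open import Data.List using (List; map; upTo; filter; length)
open import Data.Integer using (+_)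
open import Data.Rational using (ℚ; _/_; _-_; _+_; _*_; _<_; _≤_; ∣_∣; Positive; 0ℚ)
open import Data.Product using (∃; _×_)
open import Relation.Nullary.Decidable using (does; ¬?)

-- regCount m k n = number of partitions of n all of whose parts are ≤ k
-- and not divisible by m.  Recursion on the largest allowed part k:
-- either k is forbidden (m ∣ k), or we choose its multiplicity j.
regCount : ℕ → ℕ → ℕ → ℕ
regCount m zero zero = 1
regCount m zero (suc n) = 0
regCount m (suc k) n =
  if does (m ∣? suc k)
  then regCount m k n
  else sum (map (λ j → if j ℕ.* suc k ≤ᵇ n then regCount m k (n ∸ j ℕ.* suc k) else 0)
                (upTo (suc n)))

-- b m n : number of m-regular partitions of n (no part divisible by m).
-- Parts of a partition of n are ≤ n, so bounding the parts by n loses nothing.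
b : ℕ → ℕ → ℕ
b m n = regCount m n n

oddCount : ℕ → ℕ → ℕ
oddCount m x = length (filter (λ n → ¬? (b m n % 2 ℕ.≟ 0)) (upTo (suc x)))

ratio : ℕ → ℕ → ℚ
ratio m k = (+ oddCount m (suc k)) / suc k

-- A rational sequence is convergent (its limit exists in ℝ):
-- Cauchy criterion, ε ranging over positive rationals.
Convergent : (ℕ → ℚ) → Set
Convergent a = ∀ (ε : ℚ) → Positive ε →
  ∃ λ N → ∀ x y → N ℕ.≤ x → N ℕ.≤ y → ∣ a x - a y ∣ < ε

TendsTo : (ℕ → ℚ) → ℚ → Set
TendsTo a L = ∀ (ε : ℚ) → Positive ε →
  ∃ λ N → ∀ x → N ℕ.≤ x → ∣ a x - L ∣ < ε

EventuallyLe : (ℕ → ℚ) → ℚ → Set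
EventuallyLe a L = ∀ (ε : ℚ) → Positive ε →
  ∃ λ N → ∀ x → N ℕ.≤ x → a x ≤ L + ε

¼ : ℚ
¼ = + 1 / 4

{-# OPTIONS --safe #-}

-- Work in 𝔽₂[[q]] and write E(q) = ∏ (1 + q^i), so that ∑ b_m(n) q^n = E(q^m) / E(q) and E(q)² = E(q²).
-- By the pentagonal number theorem E(q) = ∑ q^i over the i such that 24 i + 1 is a square; hence coefficients of
-- products E(q^c) E(q^d) count positive solutions of c x² + d y² = 24 n + c + d modulo 2, and such counts are
-- computed by pairing points of quadratic forms under sign changes.
--
-- Multiplication by 1 + √-2 and by 1 + √-5 gives E(q) E(q²) = ∑ q^(k(k+1)/2) and
-- E(q) E(q⁵) = E(q²) E(q⁴) + q E(q¹⁰) E(q²⁰).  Dividing by E(q²) and separating even and odd exponents twice,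
-- b₅(4n) has the parity of the n-th coefficient of E(q), b₅(4n+1) that of E(q²) E(q⁵), b₅(4n+2) is even and
-- b₅(4n+3) ≡ b₂₀(n).  The claim follows once E(q) and E(q²) E(q⁵) have odd coefficients only on a set of density 0.
--
-- For the latter let N = 24 n + 7.  If a prime p ≠ 5 divides N exactly once, then half of the solutions of
-- 2 x² + 5 y² = N are the points of a lattice on which (2 x² + 5 y²) / p is a form of determinant 10, hence
-- equivalent to x² + 10 y² or 2 x² + 5 y²; so the number of positive solutions is even unless N / p is a square or
-- five times a square.  The exceptional N, and those with no such p, have density 0 by Chebyshev's bound on primes.
module Submission where

-- All parities come from counting one finite set of integer points twice. On a diagonal form a x² +
-- c y² the four sign changes act freely off the axes, so modulo 4 the number of points is decided
-- by the axes. In the second count a congruence, x ≡ y modulo 3 or x ≡ t y modulo p, admits exactly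
-- two of the four sign choices of each positive solution. Comparing both counts modulo 4 and
-- halving leaves the parity of the number of positive solutions. For the quotient form of
-- determinant 10 this works because both reduced forms of discriminant -40 are diagonal: whichever
-- class occurs, its points come in fours unless one of the axes is hit. A single prime of exact
-- exponent one already makes the count even; what is left consists of numbers of the shapes p u², 5
-- p u² and s t² with s ≤ 5 t, whose rarity rests on π(x) = o(x). The existence of a limit enters as
-- the Cauchy property: it relates the term with denominator x + 1 to the one with denominator 4 (x
-- + 1), where both counts can be compared.

open import Defs

-- Arithmetic of formal power series over the field with two elements

module PowerSeries where

  open import Data.Bool using (Bool; true; false; _∧_; _xor_; if_then_else_)
  open import Data.Bool.Properties using (∧-comm; ∧-assoc; ∧-idem; ∧-zeroʳ; ∧-identityʳ; ∧-distribˡ-xor; ∧-distribʳ-xor; xor-assoc; xor-comm; xor-same; xor-identityʳ)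
  open import Data.Nat using (ℕ; zero; suc; _+_; _*_; _∸_; _≤_; _<_; z≤n; s≤s; NonZero; _/_; _≤?_; ≢-nonZero⁻¹)
  open import Data.Nat.Properties
  open import Data.Nat.Divisibility using (_∣_; _∣?_; divides; n∣m*n; ∣-trans; _∣0; ∣m+n∣m⇒∣n; ∣m∣n⇒∣m+n; *-cancelʳ-∣; >⇒∤)
  open import Data.Nat.DivMod using (m*n/n≡m)
  open import Data.Nat.Induction using (<-rec)
  open import Data.Empty using (⊥-elim)
  open import Function using (_∘_)
  open import Relation.Nullary using (¬_; yes; no)
  open import Relation.Nullary.Decidable using (does; dec-true; dec-false)
  open import Relation.Binary.PropositionalEquality using (_≡_; _≗_; refl; sym; trans; cong; cong₂; subst; module ≡-Reasoning)
  open ≡-Reasoning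

  -- Power series over 𝔽₂, compared coefficientwise by _≗_.
  Series : Set
  Series = ℕ → Bool

  private variable
    f g h f′ g′ : Series

  infixl 6 _⊕_
  infixl 7 _⊛_

  _⊕_ : Series → Series → Series
  (f ⊕ g) n = f n xor g n

  tail : Series → Series
  tail f n = f (suc n)

  one : Series
  one zero = true
  one (suc _) = false

  -- The Cauchy product in the form f g = f(0) g + q (tail f) g. Recursion on the index replaces
  -- finite sums, so the ring laws become inductions that peel one coefficient off the left factor.
  _⊛_ : Series → Series → Series
  (f ⊛ g) zero = f 0 ∧ g 0
  (f ⊛ g) (suc n) = (f 0 ∧ g (suc n)) xor (tail f ⊛ g) n

  xor-swap : ∀ a b c d → (a xor b) xor (c xor d) ≡ (a xor c) xor (b xor d)
  xor-swap a b c d = begin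
    (a xor b) xor (c xor d) ≡⟨ xor-assoc a b _ ⟩
    a xor (b xor (c xor d)) ≡⟨ cong (a xor_) (sym (xor-assoc b c d)) ⟩
    a xor ((b xor c) xor d) ≡⟨ cong (λ v → a xor (v xor d)) (xor-comm b c) ⟩
    a xor ((c xor b) xor d) ≡⟨ cong (a xor_) (xor-assoc c b d) ⟩
    a xor (c xor (b xor d)) ≡⟨ sym (xor-assoc a c _) ⟩
    (a xor c) xor (b xor d) ∎

  xor-cancelˡ : ∀ a b → a xor (a xor b) ≡ b
  xor-cancelˡ a b = trans (sym (xor-assoc a a b)) (cong (_xor b) (xor-same a))

  -- Only coefficients up to n enter coefficient n of a product. This is what lets infinite products
  -- be replaced by finite truncations.
  ⊛-cong-≤ : ∀ n → (∀ k → k ≤ n → f k ≡ f′ k) → (∀ k → k ≤ n → g k ≡ g′ k) →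
             (f ⊛ g) n ≡ (f′ ⊛ g′) n
  ⊛-cong-≤ zero p q = cong₂ _∧_ (p 0 z≤n) (q 0 z≤n)
  ⊛-cong-≤ (suc n) p q = cong₂ _xor_ (cong₂ _∧_ (p 0 z≤n) (q (suc n) ≤-refl))
    (⊛-cong-≤ n (λ k k≤n → p (suc k) (s≤s k≤n)) (λ k k≤n → q k (m≤n⇒m≤1+n k≤n)))

  ⊛-cong : f ≗ f′ → g ≗ g′ → f ⊛ g ≗ f′ ⊛ g′
  ⊛-cong p q n = ⊛-cong-≤ n (λ k _ → p k) (λ k _ → q k)

  ⊛-sucʳ : ∀ f g n → (f ⊛ g) (suc n) ≡ (f ⊛ tail g) n xor (f (suc n) ∧ g 0)
  ⊛-sucʳ f g zero = refl
  ⊛-sucʳ f g (suc n) = trans (cong ((f 0 ∧ g (suc (suc n))) xor_) (⊛-sucʳ (tail f) g n))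
                             (sym (xor-assoc (f 0 ∧ g (suc (suc n))) _ _))

  ⊛-comm : ∀ f g → f ⊛ g ≗ g ⊛ f
  ⊛-comm f g zero = ∧-comm (f 0) (g 0)
  ⊛-comm f g (suc n) = begin
    (f 0 ∧ g (suc n)) xor (tail f ⊛ g) n  ≡⟨ cong₂ _xor_ (∧-comm (f 0) _) (⊛-comm (tail f) g n) ⟩
    (g (suc n) ∧ f 0) xor (g ⊛ tail f) n  ≡⟨ xor-comm (g (suc n) ∧ f 0) _ ⟩
    (g ⊛ tail f) n xor (g (suc n) ∧ f 0)  ≡⟨ sym (⊛-sucʳ g f n) ⟩
    (g ⊛ f) (suc n) ∎

  ⊛-distribʳ : ∀ f g h → (f ⊕ g) ⊛ h ≗ (f ⊛ h) ⊕ (g ⊛ h)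
  ⊛-distribʳ f g h zero = ∧-distribʳ-xor (h 0) (f 0) (g 0)
  ⊛-distribʳ f g h (suc n) = trans
    (cong₂ _xor_ (∧-distribʳ-xor (h (suc n)) (f 0) (g 0)) (⊛-distribʳ (tail f) (tail g) h n))
    (xor-swap (f 0 ∧ h (suc n)) (g 0 ∧ h (suc n)) _ _)

  ⊛-distribˡ : ∀ f g h → f ⊛ (g ⊕ h) ≗ (f ⊛ g) ⊕ (f ⊛ h)
  ⊛-distribˡ f g h n = trans (⊛-comm f (g ⊕ h) n)
    (trans (⊛-distribʳ g h f n) (cong₂ _xor_ (⊛-comm g f n) (⊛-comm h f n)))

  ⊛-scaleˡ : ∀ a g h → (λ n → a ∧ g n) ⊛ h ≗ (λ n → a ∧ (g ⊛ h) n)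
  ⊛-scaleˡ a g h zero = ∧-assoc a _ _
  ⊛-scaleˡ a g h (suc n) = trans (cong₂ _xor_ (∧-assoc a (g 0) _) (⊛-scaleˡ a (tail g) h n))
                                 (sym (∧-distribˡ-xor a _ _))

  ⊛-assoc : ∀ f g h → (f ⊛ g) ⊛ h ≗ f ⊛ (g ⊛ h)
  ⊛-assoc f g h zero = ∧-assoc (f 0) _ _
  ⊛-assoc f g h (suc n) = begin
    ((f 0 ∧ g 0) ∧ h (suc n)) xor (tail (f ⊛ g) ⊛ h) n
      ≡⟨ cong₂ _xor_ (∧-assoc (f 0) _ _) (⊛-distribʳ (λ k → f 0 ∧ g (suc k)) (tail f ⊛ g) h n) ⟩
    (f 0 ∧ (g 0 ∧ h (suc n))) xor (((λ k → f 0 ∧ tail g k) ⊛ h) n xor ((tail f ⊛ g) ⊛ h) n)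
      ≡⟨ cong ((f 0 ∧ (g 0 ∧ h (suc n))) xor_) (cong₂ _xor_ (⊛-scaleˡ (f 0) (tail g) h n) (⊛-assoc (tail f) g h n)) ⟩
    (f 0 ∧ (g 0 ∧ h (suc n))) xor ((f 0 ∧ (tail g ⊛ h) n) xor (tail f ⊛ (g ⊛ h)) n)
      ≡⟨ sym (xor-assoc (f 0 ∧ (g 0 ∧ h (suc n))) _ _) ⟩
    ((f 0 ∧ (g 0 ∧ h (suc n))) xor (f 0 ∧ (tail g ⊛ h) n)) xor (tail f ⊛ (g ⊛ h)) n
      ≡⟨ cong (_xor (tail f ⊛ (g ⊛ h)) n) (sym (∧-distribˡ-xor (f 0) _ _)) ⟩
    (f 0 ∧ (g ⊛ h) (suc n)) xor (tail f ⊛ (g ⊛ h)) n ∎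

  ⊛-zeroˡ : ∀ g → (λ _ → false) ⊛ g ≗ (λ _ → false)
  ⊛-zeroˡ g zero = refl
  ⊛-zeroˡ g (suc n) = ⊛-zeroˡ g n

  ⊛-identityˡ : ∀ g → one ⊛ g ≗ g
  ⊛-identityˡ g zero = refl
  ⊛-identityˡ g (suc n) = trans (cong (g (suc n) xor_) (⊛-zeroˡ g n)) (xor-identityʳ _)

  -- The constant term 1 makes coefficient k of g equal to coefficient k of f g plus terms in
  -- earlier coefficients of g, so g is recovered step by step; `below` carries all indices up to n
  -- for the strong induction.
  ⊛-cancelˡ : ∀ f g h → f 0 ≡ true → f ⊛ g ≗ f ⊛ h → g ≗ h
  ⊛-cancelˡ f g h f0 eq n = below n n ≤-refl
    where
    below : ∀ n k → k ≤ n → g k ≡ h k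
    below n zero k≤n = trans (sym (head g)) (trans (eq 0) (head h))
      where
      head : ∀ (g : Series) → f 0 ∧ g 0 ≡ g 0
      head g = cong (_∧ g 0) f0
    below (suc n) (suc k) (s≤s k≤n) = trans (sym (top g))
      (trans (cong₂ _xor_ (eq (suc k)) (⊛-cong-≤ k (λ _ _ → refl) (λ i i≤k → below n i (≤-trans i≤k k≤n)))) (top h))
      where
      top : ∀ (g : Series) → (f ⊛ g) (suc k) xor (tail f ⊛ g) k ≡ g (suc k)
      top g = trans (cong (λ v → ((v ∧ g (suc k)) xor (tail f ⊛ g) k) xor (tail f ⊛ g) k) f0)
        (trans (xor-assoc (g (suc k)) _ _)
          (trans (cong (g (suc k) xor_) (xor-same ((tail f ⊛ g) k))) (xor-identityʳ _)))

  -- The cross terms f(0) f(n+2) and f(n+2) f(0) cancel modulo 2, so squaring passes to the tails at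
  -- a cost of two exponents.
  frobenius-suc² : ∀ f n → (f ⊛ f) (suc (suc n)) ≡ (tail f ⊛ tail f) n
  frobenius-suc² f n = begin
    (f 0 ∧ f (suc (suc n))) xor (tail f ⊛ f) (suc n)
      ≡⟨ cong₂ _xor_ (∧-comm (f 0) _) (trans (⊛-sucʳ (tail f) f n) (xor-comm ((tail f ⊛ tail f) n) _)) ⟩
    (f (suc (suc n)) ∧ f 0) xor ((f (suc (suc n)) ∧ f 0) xor (tail f ⊛ tail f) n)
      ≡⟨ xor-cancelˡ (f (suc (suc n)) ∧ f 0) _ ⟩
    (tail f ⊛ tail f) n ∎

  -- shift d f is q^d f(q), dilate d f is f(q^d).

  shift : ℕ → Series → Series
  shift zero f n = f n
  shift (suc d) f zero = false
  shift (suc d) f (suc n) = shift d f n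

  shift-+ : ∀ d f n → shift d f (d + n) ≡ f n
  shift-+ zero f n = refl
  shift-+ (suc d) f n = shift-+ d f n

  shift-< : ∀ {d n} f → n < d → shift d f n ≡ false
  shift-< {suc d} {zero} f _ = refl
  shift-< {suc d} {suc n} f (s≤s n<d) = shift-< f n<d

  shift-cong : ∀ d → f ≗ g → shift d f ≗ shift d g
  shift-cong zero p n = p n
  shift-cong (suc d) p zero = refl
  shift-cong (suc d) p (suc n) = shift-cong d p n

  shift-⊕ : ∀ d f g → shift d (f ⊕ g) ≗ shift d f ⊕ shift d g
  shift-⊕ zero f g n = refl
  shift-⊕ (suc d) f g zero = refl
  shift-⊕ (suc d) f g (suc n) = shift-⊕ d f g n

  shift-shift : ∀ d e f → shift d (shift e f) ≗ shift (d + e) f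
  shift-shift zero e f n = refl
  shift-shift (suc d) e f zero = refl
  shift-shift (suc d) e f (suc n) = shift-shift d e f n

  shift-⊛ : ∀ d f g → shift d f ⊛ g ≗ shift d (f ⊛ g)
  shift-⊛ zero f g n = refl
  shift-⊛ (suc d) f g zero = refl
  shift-⊛ (suc d) f g (suc n) = shift-⊛ d f g n

  ⊛-shift : ∀ d f g → f ⊛ shift d g ≗ shift d (f ⊛ g)
  ⊛-shift d f g n = trans (⊛-comm f (shift d g) n) (trans (shift-⊛ d g f n) (shift-cong d (⊛-comm g f) n))

  dilate : (d : ℕ) .{{_ : NonZero d}} → Series → Series
  dilate d f n = if does (d ∣? n) then f (n / d) else false

  module _ (d : ℕ) .{{_ : NonZero d}} where

    dilate-* : ∀ f k → dilate d f (k * d) ≡ f k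
    dilate-* f k rewrite dec-true (d ∣? (k * d)) (n∣m*n k) = cong f (m*n/n≡m k d)

    dilate-∤ : ∀ f {n} → ¬ d ∣ n → dilate d f n ≡ false
    dilate-∤ f {n} d∤n rewrite dec-false (d ∣? n) d∤n = refl

    dilate-cong : f ≗ g → dilate d f ≗ dilate d g
    dilate-cong p n with d ∣? n
    ... | yes _ = p _
    ... | no _ = refl

    dilate-⊕ : ∀ f g → dilate d (f ⊕ g) ≗ dilate d f ⊕ dilate d g
    dilate-⊕ f g n with d ∣? n
    ... | yes _ = refl
    ... | no _ = refl

    dilate-shift : ∀ k f → dilate d (shift k f) ≗ shift (k * d) (dilate d f)
    dilate-shift k f n with d ∣? n
    dilate-shift k f n | no d∤n with k * d ≤? n
    ... | no kd≰n = sym (shift-< (dilate d f) (≰⇒> kd≰n))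
    ... | yes kd≤n = sym (begin
      shift (k * d) (dilate d f) n                      ≡⟨ cong (shift (k * d) (dilate d f)) (sym (m+[n∸m]≡n kd≤n)) ⟩
      shift (k * d) (dilate d f) (k * d + (n ∸ k * d))  ≡⟨ shift-+ (k * d) _ _ ⟩
      dilate d f (n ∸ k * d)                            ≡⟨ dilate-∤ f (λ d∣ → d∤n (subst (d ∣_) (m+[n∸m]≡n kd≤n) (∣m∣n⇒∣m+n (n∣m*n k) d∣))) ⟩
      false ∎)
    dilate-shift k f n | yes (divides j refl) = trans (cong (shift k f) (m*n/n≡m j d)) go
      where
      go : shift k f j ≡ shift (k * d) (dilate d f) (j * d)
      go with k ≤? j
      ... | no k≰j = trans (shift-< f (≰⇒> k≰j)) (sym (shift-< (dilate d f) (*-monoˡ-< d (≰⇒> k≰j))))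
      ... | yes k≤j = begin
        shift k f j                                         ≡⟨ cong (shift k f) (sym (m+[n∸m]≡n k≤j)) ⟩
        shift k f (k + (j ∸ k))                             ≡⟨ shift-+ k f _ ⟩
        f (j ∸ k)                                           ≡⟨ sym (dilate-* f (j ∸ k)) ⟩
        dilate d f ((j ∸ k) * d)                            ≡⟨ sym (shift-+ (k * d) _ _) ⟩
        shift (k * d) (dilate d f) (k * d + (j ∸ k) * d)    ≡⟨ cong (shift (k * d) (dilate d f)) (trans (sym (*-distribʳ-+ d k (j ∸ k))) (cong (_* d) (m+[n∸m]≡n k≤j))) ⟩
        shift (k * d) (dilate d f) (j * d) ∎

    dilate-one : dilate d one ≗ one
    dilate-one n with d ∣? n
    ... | no d∤n = helper n d∤n
      where
      helper : ∀ n → ¬ d ∣ n → false ≡ one n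
      helper zero d∤0 = ⊥-elim (d∤0 (d ∣0))
      helper (suc _) _ = refl
    ... | yes (divides k refl) = trans (cong one (m*n/n≡m k d)) (go k)
      where
      go : ∀ k → one k ≡ one (k * d)
      go zero = refl
      go (suc k) with suc k * d in eq
      ... | zero = ⊥-elim (≢-nonZero⁻¹ (suc k * d) {{m*n≢0 (suc k) d}} eq)
      ... | suc _ = refl

    private
      ⊛-unfold : ∀ f g → f ⊛ g ≗ (λ n → f 0 ∧ g n) ⊕ shift 1 (tail f ⊛ g)
      ⊛-unfold f g zero = sym (xor-identityʳ _)
      ⊛-unfold f g (suc n) = refl

      unfold : ∀ f → f ≗ (λ n → f 0 ∧ one n) ⊕ shift 1 (tail f)
      unfold f zero = sym (trans (xor-identityʳ _) (∧-identityʳ _))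
      unfold f (suc n) = sym (cong (_xor f (suc n)) (∧-zeroʳ (f 0)))

      dilate-scale : ∀ a g → dilate d (λ n → a ∧ g n) ≗ (λ n → a ∧ dilate d g n)
      dilate-scale a g n with d ∣? n
      ... | yes _ = refl
      ... | no _ = sym (∧-zeroʳ a)

      shift-cong-< : ∀ d .{{_ : NonZero d}} {f g} n → (∀ k → k < n → f k ≡ g k) → shift d f n ≡ shift d g n
      shift-cong-< (suc d) zero p = refl
      shift-cong-< (suc d) (suc n) p = go d n (λ k k≤n → p k (s≤s k≤n))
        where
        go : ∀ d {f g} n → (∀ k → k ≤ n → f k ≡ g k) → shift d f n ≡ shift d g n
        go zero n p = p n ≤-refl
        go (suc d) zero p = refl
        go (suc d) (suc n) p = go d n (λ k k≤n → p k (m≤n⇒m≤1+n k≤n))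

    dilate-unfold : ∀ f → dilate d f ≗ (λ n → f 0 ∧ one n) ⊕ shift (1 * d) (dilate d (tail f))
    dilate-unfold f n = begin
      dilate d f n
        ≡⟨ dilate-cong (unfold f) n ⟩
      dilate d ((λ n → f 0 ∧ one n) ⊕ shift 1 (tail f)) n
        ≡⟨ dilate-⊕ (λ n → f 0 ∧ one n) (shift 1 (tail f)) n ⟩
      dilate d (λ n → f 0 ∧ one n) n xor dilate d (shift 1 (tail f)) n
        ≡⟨ cong₂ _xor_ (trans (dilate-scale (f 0) one n) (cong (f 0 ∧_) (dilate-one n))) (dilate-shift 1 (tail f) n) ⟩
      (f 0 ∧ one n) xor shift (1 * d) (dilate d (tail f)) n ∎

    dilate-⊛-unfold : ∀ f g → dilate d f ⊛ g ≗ (λ n → f 0 ∧ g n) ⊕ shift (1 * d) (dilate d (tail f) ⊛ g)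
    dilate-⊛-unfold f g n = begin
      (dilate d f ⊛ g) n
        ≡⟨ ⊛-cong {g = g} (dilate-unfold f) (λ _ → refl) n ⟩
      (((λ n → f 0 ∧ one n) ⊕ shift (1 * d) (dilate d (tail f))) ⊛ g) n
        ≡⟨ ⊛-distribʳ (λ n → f 0 ∧ one n) (shift (1 * d) (dilate d (tail f))) g n ⟩
      ((λ n → f 0 ∧ one n) ⊛ g) n xor (shift (1 * d) (dilate d (tail f)) ⊛ g) n
        ≡⟨ cong₂ _xor_ (trans (⊛-scaleˡ (f 0) one g n) (cong (f 0 ∧_) (⊛-identityˡ g n))) (shift-⊛ (1 * d) (dilate d (tail f)) g n) ⟩
      (f 0 ∧ g n) xor shift (1 * d) (dilate d (tail f) ⊛ g) n ∎

    dilate-⊛ : ∀ f g → dilate d (f ⊛ g) ≗ dilate d f ⊛ dilate d g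
    dilate-⊛ f g n = <-rec (λ n → ∀ f → dilate d (f ⊛ g) n ≡ (dilate d f ⊛ dilate d g) n) step n f
      where
      step : ∀ n → (∀ {k} → k < n → ∀ f → dilate d (f ⊛ g) k ≡ (dilate d f ⊛ dilate d g) k) →
             ∀ f → dilate d (f ⊛ g) n ≡ (dilate d f ⊛ dilate d g) n
      step n ih f = begin
        dilate d (f ⊛ g) n
          ≡⟨ dilate-cong (⊛-unfold f g) n ⟩
        dilate d ((λ n → f 0 ∧ g n) ⊕ shift 1 (tail f ⊛ g)) n
          ≡⟨ dilate-⊕ (λ n → f 0 ∧ g n) (shift 1 (tail f ⊛ g)) n ⟩
        dilate d (λ n → f 0 ∧ g n) n xor dilate d (shift 1 (tail f ⊛ g)) n
          ≡⟨ cong₂ _xor_ (dilate-scale (f 0) g n) (dilate-shift 1 (tail f ⊛ g) n) ⟩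
        (f 0 ∧ dilate d g n) xor shift (1 * d) (dilate d (tail f ⊛ g)) n
          -- Since `1 * d` is positive, the shifted series at n is read only below n, where the
          -- induction hypothesis applies.
          ≡⟨ cong ((f 0 ∧ dilate d g n) xor_) (shift-cong-< (1 * d) {{m*n≢0 1 d}} n (λ k k<n → ih k<n (tail f))) ⟩
        (f 0 ∧ dilate d g n) xor shift (1 * d) (dilate d (tail f) ⊛ dilate d g) n
          ≡⟨ sym (dilate-⊛-unfold f (dilate d g) n) ⟩
        (dilate d f ⊛ dilate d g) n ∎

  dilate-dilate : ∀ a b .{{_ : NonZero a}} .{{_ : NonZero b}} .{{_ : NonZero (b * a)}} f →
                  dilate a (dilate b f) ≗ dilate (b * a) f
  dilate-dilate a b f n with a ∣? n
  ... | no a∤n = sym (dilate-∤ (b * a) f (λ ba∣n → a∤n (∣-trans (n∣m*n b) ba∣n)))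
  ... | yes (divides k refl) = trans (cong (dilate b f) (m*n/n≡m k a)) (go k)
    where
    go : ∀ k → dilate b f k ≡ dilate (b * a) f (k * a)
    go k with b ∣? k
    ... | no b∤k = sym (dilate-∤ (b * a) f (b∤k ∘ *-cancelʳ-∣ a))
    ... | yes (divides j refl) = trans (cong f (m*n/n≡m j b))
      (trans (sym (dilate-* (b * a) f j)) (cong (dilate (b * a) f) (sym (*-assoc j b a))))

  even odd : Series → Series
  even f n = f (n * 2)
  odd f n = f (suc (n * 2))

  frobenius : ∀ f → f ⊛ f ≗ dilate 2 f
  frobenius f zero = ∧-idem (f 0)
  frobenius f (suc zero) = trans (cong ((f 0 ∧ f 1) xor_) (∧-comm (f 1) (f 0))) (xor-same (f 0 ∧ f 1))
  frobenius f (suc (suc n)) = trans (frobenius-suc² f n)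
    (trans (frobenius (tail f) n) (sym (trans (dilate-unfold 2 f (suc (suc n))) (cong (_xor dilate 2 (tail f) n) (∧-zeroʳ (f 0))))))

  -- A factor in q² does not mix the parities of exponents. Division by such a factor therefore
  -- commutes with extracting even or odd exponents, which drives both dissections of `β₅`.
  even-dilate-⊛ : ∀ f g → even (dilate 2 f ⊛ g) ≗ f ⊛ even g
  even-dilate-⊛ f g zero = refl
  even-dilate-⊛ f g (suc n) = trans (dilate-⊛-unfold 2 f g (suc n * 2))
    (cong ((f 0 ∧ g (suc n * 2)) xor_) (even-dilate-⊛ (tail f) g n))

  odd-dilate-⊛ : ∀ f g → odd (dilate 2 f ⊛ g) ≗ f ⊛ odd g
  odd-dilate-⊛ f g zero = xor-identityʳ (f 0 ∧ g 1)
  odd-dilate-⊛ f g (suc n) = trans (dilate-⊛-unfold 2 f g (suc (suc n * 2)))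
    (cong ((f 0 ∧ g (suc (suc n * 2))) xor_) (odd-dilate-⊛ (tail f) g n))

  odd-dilate : ∀ f → odd (dilate 2 f) ≗ (λ _ → false)
  odd-dilate f n = dilate-∤ 2 f (λ 2∣ → >⇒∤ (s≤s (s≤s z≤n)) (∣m+n∣m⇒∣n (subst (2 ∣_) (+-comm 1 (n * 2)) 2∣) (n∣m*n n)))

open PowerSeries

-- The pentagonal number theorem modulo 2, and regular partitions

module EulerProducts where

  open import Data.Bool using (Bool; true; false; _xor_; not; if_then_else_; T)
  open import Data.Bool.Properties using (xor-assoc; xor-comm; xor-same; xor-identityʳ; not-distribˡ-xor)
  open import Data.Nat using (ℕ; zero; suc; _+_; _*_; _∸_; _≤_; _<_; _≤ᵇ_; z≤n; s≤s; NonZero; _/_; _≤?_; _≟_; ≢-nonZero⁻¹; >-nonZero⁻¹)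
  open import Data.Nat.Properties
  open import Data.Nat.Divisibility using (_∣_; _∣?_; divides; n∣m*n; ∣m+n∣m⇒∣n; >⇒∤; ∣m⇒∣m*n)
  open import Data.Nat.DivMod using (m/n≤m)
  open import Data.Nat.Induction using (<-rec)
  open import Data.Nat.ListAction using (sum)
  open import Data.Nat.Tactic.RingSolver using (solve-∀)
  open import Data.List using (applyUpTo)
  open import Data.List.Properties using (map-upTo)
  open import Data.Product using (∃; _×_; _,_)
  open import Data.Sum using (_⊎_; inj₁; inj₂)
  open import Data.Empty using (⊥; ⊥-elim)
  open import Relation.Binary.Definitions using (tri<; tri≈; tri>)
  open import Function using (_∘_)
  open import Relation.Nullary using (¬_; yes; no; Dec)
  open import Relation.Nullary.Decidable using (does; dec-true; dec-false; map′)
  open import Relation.Binary.PropositionalEquality using (_≡_; _≢_; _≗_; refl; sym; trans; cong; cong₂; subst; module ≡-Reasoning)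
  open ≡-Reasoning

  private variable
    f g h : Series

  parity : ℕ → Bool
  parity zero = false
  parity (suc n) = not (parity n)

  parity-+ : ∀ m n → parity (m + n) ≡ parity m xor parity n
  parity-+ zero n = refl
  parity-+ (suc m) n = trans (cong not (parity-+ m n)) (not-distribˡ-xor (parity m) (parity n))

  -- Multiplication by the binomial 1 + q^i.
  bin : ℕ → Series → Series
  bin i f = f ⊕ shift i f

  bin-cong : ∀ i → f ≗ g → bin i f ≗ bin i g
  bin-cong i p n = cong₂ _xor_ (p n) (shift-cong i p n)

  shift-bin : ∀ d i f → shift d (bin i f) ≗ bin i (shift d f)
  shift-bin d i f n = trans (shift-⊕ d f (shift i f) n) (cong (shift d f n xor_)
    (trans (shift-shift d i f n) (trans (cong (λ e → shift e f n) (+-comm d i)) (sym (shift-shift i d f n)))))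

  bin-⊕ : ∀ i f g → bin i (f ⊕ g) ≗ bin i f ⊕ bin i g
  bin-⊕ i f g n = trans (cong ((f ⊕ g) n xor_) (shift-⊕ i f g n)) (xor-swap (f n) (g n) _ _)

  bin-comm : ∀ i j f → bin i (bin j f) ≗ bin j (bin i f)
  bin-comm i j f n = trans (bin-⊕ i f (shift j f) n) (cong (bin i f n xor_) (sym (shift-bin j i f n)))

  bin-⊛ : ∀ i f g → bin i f ⊛ g ≗ bin i (f ⊛ g)
  bin-⊛ i f g n = trans (⊛-distribʳ f (shift i f) g n) (cong ((f ⊛ g) n xor_) (shift-⊛ i f g n))

  ⊛-bin : ∀ i f g → f ⊛ bin i g ≗ bin i (f ⊛ g)
  ⊛-bin i f g n = trans (⊛-distribˡ f g (shift i g) n) (cong ((f ⊛ g) n xor_) (⊛-shift i f g n))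

  -- block s j is (1 + q^(s+1)) ⋯ (1 + q^(s+j)).
  block : ℕ → ℕ → Series
  block s zero = one
  block s (suc j) = bin (s + suc j) (block s j)

  -- By definition `block` grows by its largest factor; Shanks' argument also has to adjoin the one
  -- below its smallest.
  block-sucˡ : ∀ s j → bin (suc s) (block (suc s) j) ≗ block s (suc j)
  block-sucˡ s zero n = cong (λ i → bin i one n) (+-comm 1 s)
  block-sucˡ s (suc j) n = begin
    bin (suc s) (bin (suc s + suc j) (block (suc s) j)) n  ≡⟨ bin-comm (suc s) (suc s + suc j) (block (suc s) j) n ⟩
    bin (suc s + suc j) (bin (suc s) (block (suc s) j)) n  ≡⟨ bin-cong (suc s + suc j) (block-sucˡ s j) n ⟩
    bin (suc s + suc j) (block s (suc j)) n                ≡⟨ cong (λ i → bin i (block s (suc j)) n) (sym (+-suc s (suc j))) ⟩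
    bin (s + suc (suc j)) (block s (suc j)) n ∎

  tri : ℕ → ℕ
  tri zero = 0
  tri (suc s) = suc s + tri s

  expo : ℕ → ℕ → ℕ
  expo n s = s * n + tri s

  -- Shanks: ∑_{s ≤ n} q^(sn + s(s+1)/2) ∏_{s < i ≤ n} (1 + q^i) is a partial sum of the pentagonal theta series.
  shanksTerm : ℕ → ℕ → Series
  shanksTerm n s = shift (expo n s) (block s (n ∸ s))

  sumSeries : ℕ → (ℕ → Series) → Series
  sumSeries zero F = λ _ → false
  sumSeries (suc k) F = sumSeries k F ⊕ F k

  shanks : ℕ → Series
  shanks n = sumSeries (suc n) (shanksTerm n)

  -- The boundary terms of a telescoping sum: from m to m + 1 the summand s changes by `carry m s`
  -- plus `carry m (suc s)`, so only the last boundary term survives.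
  carry : ℕ → ℕ → Series
  carry m zero = λ _ → false
  carry m (suc s) = shift (expo m (suc s)) (block s (m ∸ s))

  -- Split off the top factor 1 + q^(m+1) of the longer block. Its part q^(m+1) raises the exponent
  -- to `expo m (suc s)`; its part 1 joins the summand for m to form the factor 1 + q^s, just below
  -- `block s`. For s = 0 that factor is 1 + 1 = 0.
  shanksTerm-diff : ∀ m s → s ≤ m → shanksTerm (suc m) s ⊕ shanksTerm m s ≗ carry m s ⊕ carry m (suc s)
  shanksTerm-diff m s s≤m n = begin
    shanksTerm (suc m) s n xor shanksTerm m s n
      ≡⟨ cong (λ j → shift (expo (suc m) s) (block s j) n xor F m n) (+-∸-assoc 1 s≤m) ⟩
    shift (expo (suc m) s) (bin (s + suc j) (block s j)) n xor F m n
      ≡⟨ cong (λ i → shift (expo (suc m) s) (bin i (block s j)) n xor F m n) (trans (+-suc s j) (cong suc (m+[n∸m]≡n s≤m))) ⟩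
    shift (expo (suc m) s) (bin (suc m) (block s j)) n xor F m n
      ≡⟨ cong (_xor F m n) (shift-⊕ (expo (suc m) s) (block s j) (shift (suc m) (block s j)) n) ⟩
    (F (suc m) n xor shift (expo (suc m) s) (shift (suc m) (block s j)) n) xor F m n
      ≡⟨ cong (λ v → (F (suc m) n xor v) xor F m n) (trans (shift-shift (expo (suc m) s) (suc m) (block s j) n) (cong (λ e → shift e (block s j) n) (expo-suc m s))) ⟩
    (F (suc m) n xor carry m (suc s) n) xor F m n
      ≡⟨ trans (xor-comm (F (suc m) n xor carry m (suc s) n) (F m n)) (sym (xor-assoc (F m n) (F (suc m) n) _)) ⟩
    (F m n xor F (suc m) n) xor carry m (suc s) n
      ≡⟨ cong (λ v → (F m n xor v) xor carry m (suc s) n) (trans (cong (λ e → shift e (block s j) n) (expo-sucˡ m s)) (sym (shift-shift (expo m s) s (block s j) n))) ⟩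
    (F m n xor shift (expo m s) (shift s (block s j)) n) xor carry m (suc s) n
      ≡⟨ cong (_xor carry m (suc s) n) (trans (sym (shift-⊕ (expo m s) (block s j) (shift s (block s j)) n)) (fold s s≤m)) ⟩
    carry m s n xor carry m (suc s) n ∎
    where
    j = m ∸ s
    F : ℕ → Series
    F k = shift (expo k s) (block s j)
    expo-suc : ∀ m s → expo (suc m) s + suc m ≡ expo m (suc s)
    expo-suc m s = identity (tri s) m s
      where
      identity : ∀ t m s → s * suc m + t + suc m ≡ suc s * m + (suc s + t)
      identity = solve-∀
    expo-sucˡ : ∀ m s → expo (suc m) s ≡ expo m s + s
    expo-sucˡ m s = identity (tri s) m s
      where
      identity : ∀ t m s → s * suc m + t ≡ s * m + t + s
      identity = solve-∀
    fold : ∀ s → s ≤ m → shift (expo m s) (bin s (block s (m ∸ s))) n ≡ carry m s n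
    fold zero _ = xor-same (block 0 m n)
    fold (suc s) s<m = shift-cong (expo m (suc s)) (λ k → trans (block-sucˡ s (m ∸ suc s) k)
      (cong (λ j → block s j k) (sym (+-∸-assoc 1 s<m)))) n

  shanks-partial : ∀ m r → r ≤ suc m → sumSeries r (shanksTerm (suc m)) ⊕ sumSeries r (shanksTerm m) ≗ carry m r
  shanks-partial m zero _ n = refl
  shanks-partial m (suc r) (s≤s r≤m) n = begin
    (sumSeries r (shanksTerm (suc m)) n xor shanksTerm (suc m) r n) xor (sumSeries r (shanksTerm m) n xor shanksTerm m r n)
      ≡⟨ xor-swap (sumSeries r (shanksTerm (suc m)) n) _ _ _ ⟩
    (sumSeries r (shanksTerm (suc m)) n xor sumSeries r (shanksTerm m) n) xor (shanksTerm (suc m) r n xor shanksTerm m r n)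
      ≡⟨ cong₂ _xor_ (shanks-partial m r (m≤n⇒m≤1+n r≤m) n) (shanksTerm-diff m r r≤m n) ⟩
    carry m r n xor (carry m r n xor carry m (suc r) n)
      ≡⟨ xor-cancelˡ (carry m r n) _ ⟩
    carry m (suc r) n ∎

  monomial : ℕ → Series
  monomial e = shift e one

  -- With k = m + 1 the two exponents added are the generalised pentagonal numbers k (3 k - 1) / 2
  -- and k (3 k + 1) / 2.
  pentagonal : ℕ → Series
  pentagonal zero = one
  pentagonal (suc m) = pentagonal m ⊕ (monomial (expo m (suc m)) ⊕ monomial (expo (suc m) (suc m)))

  shanks-pentagonal : ∀ n → shanks n ≗ pentagonal n
  shanks-pentagonal zero k = refl
  shanks-pentagonal (suc m) k = begin
    X xor Y                 ≡⟨ sym (xor-cancelˡ Z (X xor Y)) ⟩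
    Z xor (Z xor (X xor Y)) ≡⟨ cong (Z xor_) (sym (xor-assoc Z X Y)) ⟩
    Z xor ((Z xor X) xor Y) ≡⟨ cong (λ v → Z xor (v xor Y)) (xor-comm Z X) ⟩
    Z xor ((X xor Z) xor Y) ≡⟨ cong₂ (λ u v → u xor (v xor Y)) (shanks-pentagonal m k) (shanks-partial m (suc m) ≤-refl k) ⟩
    pentagonal m k xor (carry m (suc m) k xor Y)
      ≡⟨ cong (pentagonal m k xor_) (cong₂ _xor_ (cong (λ j → shift (expo m (suc m)) (block m j) k) (n∸n≡0 m))
                                                (cong (λ j → shift (expo (suc m) (suc m)) (block (suc m) j) k) (n∸n≡0 m))) ⟩
    pentagonal (suc m) k ∎
    where
    X = sumSeries (suc m) (shanksTerm (suc m)) k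
    Y = shanksTerm (suc m) (suc m) k
    Z = shanks m k

  -- Every summand with s ≥ 1 starts at exponent n + 1 or later, so up to exponent n only s = 0, the
  -- whole product, contributes.
  shanks-low : ∀ n k → k ≤ n → shanks n k ≡ block 0 n k
  shanks-low n k k≤n = go n
    where
    go : ∀ r → sumSeries (suc r) (shanksTerm n) k ≡ block 0 n k
    go zero = refl
    go (suc r) = trans (cong₂ _xor_ (go r) (shift-< (block (suc r) (n ∸ suc r)) k<)) (xor-identityʳ _)
      where
      k< : k < expo n (suc r)
      k< = ≤-trans (s≤s k≤n) (≤-trans (≤-reflexive (+-comm 1 n)) (+-mono-≤ (m≤m+n n (r * n)) (s≤s z≤n)))

  IsSquare : ℕ → Set
  IsSquare N = ∃ λ x → x * x ≡ N

  x≤x*x : ∀ x → x ≤ x * x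
  x≤x*x zero = z≤n
  x≤x*x (suc x) = m≤m+n (suc x) (x * suc x)

  square? : ∀ N → Dec (IsSquare N)
  square? N = map′ (λ (x , _ , eq) → x , eq) (λ (x , eq) → x , s≤s (subst (x ≤_) eq (x≤x*x x)) , eq)
    (anyUpTo? (λ x → x * x ≟ N) (suc N))

  square-injective : ∀ {x y} → x * x ≡ y * y → x ≡ y
  square-injective {x} {y} eq with <-cmp x y
  ... | tri< x<y _ _ = ⊥-elim (<⇒≢ (*-mono-< x<y x<y) eq)
  ... | tri≈ _ x≡y _ = x≡y
  ... | tri> _ _ y<x = ⊥-elim (<⇒≢ (*-mono-< y<x y<x) (sym eq))

  -- The series E(q), since 24 k + 1 is a square exactly at the generalised pentagonal numbers. The
  -- criterion by squares is the form in which products later become counts of solutions.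
  θ : Series
  θ k = does (square? (24 * k + 1))

  does-true⇒ : ∀ {P : Set} (P? : Dec P) → does P? ≡ true → P
  does-true⇒ (yes p) _ = p

  false≢true : false ≢ true
  false≢true ()

  Bool-ext : ∀ {a b} → (a ≡ true → b ≡ true) → (b ≡ true → a ≡ true) → a ≡ b
  Bool-ext {true} {true} _ _ = refl
  Bool-ext {false} {false} _ _ = refl
  Bool-ext {true} {false} f _ = sym (f refl)
  Bool-ext {false} {true} _ g = g refl

  ¬true⇒false : ∀ {a} → (a ≡ true → ⊥) → a ≡ false
  ¬true⇒false {true} p = ⊥-elim (p refl)
  ¬true⇒false {false} _ = refl

  monomial-self : ∀ e → monomial e e ≡ true
  monomial-self zero = refl
  monomial-self (suc e) = monomial-self e

  monomial-true : ∀ e k → monomial e k ≡ true → k ≡ e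
  monomial-true zero zero _ = refl
  monomial-true (suc e) (suc k) p = cong suc (monomial-true e k p)

  tri-closed : ∀ s → tri s + tri s ≡ s * suc s
  tri-closed zero = refl
  tri-closed (suc s) = trans (identity s (tri s)) (trans (cong (λ v → v + (suc s + suc s)) (tri-closed s)) (identity′ s))
    where
    identity : ∀ s t → suc s + t + (suc s + t) ≡ t + t + (suc s + suc s)
    identity = solve-∀
    identity′ : ∀ s → s * suc s + (suc s + suc s) ≡ suc s * suc (suc s)
    identity′ = solve-∀

  expo-square : ∀ n s → 24 * expo n s + 1 ≡ 24 * (s * n) + 12 * (s * suc s) + 1
  expo-square n s = trans (identity (s * n) (tri s)) (cong (λ v → 24 * (s * n) + 12 * v + 1) (tri-closed s))
    where
    identity : ∀ a t → 24 * (a + t) + 1 ≡ 24 * a + 12 * (t + t) + 1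
    identity = solve-∀

  expo-square⁻ : ∀ m → 24 * expo m (suc m) + 1 ≡ (6 * m + 5) * (6 * m + 5)
  expo-square⁻ m = trans (expo-square m (suc m)) (identity m)
    where
    identity : ∀ m → 24 * (suc m * m) + 12 * (suc m * suc (suc m)) + 1 ≡ (6 * m + 5) * (6 * m + 5)
    identity = solve-∀

  expo-square⁺ : ∀ m → 24 * expo (suc m) (suc m) + 1 ≡ (6 * m + 7) * (6 * m + 7)
  expo-square⁺ m = trans (expo-square (suc m) (suc m)) (identity m)
    where
    identity : ∀ m → 24 * (suc m * suc m) + 12 * (suc m * suc (suc m)) + 1 ≡ (6 * m + 7) * (6 * m + 7)
    identity = solve-∀

  ∤24k+1 : ∀ d j k → d * j ≡ 24 → 1 < d → ¬ d ∣ 24 * k + 1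
  ∤24k+1 d j k dj≡24 1<d d∣ = >⇒∤ 1<d (∣m+n∣m⇒∣n d∣ (∣m⇒∣m*n k (divides j (trans (sym dj≡24) (*-comm d j)))))

  -- A root of 24 k + 1 is prime to 6, and among 6 m + 2, ..., 6 m + 7 only 6 m + 5 and 6 m + 7 are.
  root-gap : ∀ m k x → x * x ≡ 24 * k + 1 → x ≤ 6 * m + 7 → x ≤ 6 * m + 1 ⊎ x ≡ 6 * m + 5 ⊎ x ≡ 6 * m + 7
  root-gap m k x eq x≤ with x ≤? 6 * m + 1
  ... | yes p = inj₁ p
  ... | no x≰ = inj₂ (subst (λ y → y ≡ 6 * m + 5 ⊎ y ≡ 6 * m + 7) xr (cases r (+-cancelˡ-≤ (6 * m + 2) r 5 (subst (_≤ 6 * m + 2 + 5) (sym xr) (≤-trans x≤ (≤-reflexive (sym (+-assoc (6 * m) 2 5))))))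
        (λ d d∣ j dj 1<d → ∤24k+1 d j k dj 1<d (subst (d ∣_) eq (∣m⇒∣m*n x (subst (d ∣_) xr d∣))))))
    where
    r = x ∸ (6 * m + 2)
    xr : 6 * m + 2 + r ≡ x
    xr = m+[n∸m]≡n (subst (_≤ x) (sym (+-suc (6 * m) 1)) (≰⇒> x≰))
    2∣ : ∀ i → 2 ∣ 6 * m + 2 + i * 2
    2∣ i = divides (3 * m + 1 + i) (identity m i)
      where
      identity : ∀ m i → 6 * m + 2 + i * 2 ≡ (3 * m + 1 + i) * 2
      identity = solve-∀
    cases : ∀ r → r ≤ 5 → (∀ d → d ∣ 6 * m + 2 + r → ∀ j → d * j ≡ 24 → 1 < d → ⊥) →
            6 * m + 2 + r ≡ 6 * m + 5 ⊎ 6 * m + 2 + r ≡ 6 * m + 7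
    cases 0 _ bad = ⊥-elim (bad 2 (2∣ 0) 12 refl (s≤s (s≤s z≤n)))
    cases 1 _ bad = ⊥-elim (bad 3 (divides (2 * m + 1) (identity m)) 8 refl (s≤s (s≤s z≤n)))
      where
      identity : ∀ m → 6 * m + 2 + 1 ≡ (2 * m + 1) * 3
      identity = solve-∀
    cases 2 _ bad = ⊥-elim (bad 2 (2∣ 1) 12 refl (s≤s (s≤s z≤n)))
    cases 3 _ bad = inj₁ (+-assoc (6 * m) 2 3)
    cases 4 _ bad = ⊥-elim (bad 2 (2∣ 2) 12 refl (s≤s (s≤s z≤n)))
    cases 5 _ bad = inj₂ (+-assoc (6 * m) 2 5)
    cases (suc (suc (suc (suc (suc (suc _)))))) (s≤s (s≤s (s≤s (s≤s (s≤s ()))))) _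

  6m+5≤ : ∀ m → 6 * m + 5 ≤ 6 * suc m + 1
  6m+5≤ m = subst (6 * m + 5 ≤_) (identity m) (m≤m+n (6 * m + 5) 2)
    where
    identity : ∀ m → 6 * m + 5 + 2 ≡ 6 * suc m + 1
    identity = solve-∀

  6m+7≡ : ∀ m → 6 * m + 7 ≡ 6 * suc m + 1
  6m+7≡ = solve-∀

  pentagonal-sound : ∀ m k → pentagonal m k ≡ true → ∃ λ x → x ≤ 6 * m + 1 × x * x ≡ 24 * k + 1
  pentagonal-sound zero zero _ = 1 , ≤-refl , refl
  pentagonal-sound (suc m) k p with pentagonal m k in e₁ | monomial (expo m (suc m)) k in e₂ | monomial (expo (suc m) (suc m)) k in e₃
  ... | true | _ | _ = let x , x≤ , eq = pentagonal-sound m k e₁ in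
    x , ≤-trans x≤ (+-monoˡ-≤ 1 (*-monoʳ-≤ 6 (n≤1+n m))) , eq
  ... | false | true | _ = 6 * m + 5 , 6m+5≤ m ,
    trans (sym (expo-square⁻ m)) (cong (λ v → 24 * v + 1) (sym (monomial-true (expo m (suc m)) k e₂)))
  ... | false | false | true = 6 * m + 7 , ≤-reflexive (6m+7≡ m) ,
    trans (sym (expo-square⁺ m)) (cong (λ v → 24 * v + 1) (sym (monomial-true (expo (suc m) (suc m)) k e₃)))

  -- The three summands are added modulo 2, so it matters that exactly one of them is 1: different
  -- roots belong to different exponents, which excludes the other two.
  pentagonal-complete : ∀ m k x → x ≤ 6 * m + 1 → x * x ≡ 24 * k + 1 → pentagonal m k ≡ true
  pentagonal-complete zero zero _ _ _ = refl
  pentagonal-complete zero (suc k) zero _ ()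
  pentagonal-complete zero (suc k) (suc zero) _ eq = ⊥-elim (<⇒≢ (+-mono-≤ {1} {24 * suc k} (*-mono-≤ {1} {24} (s≤s z≤n) (s≤s z≤n)) ≤-refl) eq)
  pentagonal-complete zero (suc k) (suc (suc x)) (s≤s ()) _
  pentagonal-complete (suc m) k x x≤ eq with root-gap m k x eq (subst (x ≤_) (sym (6m+7≡ m)) x≤)
  ... | inj₁ x≤′ = cong₂ _xor_ (pentagonal-complete m k x x≤′ eq) (cong₂ _xor_ no₁ no₂)
    where
    no₁ : monomial (expo m (suc m)) k ≡ false
    no₁ = ¬true⇒false λ p → <⇒≢ (≤-<-trans x≤′ (+-monoʳ-< (6 * m) (s≤s (s≤s z≤n))))
      (square-injective (trans eq (trans (cong (λ v → 24 * v + 1) (monomial-true (expo m (suc m)) k p)) (expo-square⁻ m))))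
    no₂ : monomial (expo (suc m) (suc m)) k ≡ false
    no₂ = ¬true⇒false λ p → <⇒≢ (≤-<-trans x≤′ (+-monoʳ-< (6 * m) (s≤s (s≤s z≤n))))
      (square-injective (trans eq (trans (cong (λ v → 24 * v + 1) (monomial-true (expo (suc m) (suc m)) k p)) (expo-square⁺ m))))
  ... | inj₂ (inj₁ refl) = cong₂ _xor_ no₁ (cong₂ _xor_ (trans (cong (monomial (expo m (suc m))) k≡) (monomial-self (expo m (suc m)))) no₂)
    where
    k≡ : k ≡ expo m (suc m)
    k≡ = *-cancelˡ-≡ _ _ 24 (+-cancelʳ-≡ 1 _ _ (trans (sym eq) (sym (expo-square⁻ m))))
    no₁ : pentagonal m k ≡ false
    no₁ = ¬true⇒false λ p → let y , y≤ , eq′ = pentagonal-sound m k p in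
      <⇒≢ (≤-<-trans y≤ (+-monoʳ-< (6 * m) (s≤s (s≤s z≤n)))) (square-injective (trans eq′ (sym eq)))
    no₂ : monomial (expo (suc m) (suc m)) k ≡ false
    no₂ = ¬true⇒false λ p → <⇒≢ (+-monoʳ-< (6 * m) (s≤s (s≤s (s≤s (s≤s (s≤s (s≤s z≤n)))))))
      (square-injective (trans eq (trans (cong (λ v → 24 * v + 1) (monomial-true (expo (suc m) (suc m)) k p)) (expo-square⁺ m))))
  ... | inj₂ (inj₂ refl) = cong₂ _xor_ no₁ (cong₂ _xor_ no₂ (trans (cong (monomial (expo (suc m) (suc m))) k≡) (monomial-self (expo (suc m) (suc m)))))
    where
    k≡ : k ≡ expo (suc m) (suc m)
    k≡ = *-cancelˡ-≡ _ _ 24 (+-cancelʳ-≡ 1 _ _ (trans (sym eq) (sym (expo-square⁺ m))))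
    no₁ : pentagonal m k ≡ false
    no₁ = ¬true⇒false λ p → let y , y≤ , eq′ = pentagonal-sound m k p in
      <⇒≢ (≤-<-trans y≤ (+-monoʳ-< (6 * m) (s≤s (s≤s z≤n)))) (square-injective (trans eq′ (sym eq)))
    no₂ : monomial (expo m (suc m)) k ≡ false
    no₂ = ¬true⇒false λ p → <⇒≢ (+-monoʳ-< (6 * m) (s≤s (s≤s (s≤s (s≤s (s≤s (s≤s z≤n)))))))
      (square-injective (trans (sym (expo-square⁻ m)) (trans (cong (λ v → 24 * v + 1) (sym (monomial-true (expo m (suc m)) k p))) (sym eq))))

  root-bound : ∀ n k x → k ≤ n → x * x ≡ 24 * k + 1 → x ≤ 6 * n + 1
  root-bound n k x k≤n eq with x ≤? 6 * n + 1
  ... | yes p = p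
  ... | no x≰ = ⊥-elim (<⇒≱ (≤-trans (m≤m+n (suc (24 * n + 1)) (36 * (n * n) + 2))
                                    (≤-trans (≤-reflexive (identity n)) (*-mono-≤ (≰⇒> x≰) (≰⇒> x≰))))
                            (≤-trans (≤-reflexive eq) (+-monoˡ-≤ 1 (*-monoʳ-≤ 24 k≤n))))
    where
    identity : ∀ n → suc (24 * n + 1) + (36 * (n * n) + 2) ≡ suc (6 * n + 1) * suc (6 * n + 1)
    identity = solve-∀

  pentagonal-θ : ∀ n k → k ≤ n → pentagonal n k ≡ θ k
  pentagonal-θ n k k≤n = Bool-ext
    (λ p → let x , _ , eq = pentagonal-sound n k p in dec-true (square? (24 * k + 1)) (x , eq))
    (λ p → let x , eq = does-true⇒ (square? (24 * k + 1)) p in pentagonal-complete n k x (root-bound n k x k≤n eq) eq)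

  block-θ : ∀ n k → k ≤ n → block 0 n k ≡ θ k
  block-θ n k k≤n = trans (sym (shanks-low n k k≤n)) (trans (shanks-pentagonal n k) (pentagonal-θ n k k≤n))

  -- Regular partitions modulo 2

  -- Allowing the part c multiplies a generating function by 1 / (1 - q^c). Here r is the count
  -- without the part c, and `total` is the sum that `regCount` forms over its multiplicity.
  module GeometricSum (c : ℕ) .{{_ : NonZero c}} (r : ℕ → ℕ) where

    summand : ℕ → ℕ → ℕ
    summand n j = if j * c ≤ᵇ n then r (n ∸ j * c) else 0

    partialSum : ℕ → ℕ → ℕ
    partialSum n L = sum (applyUpTo (summand n) L)

    sum-cong : ∀ {f g : ℕ → ℕ} L → f ≗ g → sum (applyUpTo f L) ≡ sum (applyUpTo g L)
    sum-cong zero p = refl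
    sum-cong (suc L) p = cong₂ _+_ (p 0) (sum-cong L (p ∘ suc))

    sum-zero : ∀ {f : ℕ → ℕ} L → (∀ j → f j ≡ 0) → sum (applyUpTo f L) ≡ 0
    sum-zero zero p = refl
    sum-zero (suc L) p = cong₂ _+_ (p 0) (sum-zero L (p ∘ suc))

    partialSum-< : ∀ n L → n < c → partialSum n (suc L) ≡ r n
    partialSum-< n L n<c = trans (cong (r n +_) (sum-zero L vanish)) (+-identityʳ (r n))
      where
      vanish : ∀ j → summand n (suc j) ≡ 0
      vanish j with c + j * c ≤ᵇ n in eq
      ... | false = refl
      ... | true = ⊥-elim (<⇒≱ n<c (≤-trans (m≤m+n c (j * c)) (≤ᵇ⇒≤ _ _ (subst T (sym eq) _))))

    partialSum-+ : ∀ n L → partialSum (c + n) (suc L) ≡ r (c + n) + partialSum n L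
    partialSum-+ n L = cong (r (c + n) +_) (sum-cong L step)
      where
      step : ∀ j → summand (c + n) (suc j) ≡ summand n j
      step j with c + j * c ≤ᵇ c + n in e₁ | j * c ≤ᵇ n in e₂
      ... | true | true = cong r ([m+n]∸[m+o]≡n∸o c n (j * c))
      ... | false | false = refl
      ... | true | false = ⊥-elim (subst T e₂ (≤⇒≤ᵇ (+-cancelˡ-≤ c _ _ (≤ᵇ⇒≤ _ _ (subst T (sym e₁) _)))))
      ... | false | true = ⊥-elim (subst T e₁ (≤⇒≤ᵇ (+-monoʳ-≤ c (≤ᵇ⇒≤ (j * c) n (subst T (sym e₂) _)))))

    -- The range of multiplicities in `regCount` depends on n and runs past the last nonzero term.
    -- Freedom in the upper limit lets the sums at n and at c + n be compared term by term.
    partialSum-stable : ∀ n L → n < L → partialSum n L ≡ partialSum n (suc n)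
    partialSum-stable = <-rec _ step
      where
      step : ∀ n → (∀ {k} → k < n → ∀ L → k < L → partialSum k L ≡ partialSum k (suc k)) →
             ∀ L → n < L → partialSum n L ≡ partialSum n (suc n)
      step n ih (suc L) (s≤s n≤L) with c ≤? n
      ... | no c≰n = trans (partialSum-< n L (≰⇒> c≰n)) (sym (partialSum-< n n (≰⇒> c≰n)))
      ... | yes c≤n = subst (λ n → partialSum n (suc L) ≡ partialSum n (suc n)) (m+[n∸m]≡n c≤n)
          (trans (partialSum-+ k L) (trans (cong (r (c + k) +_) (trans (ih k<n L (≤-trans k<n n≤L)) (sym (ih k<n (c + k) (subst (k <_) (sym (m+[n∸m]≡n c≤n)) k<n)))))
                 (sym (partialSum-+ k (c + k)))))
        where
        k = n ∸ c
        k<n : k < n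
        k<n = ∸-monoʳ-< {o = 0} (>-nonZero⁻¹ c) c≤n

    total : ℕ → ℕ
    total n = partialSum n (suc n)

    bin-total : (parity ∘ r) ≗ bin c (parity ∘ total)
    bin-total n with c ≤? n
    ... | no c≰n = sym (trans (cong₂ _xor_ (cong parity (partialSum-< n n (≰⇒> c≰n))) (shift-< (parity ∘ total) (≰⇒> c≰n))) (xor-identityʳ _))
    ... | yes c≤n = subst (λ n → parity (r n) ≡ bin c (parity ∘ total) n) (m+[n∸m]≡n c≤n) (sym (begin
      parity (total (c + k)) xor shift c (parity ∘ total) (c + k)
        ≡⟨ cong₂ _xor_ (cong parity (trans (partialSum-+ k (c + k)) (cong (r (c + k) +_) (partialSum-stable k (c + k) (m<n+m k (>-nonZero⁻¹ c))))))
                       (shift-+ c (parity ∘ total) k) ⟩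
      parity (r (c + k) + total k) xor parity (total k)
        ≡⟨ cong (_xor parity (total k)) (parity-+ (r (c + k)) (total k)) ⟩
      (parity (r (c + k)) xor parity (total k)) xor parity (total k)
        ≡⟨ trans (xor-assoc (parity (r (c + k))) _ _) (trans (cong (parity (r (c + k)) xor_) (xor-same (parity (total k)))) (xor-identityʳ _)) ⟩
      parity (r (c + k)) ∎))
      where k = n ∸ c

  module Regular (m : ℕ) .{{_ : NonZero m}} where

    G : ℕ → Series
    G k n = parity (regCount m k n)

    G-∣ : ∀ k → m ∣ suc k → G (suc k) ≗ G k
    G-∣ k m∣ n rewrite dec-true (m ∣? suc k) m∣ = refl

    G-∤ : ∀ k → ¬ m ∣ suc k → G k ≗ bin (suc k) (G (suc k))
    G-∤ k m∤ n = trans (bin-total n) (bin-cong (suc k) (λ i → cong parity (unfold i)) n)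
      where
      open GeometricSum (suc k) (regCount m k)
      unfold : ∀ i → total i ≡ regCount m (suc k) i
      unfold i rewrite dec-false (m ∣? suc k) m∤ = cong sum (sym (map-upTo (summand i) (suc i)))

    multiples : ℕ → Series
    multiples zero = one
    multiples (suc k) = if does (m ∣? suc k) then bin (suc k) (multiples k) else multiples k

    G-zero : G 0 ≗ one
    G-zero zero = refl
    G-zero (suc n) = refl

    multiples-∣ : ∀ k → m ∣ suc k → multiples (suc k) ≗ bin (suc k) (multiples k)
    multiples-∣ k m∣ n rewrite dec-true (m ∣? suc k) m∣ = refl

    multiples-∤ : ∀ k → ¬ m ∣ suc k → multiples (suc k) ≗ multiples k
    multiples-∤ k m∤ n rewrite dec-false (m ∣? suc k) m∤ = refl

    -- The identity E(q) ∑ b_m(n) q^n = E(q^m), truncated at parts up to k: at a permitted part the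
    -- factor 1 + q^k cancels a geometric series, at a multiple of m it survives into `multiples`.
    block-⊛-G : ∀ k → block 0 k ⊛ G k ≗ multiples k
    block-⊛-G zero n = trans (⊛-identityˡ (G 0) n) (G-zero n)
    block-⊛-G (suc k) n = trans (bin-⊛ (suc k) (block 0 k) (G (suc k)) n) (step (m ∣? suc k))
      where
      step : Dec (m ∣ suc k) → bin (suc k) (block 0 k ⊛ G (suc k)) n ≡ multiples (suc k) n
      step (yes m∣) = trans
        (bin-cong (suc k) (λ i → trans (⊛-cong {f = block 0 k} (λ _ → refl) (G-∣ k m∣) i) (block-⊛-G k i)) n)
        (sym (multiples-∣ k m∣ n))
      step (no m∤) = trans (sym (⊛-bin (suc k) (block 0 k) (G (suc k)) n))
        (trans (⊛-cong {f = block 0 k} (λ _ → refl) (λ i → sym (G-∤ k m∤ i)) n)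
          (trans (block-⊛-G k n) (sym (multiples-∤ k m∤ n))))

    multiples-gap : ∀ j i → i < m → multiples (i + j * m) ≗ multiples (j * m)
    multiples-gap j zero _ n = refl
    multiples-gap j (suc i) i<m n = trans
      (multiples-∤ (i + j * m) (λ m∣ → >⇒∤ i<m (∣m+n∣m⇒∣n (subst (m ∣_) (+-comm (suc i) (j * m)) m∣) (n∣m*n j))) n)
      (multiples-gap j i (<⇒≤ i<m) n)

    multiples-suc : ∀ j → multiples (suc j * m) ≗ bin (suc j * m) (multiples (j * m))
    multiples-suc j n = go m refl
      where
      go : ∀ m′ → m′ ≡ m → multiples (m′ + j * m) n ≡ bin (m′ + j * m) (multiples (j * m)) n
      go zero 0≡m = ⊥-elim (≢-nonZero⁻¹ m (sym 0≡m))
      go (suc i) eq = trans (multiples-∣ (i + j * m) (subst (λ v → m ∣ v + j * m) (sym eq) (n∣m*n (suc j))) n)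
        (bin-cong (suc i + j * m) (multiples-gap j i (≤-reflexive eq)) n)

    multiples-dilate : ∀ j → multiples (j * m) ≗ dilate m (block 0 j)
    multiples-dilate zero n = sym (dilate-one m n)
    multiples-dilate (suc j) n = begin
      multiples (suc j * m) n                    ≡⟨ multiples-suc j n ⟩
      bin (suc j * m) (multiples (j * m)) n      ≡⟨ bin-cong (suc j * m) (multiples-dilate j) n ⟩
      dilate m (block 0 j) n xor shift (suc j * m) (dilate m (block 0 j)) n
        ≡⟨ cong (dilate m (block 0 j) n xor_) (sym (dilate-shift m (suc j) (block 0 j) n)) ⟩
      dilate m (block 0 j) n xor dilate m (shift (suc j) (block 0 j)) n
        ≡⟨ sym (dilate-⊕ m (block 0 j) (shift (suc j) (block 0 j)) n) ⟩
      dilate m (block 0 (suc j)) n ∎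

    β : Series
    β n = parity (b m n)

    G-stable : ∀ n i → G (i + n) n ≡ β n
    G-stable n zero = refl
    G-stable n (suc i) = step (m ∣? suc (i + n))
      where
      step : Dec (m ∣ suc (i + n)) → G (suc (i + n)) n ≡ β n
      step (yes m∣) = trans (G-∣ (i + n) m∣ n) (G-stable n i)
      step (no m∤) = trans (sym (trans (G-∤ (i + n) m∤ n) (trans (cong (G (suc (i + n)) n xor_) (shift-< (G (suc (i + n))) (s≤s (m≤n+m n i)))) (xor-identityʳ _)))) (G-stable n i)

    θ-⊛-β : θ ⊛ β ≗ dilate m θ
    θ-⊛-β n = begin
      (θ ⊛ β) n
        -- The truncation is at `n * m`, not n: `multiples-dilate` wants a multiple of m, and this
        -- one is at least n.
        ≡⟨ ⊛-cong-≤ n (λ k k≤n → sym (block-θ (n * m) k (≤-trans k≤n (m≤m*n n m))))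
                      (λ k k≤n → sym (trans (cong (λ v → G v k) (sym (m∸n+n≡m (≤-trans k≤n (m≤m*n n m))))) (G-stable k (n * m ∸ k)))) ⟩
      (block 0 (n * m) ⊛ G (n * m)) n ≡⟨ block-⊛-G (n * m) n ⟩
      multiples (n * m) n             ≡⟨ multiples-dilate n n ⟩
      dilate m (block 0 n) n          ≡⟨ low ⟩
      dilate m θ n ∎
      where
      low : dilate m (block 0 n) n ≡ dilate m θ n
      low with m ∣? n
      ... | yes _ = block-θ n (n / m) (m/n≤m n m)
      ... | no _ = refl

open EulerProducts

-- Counting by duplicate-free lists, and coefficients of products as counts

module Cardinality where

  open import Data.Bool using (true; false; _∧_; _xor_)
  open import Data.Nat using (ℕ; zero; suc; _+_; _*_; _∸_; _≤_; z≤n; s≤s; NonZero; _/_)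
  open import Data.Nat.Properties
  open import Data.Nat.Divisibility using (_∣?_; divides)
  open import Data.Nat.DivMod using (m*n/n≡m)
  open import Data.List using (List; []; _∷_; _++_; [_]; map; filter; length; upTo; cartesianProduct)
  open import Data.List.Properties using (length-map; length-++)
  open import Data.List.Relation.Unary.Unique.Propositional using (Unique)
  open import Data.List.Relation.Unary.Unique.Propositional.Properties using (++⁺; filter⁺; upTo⁺; cartesianProduct⁺; Unique[x∷xs]⇒x∉xs)
  open import Data.List.Relation.Unary.AllPairs using ([]; _∷_)
  open import Data.List.Relation.Unary.All as All using (All; []; _∷_)
  open import Data.List.Relation.Unary.Any using (here; there)
  open import Data.List.Membership.Propositional using (_∈_)
  open import Data.List.Membership.Propositional.Properties using (∈-∃++; ∈-++⁻; ∈-++⁺ˡ; ∈-++⁺ʳ; ∈-map⁻; ∈-map⁺; ∈-filter⁺; ∈-filter⁻; ∈-upTo⁺; ∈-cartesianProduct⁺)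
  open import Data.List.Relation.Binary.Subset.Propositional using (_⊆_)
  open import Data.Product using (∃; ∃₂; _×_; _,_; proj₁; proj₂)
  open import Data.Sum using (_⊎_; inj₁; inj₂; [_,_]′)
  open import Data.Empty using (⊥; ⊥-elim)
  open import Function using (_∘_; id)
  open import Relation.Nullary using (¬_; yes; no)
  open import Relation.Nullary.Decidable using (dec-true)
  open import Relation.Unary using (Decidable)
  open import Relation.Binary.PropositionalEquality using (_≡_; _≢_; refl; sym; trans; cong; cong₂; subst; subst₂; module ≡-Reasoning)
  open ≡-Reasoning

  length-⊆ : ∀ {A : Set} {xs ys : List A} → Unique xs → xs ⊆ ys → length xs ≤ length ys
  length-⊆ {xs = []} _ _ = z≤n
  length-⊆ {xs = x ∷ xs} u@(_ ∷ uxs) xs⊆ys with as , bs , refl ← ∈-∃++ (xs⊆ys (here refl)) =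
    subst (suc (length xs) ≤_) (sym (trans (length-++ as) (+-suc (length as) (length bs))))
      (s≤s (subst (length xs ≤_) (length-++ as) (length-⊆ uxs rest)))
    where
    rest : xs ⊆ as ++ bs
    rest {y} y∈xs with ∈-++⁻ as (xs⊆ys (there y∈xs))
    ... | inj₁ y∈as = ∈-++⁺ˡ y∈as
    ... | inj₂ (here refl) = ⊥-elim (Unique[x∷xs]⇒x∉xs u y∈xs)
    ... | inj₂ (there y∈bs) = ∈-++⁺ʳ as y∈bs

  map-unique : ∀ {A B : Set} (f : A → B) {xs} → (∀ {x y} → x ∈ xs → y ∈ xs → f x ≡ f y → x ≡ y) →
               Unique xs → Unique (map f xs)
  map-unique f inj [] = []
  map-unique f {x ∷ xs} inj u@(_ ∷ uxs) =
    All.tabulate (λ fy∈ fx≡ → let y , y∈ , eq = ∈-map⁻ f fy∈ in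
      Unique[x∷xs]⇒x∉xs u (subst (_∈ xs) (sym (inj (here refl) (there y∈) (trans fx≡ eq))) y∈))
    ∷ map-unique f (λ x∈ y∈ → inj (there x∈) (there y∈)) uxs

  -- Cardinality as a relation: `Card-unique` makes k depend on P alone, so two descriptions of one
  -- finite set yield an equation between numbers.
  record Card {A : Set} (P : A → Set) (k : ℕ) : Set where
    field
      elements : List A
      unique   : Unique elements
      sound    : ∀ {a} → a ∈ elements → P a
      complete : ∀ {a} → P a → a ∈ elements
      size     : length elements ≡ k

  module _ {A : Set} where

    Card-unique : ∀ {P : A → Set} {k l} → Card P k → Card P l → k ≡ l
    Card-unique C D = ≤-antisym (le C D) (le D C)
      where
      le : ∀ {k l} → Card _ k → Card _ l → k ≤ l
      le C D = subst₂ _≤_ (Card.size C) (Card.size D) (length-⊆ (Card.unique C) (Card.complete D ∘ Card.sound C))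

    Card-dec : ∀ {P : A → Set} → Decidable P → (xs : List A) → Unique xs → (∀ a → P a → a ∈ xs) → ∃ (Card P)
    Card-dec P? xs u c = _ , record
      { elements = filter P? xs ; unique = filter⁺ P? u
      ; sound = proj₂ ∘ ∈-filter⁻ P? {xs = xs} ; complete = λ p → ∈-filter⁺ P? (c _ p) p ; size = refl }

    Card-empty : ∀ {P : A → Set} → (∀ a → ¬ P a) → Card P 0
    Card-empty ¬P = record
      { elements = [] ; unique = [] ; sound = λ () ; complete = λ p → ⊥-elim (¬P _ p) ; size = refl }

    Card-singleton : ∀ {P : A → Set} a → P a → (∀ x → P x → x ≡ a) → Card P 1
    Card-singleton {P} a p only = record
      { elements = [ a ] ; unique = [] ∷ [] ; sound = λ { (here refl) → p }
      ; complete = λ q → here (only _ q) ; size = refl }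

    Card-union : ∀ {P Q R : A → Set} {k l} → Card P k → Card Q l → (∀ a → P a → Q a → ⊥) →
                 (∀ a → P a → R a) → (∀ a → Q a → R a) → (∀ a → R a → P a ⊎ Q a) → Card R (k + l)
    Card-union C D disj p q r = record
      { elements = C.elements ++ D.elements
      ; unique = ++⁺ C.unique D.unique (λ (c , d) → disj _ (C.sound c) (D.sound d))
      ; sound = [ p _ ∘ C.sound , q _ ∘ D.sound ]′ ∘ ∈-++⁻ C.elements
      ; complete = [ ∈-++⁺ˡ ∘ C.complete , ∈-++⁺ʳ C.elements ∘ D.complete ]′ ∘ r _
      ; size = trans (length-++ C.elements) (cong₂ _+_ C.size D.size) }
      where
      module C = Card C
      module D = Card D

  Card-image : ∀ {A B : Set} {P : A → Set} {Q : B → Set} {k} → Card P k → (f : A → B) →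
               (∀ a → P a → Q (f a)) → (∀ a a′ → P a → P a′ → f a ≡ f a′ → a ≡ a′) →
               (∀ b → Q b → ∃ λ a → P a × f a ≡ b) → Card Q k
  Card-image {Q = Q} C f maps inj surj = record
    { elements = map f C.elements
    ; unique = map-unique f (λ a∈ b∈ → inj _ _ (C.sound a∈) (C.sound b∈)) C.unique
    ; sound = λ b∈ → let a , a∈ , eq = ∈-map⁻ f b∈ in subst Q (sym eq) (maps _ (C.sound a∈))
    ; complete = λ q → let a , p , eq = surj _ q in subst (_∈ map f C.elements) eq (∈-map⁺ f (C.complete p))
    ; size = trans (length-map f C.elements) C.size }
    where module C = Card C

  Card-box : ∀ {P : ℕ × ℕ → Set} → Decidable P → ∀ N → (∀ x y → P (x , y) → x ≤ N × y ≤ N) → ∃ (Card P)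
  Card-box P? N bound = Card-dec P? (cartesianProduct (upTo (suc N)) (upTo (suc N)))
    (cartesianProduct⁺ (upTo⁺ (suc N)) (upTo⁺ (suc N)))
    (λ (x , y) p → let x≤N , y≤N = bound x y p in ∈-cartesianProduct⁺ (∈-upTo⁺ (s≤s x≤N)) (∈-upTo⁺ (s≤s y≤N)))

  ∧-true : ∀ {a b} → a ≡ true → b ≡ true → a ∧ b ≡ true
  ∧-true refl refl = refl

  ∧-true⁻ : ∀ {a b} → a ∧ b ≡ true → a ≡ true × b ≡ true
  ∧-true⁻ {true} {true} _ = refl , refl

  Products : Series → Series → ℕ → ℕ × ℕ → Set
  Products f g n (i , j) = i + j ≡ n × f i ≡ true × g j ≡ true

  ⊛-parity : ∀ f g n → ∃ λ k → Card (Products f g n) k × parity k ≡ (f ⊛ g) n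
  ⊛-parity f g zero with f 0 ∧ g 0 in eq
  ... | true = 1 , Card-singleton (0 , 0) (refl , ∧-true⁻ eq) (λ { (zero , zero) _ → refl }) , refl
  ... | false = 0 , Card-empty (λ { (zero , zero) (_ , p , q) → false≢true (trans (sym eq) (∧-true p q)) }) , refl
  ⊛-parity f g (suc n) with ⊛-parity (tail f) g n | f 0 ∧ g (suc n) in eq
  ... | k , C , par | true = suc k ,
    Card-union {P = λ ij → ij ≡ (0 , suc n)} (Card-singleton (0 , suc n) refl (λ _ → id))
      (Card-image {Q = λ (i , j) → i ≢ 0 × Products f g (suc n) (i , j)} C (λ (i , j) → suc i , j)
        (λ _ (s , p , q) → (λ ()) , cong suc s , p , q)
        (λ { _ _ _ _ refl → refl })
        (λ { (zero , _) (i≢0 , _) → ⊥-elim (i≢0 refl) ; (suc i , j) (_ , s , p , q) → (i , j) , (suc-injective s , p , q) , refl }))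
      (λ { _ refl (i≢0 , _) → i≢0 refl }) (λ { _ refl → refl , ∧-true⁻ eq }) (λ _ → proj₂)
      (λ { (zero , j) (s , _) → inj₁ (cong (0 ,_) s) ; (suc i , j) p → inj₂ ((λ ()) , p) })
    , trans (parity-+ 1 k) (cong (true xor_) par)
  ... | k , C , par | false = k ,
    Card-image C (λ (i , j) → suc i , j)
        (λ _ (s , p , q) → cong suc s , p , q)
        (λ { _ _ _ _ refl → refl })
        (λ { (zero , _) (refl , p , q) → ⊥-elim (false≢true (trans (sym eq) (∧-true p q))) ; (suc i , j) (s , p , q) → (i , j) , (suc-injective s , p , q) , refl })
    , par

  dilate-true : ∀ d .{{_ : NonZero d}} f {n} → dilate d f n ≡ true → ∃ λ k → k * d ≡ n × f k ≡ true
  dilate-true d f {n} p with d ∣? n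
  ... | yes (divides k refl) = k , refl , trans (cong f (sym (m*n/n≡m k d))) p
  dilate-true d f {n} () | no _

  -- The exponents of θ are the i such that 24 i + 1 is a square.
  RootPairs : ℕ → ℕ → ℕ → ℕ × ℕ → Set
  RootPairs c d n (x , y) = ∃₂ λ i j → x * x ≡ 24 * i + 1 × y * y ≡ 24 * j + 1 × i * c + j * d ≡ n

  -- A natural number is determined by its square, hence by the i with x² = 24 i + 1; root pairs
  -- thus correspond to the pairs of exponents that contribute to coefficient n.
  θθ-parity : ∀ c d .{{_ : NonZero c}} .{{_ : NonZero d}} n {k} → Card (RootPairs c d n) k →
              (dilate c θ ⊛ dilate d θ) n ≡ parity k
  θθ-parity c d n C =
    let l , D , par = ⊛-parity (dilate c θ) (dilate d θ) n in
    trans (sym par) (cong parity (Card-unique D (Card-image C exponents maps inj surj)))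
    where
    index : ℕ → ℕ
    index x = (x * x ∸ 1) / 24
    exponents : ℕ × ℕ → ℕ × ℕ
    exponents (x , y) = index x * c , index y * d
    index-root : ∀ x i → x * x ≡ 24 * i + 1 → index x ≡ i
    index-root x i eq = begin
      (x * x ∸ 1) / 24       ≡⟨ cong (λ v → (v ∸ 1) / 24) eq ⟩
      (24 * i + 1 ∸ 1) / 24  ≡⟨ cong (_/ 24) (trans (m+n∸n≡m (24 * i) 1) (*-comm 24 i)) ⟩
      i * 24 / 24            ≡⟨ m*n/n≡m i 24 ⟩
      i ∎
    term-true : ∀ e .{{_ : NonZero e}} x i → x * x ≡ 24 * i + 1 → dilate e θ (index x * e) ≡ true
    term-true e x i eq = trans (cong (λ v → dilate e θ (v * e)) (index-root x i eq))
      (trans (dilate-* e θ i) (dec-true (square? (24 * i + 1)) (x , eq)))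
    maps : ∀ xy → RootPairs c d n xy → Products (dilate c θ) (dilate d θ) n (exponents xy)
    maps (x , y) (i , j , p , q , s) =
      trans (cong₂ (λ u v → u * c + v * d) (index-root x i p) (index-root y j q)) s , term-true c x i p , term-true d y j q
    index-inj : ∀ e .{{_ : NonZero e}} x x′ i i′ → x * x ≡ 24 * i + 1 → x′ * x′ ≡ 24 * i′ + 1 → index x * e ≡ index x′ * e → x ≡ x′
    index-inj e x x′ i i′ p p′ eq = square-injective (trans p (trans (cong (λ v → 24 * v + 1)
      (trans (sym (index-root x i p)) (trans (*-cancelʳ-≡ (index x) (index x′) e eq) (index-root x′ i′ p′)))) (sym p′)))
    inj : ∀ xy xy′ → RootPairs c d n xy → RootPairs c d n xy′ → exponents xy ≡ exponents xy′ → xy ≡ xy′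
    inj (x , y) (x′ , y′) (i , j , p , q , _) (i′ , j′ , p′ , q′ , _) eq =
      cong₂ _,_ (index-inj c x x′ i i′ p p′ (cong proj₁ eq)) (index-inj d y y′ j j′ q q′ (cong proj₂ eq))
    surj : ∀ ab → Products (dilate c θ) (dilate d θ) n ab → ∃ λ xy → RootPairs c d n xy × exponents xy ≡ ab
    surj (a , b) (s , p , q) =
      let i , ia , pi = dilate-true c θ p
          j , jb , pj = dilate-true d θ q
          x , ex = does-true⇒ (square? (24 * i + 1)) pi
          y , ey = does-true⇒ (square? (24 * j + 1)) pj
      in (x , y) , (i , j , ex , ey , trans (cong₂ _+_ ia jb) s) ,
         cong₂ _,_ (trans (cong (_* c) (index-root x i ex)) ia) (trans (cong (_* d) (index-root y j ey)) jb)

open Cardinality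

-- Signs of solutions, and multiplication by 1 + √-d

module QuadraticForms where

  open import Data.Bool using (true; false; _xor_)
  open import Data.Bool.Properties using (xor-same)
  open import Data.Nat as ℕ using (ℕ; zero; suc; z≤n; s≤s; NonZero)
  import Data.Nat.Properties as ℕP
  import Data.Nat.Divisibility as ℕD
  open import Data.Nat.Primality using (Prime; prime?; euclidsLemma)
  import Data.Nat.Tactic.RingSolver as ℕSolver
  open import Data.Integer using (ℤ; +_; -[1+_]; +0; -_; _+_; _-_; _*_; ∣_∣)
  import Data.Integer.Properties as ℤP
  open import Data.Integer.Divisibility.Signed using (divides; ∣⇒∣ᵤ; ∣ᵤ⇒∣; ∣m∣n⇒∣m+n; ∣m∣n⇒∣m-n; ∣m⇒∣-m; ∣m⇒∣m*n) renaming (_∣_ to _∣ᶻ_; _∣?_ to _∣ᶻ?_)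
  open import Data.Integer.Tactic.RingSolver using (solve-∀)
  open import Data.Product using (∃; _×_; _,_; proj₁; proj₂; swap)
  open import Data.Sum using (_⊎_; inj₁; inj₂; [_,_]′; map₂)
  open import Data.Empty using (⊥; ⊥-elim)
  open import Function using (_∘_; id)
  open import Relation.Nullary using (¬_; yes; no; Dec; ¬?)
  open import Relation.Nullary.Decidable using (from-yes; _×-dec_)
  open import Relation.Unary using (Decidable)
  open import Relation.Binary.PropositionalEquality using (_≡_; _≢_; refl; sym; trans; cong; cong₂; subst; module ≡-Reasoning)
  open ≡-Reasoning

  -- Counting integer points by their signs

  Abs : (ℕ × ℕ → Set) → ℤ × ℤ → Set
  Abs P (x , y) = P (∣ x ∣ , ∣ y ∣)

  Card-signs : ∀ {B : Set} {P : ℕ × B → Set} {k} → (∀ b → ¬ P (0 , b)) → Card P k →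
               Card {ℤ × B} (λ (x , b) → P (∣ x ∣ , b)) (k ℕ.+ k)
  Card-signs {B} {P} ¬P0 C = Card-union
    (Card-image {Q = λ (x , b) → P (∣ x ∣ , b) × ∃ λ n → x ≡ + n} C (λ (n , b) → + n , b)
      (λ (n , b) p → p , n , refl) (λ { _ _ _ _ refl → refl })
      (λ { (.(+ n) , b) (p , n , refl) → (n , b) , p , refl }))
    (Card-image {Q = λ (x , b) → P (∣ x ∣ , b) × ∃ λ n → x ≡ -[1+ n ]} C (λ (n , b) → - (+ n) , b)
      (λ { (zero , b) p → ⊥-elim (¬P0 b p) ; (suc n , b) p → p , n , refl })
      (λ (n , b) (n′ , b′) _ _ eq → cong₂ _,_ (ℤP.+-injective (ℤP.neg-injective (cong proj₁ eq))) (cong proj₂ eq))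
      (λ { (.(-[1+ n ]) , b) (p , n , refl) → (suc n , b) , p , refl }))
    (λ { (x , b) (_ , n , refl) (_ , m , ()) }) (λ _ → proj₁) (λ _ → proj₁)
    (λ { (+ n , b) p → inj₁ (p , n , refl) ; (-[1+ n ] , b) p → inj₂ (p , n , refl) })

  Card-swap : ∀ {A B : Set} {P : A × B → Set} {k} → Card P k → Card {B × A} (P ∘ swap) k
  Card-swap C = Card-image C swap (λ _ p → p) (λ { _ _ _ _ refl → refl }) (λ (b , a) p → (a , b) , p , refl)

  Diag : ℕ → ℕ → ℕ → ℕ × ℕ → Set
  Diag a c M (x , y) = a ℕ.* (x ℕ.* x) ℕ.+ c ℕ.* (y ℕ.* y) ≡ M

  Axis : ℕ → ℕ → ℕ → Set
  Axis a M x = a ℕ.* (x ℕ.* x) ≡ M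

  Axis-bound : ∀ a .{{_ : NonZero a}} x → x ℕ.≤ a ℕ.* (x ℕ.* x)
  Axis-bound a x = ℕP.≤-trans (x≤x*x x) (ℕP.m≤n*m (x ℕ.* x) a)

  Diag-bound : ∀ a c M .{{_ : NonZero a}} .{{_ : NonZero c}} x y → Diag a c M (x , y) → x ℕ.≤ M × y ℕ.≤ M
  Diag-bound a c M x y eq =
    ℕP.≤-trans (Axis-bound a x) (subst (a ℕ.* (x ℕ.* x) ℕ.≤_) eq (ℕP.m≤m+n _ _)) ,
    ℕP.≤-trans (Axis-bound c y) (subst (c ℕ.* (y ℕ.* y) ℕ.≤_) eq (ℕP.m≤n+m _ _))

  module _ (a c M : ℕ) .{{a≢0 : NonZero a}} .{{_ : NonZero c}} .{{M≢0 : NonZero M}} where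

    private
      Axis-nonzero : ∀ a → ¬ Axis a M 0
      Axis-nonzero a eq = ℕ.≢-nonZero⁻¹ M (trans (sym eq) (ℕP.*-zeroʳ a))

      interior : ∃ (Card (λ xy → Diag a c M xy × proj₁ xy ≢ 0 × proj₂ xy ≢ 0))
      interior = Card-box (λ (x , y) → (_ ℕ.≟ _) ×-dec ¬? (x ℕ.≟ 0) ×-dec ¬? (y ℕ.≟ 0)) M (λ x y (eq , _) → Diag-bound a c M x y eq)

    -- Points off the axes come in fours and points on them in twos, the origin being excluded by M
    -- ≠ 0. Modulo 4 the total depends on the axes alone.
    Card-Diag : ∀ {α γ} → Card (Axis a M) α → Card (Axis c M) γ →
                ∃ λ k → Card (Abs (Diag a c M)) (((k ℕ.+ k) ℕ.+ (k ℕ.+ k)) ℕ.+ ((α ℕ.+ α) ℕ.+ (γ ℕ.+ γ)))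
    Card-Diag {α} {γ} A C = k , Card-union
        (Card-swap (Card-signs (λ { _ (_ , _ , 0≢0) → 0≢0 refl }) (Card-swap (Card-signs (λ { _ (_ , 0≢0 , _) → 0≢0 refl }) K))))
        (Card-union xAxis yAxis
          (λ { (x , y) (p , refl) (_ , refl) → Axis-nonzero a p })
          (λ { (x , y) (p , refl) → trans (cong (a ℕ.* (∣ x ∣ ℕ.* ∣ x ∣) ℕ.+_) (ℕP.*-zeroʳ c)) (trans (ℕP.+-identityʳ _) p) , inj₁ refl })
          (λ { (x , y) (p , refl) → trans (cong (ℕ._+ c ℕ.* (∣ y ∣ ℕ.* ∣ y ∣)) (ℕP.*-zeroʳ a)) p , inj₂ refl })
          (λ { (x , y) (p , inj₁ refl) → inj₁ (trans (sym (trans (cong (a ℕ.* (∣ x ∣ ℕ.* ∣ x ∣) ℕ.+_) (ℕP.*-zeroʳ c)) (ℕP.+-identityʳ _))) p , refl)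
             ; (x , y) (p , inj₂ refl) → inj₂ (trans (sym (cong (ℕ._+ c ℕ.* (∣ y ∣ ℕ.* ∣ y ∣)) (ℕP.*-zeroʳ a))) p , refl) }))
        (λ { (x , y) (_ , _ , y≢0) (_ , inj₁ refl) → y≢0 refl ; (x , y) (_ , x≢0 , _) (_ , inj₂ refl) → x≢0 refl })
        (λ _ → proj₁) (λ _ → proj₁) split
      where
      k = proj₁ interior
      K = proj₂ interior
      OnAxes : ℤ × ℤ → Set
      OnAxes (x , y) = Abs (Diag a c M) (x , y) × (y ≡ +0 ⊎ x ≡ +0)
      xAxis : Card {ℤ × ℤ} (λ (x , y) → Axis a M ∣ x ∣ × y ≡ +0) (α ℕ.+ α)
      xAxis = Card-signs {P = λ (n , y) → Axis a M n × y ≡ +0} (λ _ (p , _) → Axis-nonzero a p)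
        (Card-image A (λ n → n , +0) (λ _ p → p , refl) (λ { _ _ _ _ refl → refl }) (λ { (n , .+0) (p , refl) → n , p , refl }))
      yAxis : Card {ℤ × ℤ} (λ (x , y) → Axis c M ∣ y ∣ × x ≡ +0) (γ ℕ.+ γ)
      yAxis = Card-swap (Card-signs {P = λ (n , x) → Axis c M n × x ≡ +0} (λ _ (p , _) → Axis-nonzero c p)
        (Card-image C (λ n → n , +0) (λ _ p → p , refl) (λ { _ _ _ _ refl → refl }) (λ { (n , .+0) (p , refl) → n , p , refl })))
      split : ∀ xy → Abs (Diag a c M) xy →
              Abs (λ xy → Diag a c M xy × proj₁ xy ≢ 0 × proj₂ xy ≢ 0) xy ⊎ OnAxes xy
      split (x , y) p with ∣ x ∣ ℕ.≟ 0 | ∣ y ∣ ℕ.≟ 0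
      ... | _ | yes y≡0 = inj₂ (p , inj₁ (ℤP.∣i∣≡0⇒i≡0 y≡0))
      ... | yes x≡0 | no _ = inj₂ (p , inj₂ (ℤP.∣i∣≡0⇒i≡0 x≡0))
      ... | no x≢0 | no y≢0 = inj₁ (p , x≢0 , y≢0)

  -- Each positive point yields two points of C: the right sign of x, times ± 1.
  Card-half : ∀ {P : ℕ × ℕ → Set} {C : ℤ × ℤ → Set} {k} → Decidable C →
              (∀ x y → P (x , y) → x ≢ 0 × y ≢ 0) →
              (∀ x y → C (x , y) → C (- x , - y)) →
              (∀ x y → Abs P (x , y) → C (x , y) ⊎ C (- x , y)) →
              (∀ x y → Abs P (x , y) → C (x , y) → C (- x , y) → ⊥) →
              Card P k → Card (λ xy → Abs P xy × C xy) (k ℕ.+ k)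
  Card-half {P} {C} {k} C? P≢0 C-neg C-some C-excl K = Card-union upper lower
      (λ { (x , y) (_ , _ , n , refl) (_ , _ , m , ()) })
      (λ _ (p , c , _) → p , c) (λ _ (p , c , _) → p , c)
      (λ { (x , + n) (p , c) → inj₁ (p , c , n , refl) ; (x , -[1+ n ]) (p , c) → inj₂ (p , c , n , refl) })
    where
    Upper Lower : ℤ × ℤ → Set
    Upper (x , y) = Abs P (x , y) × C (x , y) × ∃ λ n → y ≡ + n
    Lower (x , y) = Abs P (x , y) × C (x , y) × ∃ λ n → y ≡ -[1+ n ]
    choose : ∀ x y → Dec (C (+ x , + y)) → ℤ × ℤ
    choose x y (yes _) = + x , + y
    choose x y (no _) = - (+ x) , + y
    sign : ℕ × ℕ → ℤ × ℤ
    sign (x , y) = choose x y (C? (+ x , + y))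
    choose-abs : ∀ x y c → (∣ proj₁ (choose x y c) ∣ , ∣ proj₂ (choose x y c) ∣) ≡ (x , y)
    choose-abs x y (yes _) = refl
    choose-abs x y (no _) = cong (_, y) (ℤP.∣-i∣≡∣i∣ (+ x))
    choose-C : ∀ x y c → P (x , y) → C (choose x y c)
    choose-C x y (yes c) p = c
    choose-C x y (no ¬c) p = [ ⊥-elim ∘ ¬c , id ]′ (C-some (+ x) (+ y) p)
    choose-upper : ∀ x y c → ∃ λ n → proj₂ (choose x y c) ≡ + n
    choose-upper x y (yes _) = y , refl
    choose-upper x y (no _) = y , refl
    choose-surj : ∀ x y c → Abs P (x , + y) → C (x , + y) → choose ∣ x ∣ y c ≡ (x , + y)
    choose-surj (+ x) y (yes _) _ _ = refl
    choose-surj (+ x) y (no ¬c) _ c = ⊥-elim (¬c c)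
    choose-surj -[1+ x ] y (yes c′) p c = ⊥-elim (C-excl (+ suc x) (+ y) p c′ c)
    choose-surj -[1+ x ] y (no _) _ _ = refl
    upper : Card Upper k
    upper = Card-image K sign
      (λ (x , y) p → let c = C? (+ x , + y) in subst P (sym (choose-abs x y c)) p , choose-C x y c p , choose-upper x y c)
      (λ (x , y) (x′ , y′) _ _ eq → trans (sym (choose-abs x y (C? _)))
        (trans (cong (λ (u , v) → ∣ u ∣ , ∣ v ∣) eq) (choose-abs x′ y′ (C? _))))
      (λ { (x , .(+ y)) (p , c , y , refl) → (∣ x ∣ , y) , p , choose-surj x y (C? _) p c })
    lower : Card Lower k
    lower = Card-image upper (λ (x , y) → - x , - y)
      (λ { (x , .(+ zero)) (p , c , zero , refl) → ⊥-elim (proj₂ (P≢0 ∣ x ∣ 0 p) refl)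
         ; (x , .(+ suc n)) (p , c , suc n , refl) → subst (λ v → P (v , suc n)) (sym (ℤP.∣-i∣≡∣i∣ x)) p , C-neg x (+ suc n) c , n , refl })
      (λ (x , y) (x′ , y′) _ _ eq → cong₂ _,_ (ℤP.neg-injective (cong proj₁ eq)) (ℤP.neg-injective (cong proj₂ eq)))
      (λ { (x , .(-[1+ n ])) (p , c , n , refl) → (- x , + suc n) ,
           (subst (λ v → P (v , suc n)) (sym (ℤP.∣-i∣≡∣i∣ x)) p , C-neg x -[1+ n ] c , suc n , refl) ,
           cong (_, -[1+ n ]) (ℤP.neg-involutive x) })

  abs-square : ∀ x → + (∣ x ∣ ℕ.* ∣ x ∣) ≡ x * x
  abs-square (+ n) = ℤP.pos-* n n
  abs-square -[1+ n ] = refl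

  diag-cast : ∀ a c x y → + (a ℕ.* (∣ x ∣ ℕ.* ∣ x ∣) ℕ.+ c ℕ.* (∣ y ∣ ℕ.* ∣ y ∣)) ≡ + a * (x * x) + + c * (y * y)
  diag-cast a c x y = cong₂ _+_ (trans (ℤP.pos-* a _) (cong (+ a *_) (abs-square x)))
                                (trans (ℤP.pos-* c _) (cong (+ c *_) (abs-square y)))

  Diag⇒ℤ : ∀ a c M x y → Abs (Diag a c M) (x , y) → + a * (x * x) + + c * (y * y) ≡ + M
  Diag⇒ℤ a c M x y p = trans (sym (diag-cast a c x y)) (cong +_ p)

  ℤ⇒Diag : ∀ a c M x y → + a * (x * x) + + c * (y * y) ≡ + M → Abs (Diag a c M) (x , y)
  ℤ⇒Diag a c M x y p = ℤP.+-injective (trans (diag-cast a c x y) p)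

  prime-∣-* : ∀ {p} → Prime p → ∀ i j → + p ∣ᶻ i * j → + p ∣ᶻ i ⊎ + p ∣ᶻ j
  prime-∣-* {p} pr i j p∣ with euclidsLemma ∣ i ∣ ∣ j ∣ pr (subst (p ℕD.∣_) (ℤP.abs-* i j) (∣⇒∣ᵤ p∣))
  ... | inj₁ q = inj₁ (∣ᵤ⇒∣ q)
  ... | inj₂ q = inj₂ (∣ᵤ⇒∣ q)

  prime[3] : Prime 3
  prime[3] = from-yes (prime? 3)

  double-injective : ∀ {m n} → m ℕ.+ m ≡ n ℕ.+ n → m ≡ n
  double-injective {m} {n} eq = ℕP.*-cancelˡ-≡ m n 2 (trans (cong (m ℕ.+_) (ℕP.+-identityʳ m)) (trans eq (cong (n ℕ.+_) (sym (ℕP.+-identityʳ n)))))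

  parity-double : ∀ n → parity (n ℕ.+ n) ≡ false
  parity-double n = trans (parity-+ n n) (xor-same (parity n))

  -- Multiplication by 1 + √-d identifies the points of norm M with the points (x , y) of norm (1 + d) M such that x ≡ y mod 1 + d.
  module NormForm (d M : ℕ) .{{_ : NonZero d}} .{{_ : NonZero M}}
    (3∣1+d : 3 ℕD.∣ suc d)
    (lift : ∀ x y → Abs (Diag 1 d (suc d ℕ.* M)) (x , y) → + 3 ∣ᶻ x - y → + suc d ∣ᶻ x - y)
    (¬xAxis : ∀ u → ¬ Axis 9 (suc d ℕ.* M) u) (¬yAxis : ∀ t → ¬ Axis (9 ℕ.* d) (suc d ℕ.* M) t) where

    K : ℕ
    K = suc d ℕ.* M

    -- When 3 does not divide y, exactly one of (x , y) and (- x , y) is chosen modulo 3. For d = 5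
    -- divisibility by 1 + √-d also asks for x ≡ y modulo 2, which holds on all points for parity
    -- reasons; `lift` supplies it.
    Congruent : ℤ × ℤ → Set
    Congruent (x , y) = + 3 ∣ᶻ x - y

    Roots : ℕ × ℕ → Set
    Roots (x , y) = Diag 1 d K (x , y) × ¬ 3 ℕD.∣ y

    private
      3∣1+dℤ : + 3 ∣ᶻ + suc d
      3∣1+dℤ = ∣ᵤ⇒∣ 3∣1+d

      3∣K : + 3 ∣ᶻ + K
      3∣K = ∣ᵤ⇒∣ (ℕD.∣m⇒∣m*n M 3∣1+d)

      3∣product : ∀ x y → Abs (Diag 1 d K) (x , y) → + 3 ∣ᶻ (x - y) * (x + y)
      3∣product x y p = subst (+ 3 ∣ᶻ_) (trans (cong (_- + suc d * (y * y)) (sym (Diag⇒ℤ 1 d K x y p))) (identity x y (+ d)))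
        (∣m∣n⇒∣m-n 3∣K (∣m⇒∣m*n (y * y) 3∣1+dℤ))
        where
        identity : ∀ x y D → + 1 * (x * x) + D * (y * y) - (+ 1 + D) * (y * y) ≡ (x - y) * (x + y)
        identity = solve-∀

      cancel-2 : ∀ y → + 3 ∣ᶻ + 2 * y → + 3 ∣ᶻ y
      cancel-2 y p with prime-∣-* prime[3] (+ 2) y p
      ... | inj₁ q = ⊥-elim (ℕD.>⇒∤ (s≤s (s≤s (s≤s z≤n))) (∣⇒∣ᵤ q))
      ... | inj₂ q = q

      nonzero : ∀ x y → Roots (x , y) → x ≢ 0 × y ≢ 0
      nonzero x y (p , 3∤y) = (λ { refl → 3∤y ([ flip , ∣⇒∣ᵤ ]′ (prime-∣-* prime[3] (+ 0 - + y) (+ y) (3∣product (+ 0) (+ y) p))) }) ,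
                              (λ { refl → 3∤y (3 ℕD.∣0) })
        where
        flip : + 3 ∣ᶻ + 0 - + y → 3 ℕD.∣ y
        flip q = subst (3 ℕD.∣_) (trans (cong ∣_∣ (ℤP.+-identityˡ (- (+ y)))) (ℤP.∣-i∣≡∣i∣ (+ y))) (∣⇒∣ᵤ q)

      congruent-neg : ∀ x y → Congruent (x , y) → Congruent (- x , - y)
      congruent-neg x y c = subst (+ 3 ∣ᶻ_) (identity x y) (∣m⇒∣-m c)
        where
        identity : ∀ x y → - (x - y) ≡ - x - - y
        identity = solve-∀

      congruent-some : ∀ x y → Abs Roots (x , y) → Congruent (x , y) ⊎ Congruent (- x , y)
      congruent-some x y (p , _) = map₂ (λ q → subst (+ 3 ∣ᶻ_) (identity x y) (∣m⇒∣-m q))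
        (prime-∣-* prime[3] (x - y) (x + y) (3∣product x y p))
        where
        identity : ∀ x y → - (x + y) ≡ - x - y
        identity = solve-∀

      congruent-excl : ∀ x y → Abs Roots (x , y) → Congruent (x , y) → Congruent (- x , y) → ⊥
      congruent-excl x y (_ , 3∤y) c c′ = 3∤y (∣⇒∣ᵤ (cancel-2 y (subst (+ 3 ∣ᶻ_) (identity x y) (∣m⇒∣-m (∣m∣n⇒∣m+n c c′)))))
        where
        identity : ∀ x y → - ((x - y) + (- x - y)) ≡ + 2 * y
        identity = solve-∀

      -- `Scaled` is the image of multiplication by 1 + √-d. It is split by whether 3 divides y,
      -- because exponents of theta series correspond to coordinates prime to 3 only.
      Scaled Primitive Imprimitive : ℤ × ℤ → Set
      Scaled xy = Abs (Diag 1 d K) xy × Congruent xy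
      Primitive xy = Abs Roots xy × Congruent xy
      Imprimitive xy = Scaled xy × 3 ℕD.∣ ∣ proj₂ xy ∣

      -- The product (w - z √-d) (1 + √-d) = (w + d z) + (w - z) √-d multiplies norms by 1 + d, and
      -- (w + d z) - (w - z) = (1 + d) z recovers z and shows which points are reached.
      scaled : ∀ {k} → Card (Abs (Diag 1 d M)) k → Card Scaled k
      scaled C = Card-image C mult
        (λ (w , z) p → ℤ⇒Diag 1 d K (w + + d * z) (w - z) (trans (norm w z (+ d)) (trans (cong (+ suc d *_) (Diag⇒ℤ 1 d M w z p)) (sym (ℤP.pos-* (suc d) M)))) ,
          subst (+ 3 ∣ᶻ_) (sym (difference w z (+ d))) (∣m⇒∣m*n z 3∣1+dℤ))
        (λ (w , z) (w′ , z′) _ _ eq → inj w z w′ z′ (cong proj₁ eq) (cong proj₂ eq))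
        surj
        where
        mult : ℤ × ℤ → ℤ × ℤ
        mult (w , z) = w + + d * z , w - z
        norm : ∀ w z D → + 1 * ((w + D * z) * (w + D * z)) + D * ((w - z) * (w - z)) ≡ (+ 1 + D) * (+ 1 * (w * w) + D * (z * z))
        norm = solve-∀
        difference : ∀ w z D → w + D * z - (w - z) ≡ (+ 1 + D) * z
        difference = solve-∀
        inj : ∀ w z w′ z′ → w + + d * z ≡ w′ + + d * z′ → w - z ≡ w′ - z′ → (w , z) ≡ (w′ , z′)
        inj w z w′ z′ e₁ e₂ = cong₂ _,_ (trans (restore w z) (trans (cong₂ _+_ e₂ z≡) (sym (restore w′ z′)))) z≡
          where
          z≡ : z ≡ z′
          z≡ = ℤP.*-cancelˡ-≡ (+ suc d) z z′ (trans (sym (difference w z (+ d))) (trans (cong₂ _-_ e₁ e₂) (difference w′ z′ (+ d))))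
          restore : ∀ w z → w ≡ w - z + z
          restore = solve-∀
        surj : ∀ xy → Scaled xy → ∃ λ wz → Abs (Diag 1 d M) wz × mult wz ≡ xy
        surj (x , y) (p , c) with lift x y p c
        ... | divides z eq = (y + z , z) , ℤ⇒Diag 1 d M (y + z) z
              (ℤP.*-cancelˡ-≡ (+ suc d) _ _ (trans (sym (norm (y + z) z (+ d)))
                (trans (cong₂ (λ u v → + 1 * (u * u) + + d * (v * v)) x≡ (second y z)) (trans (Diag⇒ℤ 1 d K x y p) (ℤP.pos-* (suc d) M))))) ,
              cong₂ _,_ x≡ (second y z)
          where
          second : ∀ y z → y + z - z ≡ y
          second = solve-∀
          first : ∀ y z D → y + z + D * z ≡ y + z * (+ 1 + D)
          first = solve-∀
          restore : ∀ x y → y + (x - y) ≡ x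
          restore = solve-∀
          x≡ : y + z + + d * z ≡ x
          x≡ = trans (first y z (+ d)) (trans (cong (λ v → y + v) (sym eq)) (restore x y))

      -- If 3 divides y and x - y, it divides x, and division by 3 leaves points of 9 u² + 9 d t² =
      -- K. None of them lies on an axis by hypothesis, so they come in fours.
      imprimitive : ∃ λ k → Card Imprimitive ((k ℕ.+ k) ℕ.+ (k ℕ.+ k))
      imprimitive with Card-Diag 9 (9 ℕ.* d) K {{_}} {{ℕP.m*n≢0 9 d}} {{ℕP.m*n≢0 (suc d) M}}
                         (Card-empty ¬xAxis) (Card-empty ¬yAxis)
      ... | k , C = k , subst (Card Imprimitive) (ℕP.+-identityʳ _) (Card-image C triple
          (λ (u , t) p → (ℤ⇒Diag 1 d K (+ 3 * u) (+ 3 * t) (trans (scale u t (+ d)) (trans (cong (λ v → + 9 * (u * u) + v * (t * t)) (sym (ℤP.pos-* 9 d))) (Diag⇒ℤ 9 (9 ℕ.* d) K u t p))) ,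
                            divides (u - t) (difference u t)) ,
                           subst (3 ℕD.∣_) (sym (ℤP.abs-* (+ 3) t)) (ℕD.m∣m*n ∣ t ∣))
          (λ (u , t) (u′ , t′) _ _ eq → cong₂ _,_ (ℤP.*-cancelˡ-≡ (+ 3) u u′ (cong proj₁ eq)) (ℤP.*-cancelˡ-≡ (+ 3) t t′ (cong proj₂ eq)))
          surj)
        where
        triple : ℤ × ℤ → ℤ × ℤ
        triple (u , t) = + 3 * u , + 3 * t
        scale : ∀ u t D → + 1 * ((+ 3 * u) * (+ 3 * u)) + D * ((+ 3 * t) * (+ 3 * t)) ≡ + 9 * (u * u) + + 9 * D * (t * t)
        scale = solve-∀
        difference : ∀ u t → + 3 * u - + 3 * t ≡ (u - t) * + 3
        difference = solve-∀
        surj : ∀ xy → Imprimitive xy → ∃ λ ut → Abs (Diag 9 (9 ℕ.* d) K) ut × triple ut ≡ xy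
        surj (x , y) ((p , divides q eq) , 3∣y) with ∣ᵤ⇒∣ {+ 3} {y} 3∣y
        ... | divides t refl = (q + t , t) , ℤ⇒Diag 9 (9 ℕ.* d) K (q + t) t
                (trans (cong (λ v → + 9 * ((q + t) * (q + t)) + v * (t * t)) (ℤP.pos-* 9 d))
                  (trans (sym (scale (q + t) t (+ d))) (trans (cong₂ (λ u v → + 1 * (u * u) + + d * (v * v)) x≡ (ℤP.*-comm (+ 3) t)) (Diag⇒ℤ 1 d K x (t * + 3) p)))) ,
                cong₂ _,_ x≡ (ℤP.*-comm (+ 3) t)
          where
          first : ∀ q t → + 3 * (q + t) ≡ q * + 3 + t * + 3
          first = solve-∀
          restore : ∀ x y → x - y + y ≡ x
          restore = solve-∀
          x≡ : + 3 * (q + t) ≡ x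
          x≡ = trans (first q t) (trans (cong (_+ t * + 3) (sym eq)) (restore x (t * + 3)))

    -- Counting `Scaled` in two ways gives 2 j + 4 l = 4 k + 2 α + 2 γ, where 4 l is the number of
    -- imprimitive points; half of this equation is read modulo 2.
    roots-parity : ∀ {j α γ} → Card Roots j → Card (Axis 1 M) α → Card (Axis d M) γ →
                   parity j ≡ parity α xor parity γ
    roots-parity {j} {α} {γ} J A C =
      let k , T = Card-Diag 1 d M A C
          l , I = imprimitive
          total = Card-union {R = Scaled} (Card-half {C = Congruent} (λ (x , y) → + 3 ∣ᶻ? (x - y)) nonzero congruent-neg congruent-some congruent-excl J) I
                    (λ _ ((_ , 3∤y) , _) (_ , 3∣y) → 3∤y 3∣y)
                    (λ _ ((p , _) , c) → p , c) (λ _ → proj₁) split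
          eq = Card-unique total (scaled T)
          half : j ℕ.+ (l ℕ.+ l) ≡ (k ℕ.+ k) ℕ.+ (α ℕ.+ γ)
          half = double-injective (trans (left j l) (trans eq (sym (right k α γ))))
      in trans (sym (trans (parity-+ j (l ℕ.+ l)) (trans (cong (parity j xor_) (parity-double l)) (xor-falseʳ (parity j)))))
           (trans (cong parity half) (trans (parity-+ (k ℕ.+ k) (α ℕ.+ γ)) (trans (cong (_xor parity (α ℕ.+ γ)) (parity-double k)) (parity-+ α γ))))
      where
      xor-falseʳ : ∀ b → b xor false ≡ b
      xor-falseʳ true = refl
      xor-falseʳ false = refl
      left : ∀ j l → (j ℕ.+ (l ℕ.+ l)) ℕ.+ (j ℕ.+ (l ℕ.+ l)) ≡ (j ℕ.+ j) ℕ.+ ((l ℕ.+ l) ℕ.+ (l ℕ.+ l))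
      left = ℕSolver.solve-∀
      right : ∀ k a c → ((k ℕ.+ k) ℕ.+ (a ℕ.+ c)) ℕ.+ ((k ℕ.+ k) ℕ.+ (a ℕ.+ c)) ≡ ((k ℕ.+ k) ℕ.+ (k ℕ.+ k)) ℕ.+ ((a ℕ.+ a) ℕ.+ (c ℕ.+ c))
      right = ℕSolver.solve-∀
      split : ∀ xy → Scaled xy → Primitive xy ⊎ Imprimitive xy
      split (x , y) (p , c) with 3 ℕD.∣? ∣ y ∣
      ... | yes 3∣y = inj₂ ((p , c) , 3∣y)
      ... | no 3∤y = inj₁ ((p , 3∤y) , c)

open QuadraticForms

-- Products of two theta series, and b₅ on the residue classes modulo 4

module ThetaProducts where

  open import Data.Bool using (true; false; _xor_)
  open import Data.Bool.Properties using (xor-identityʳ)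
  open import Data.Nat using (ℕ; zero; suc; _+_; _*_; _<_; z≤n; s≤s; NonZero; _≟_; _%_; _/_)
  open import Data.Nat.Properties
  open import Data.Nat.Divisibility using (_∣_; divides; ∣m⇒∣m*n; ∣n⇒∣m*n; ∣m∣n⇒∣m+n; ∣m+n∣m⇒∣n; m∣m*n; _∣?_; >⇒∤)
  open import Data.Nat.DivMod using (m≡m%n+[m/n]*n; m%n<n)
  open import Data.Nat.Primality using (Prime; euclidsLemma; prime[2])
  open import Data.Nat.Tactic.RingSolver using (solve-∀)
  import Data.Integer as ℤ
  import Data.Integer.Properties as ℤP
  import Data.Integer.Divisibility.Signed as ℤD
  import Data.Integer.Tactic.RingSolver as ℤSolver
  open import Data.Product using (∃; _×_; _,_)
  open import Data.Sum using (_⊎_; inj₁; inj₂; [_,_]′)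
  open import Data.Empty using (⊥; ⊥-elim)
  open import Function using (id)
  open import Relation.Nullary using (¬_; yes; no; Dec; ¬?)
  open import Relation.Nullary.Decidable using (does; dec-true; dec-false; map′; _×-dec_)
  open import Relation.Binary.PropositionalEquality using (_≡_; _≗_; refl; sym; trans; cong; cong₂; subst; module ≡-Reasoning)
  open ≡-Reasoning

  axis? : ∀ a .{{_ : NonZero a}} M → Dec (∃ (Axis a M))
  axis? a M = map′ (λ (x , _ , p) → x , p)
    (λ (x , p) → x , s≤s (≤-trans (Axis-bound a x) (≤-reflexive p)) , p)
    (anyUpTo? (λ x → a * (x * x) ≟ M) (suc M))

  -- At most one nonnegative point lies on an axis, so the parity of the count records existence.
  Card-Axis : ∀ a .{{_ : NonZero a}} M → ∃ λ α → Card (Axis a M) α × parity α ≡ does (axis? a M)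
  Card-Axis a M = go (axis? a M)
    where
    go : (A? : Dec (∃ (Axis a M))) → ∃ λ α → Card (Axis a M) α × parity α ≡ does A?
    go (yes (x , p)) = 1 , Card-singleton x p (λ y q → square-injective (*-cancelˡ-≡ (y * y) (x * x) a (trans q (sym p)))) , refl
    go (no ¬p) = 0 , Card-empty (λ x p → ¬p (x , p)) , refl

  even⊎odd : ∀ x → (∃ λ k → x ≡ 2 * k) ⊎ (∃ λ k → x ≡ suc (2 * k))
  even⊎odd zero = inj₁ (0 , refl)
  even⊎odd (suc x) with even⊎odd x
  ... | inj₁ (k , refl) = inj₂ (k , refl)
  ... | inj₂ (k , refl) = inj₁ (suc k , sym (*-suc 2 k))

  -- From (r + 12 q)² = r² + 24 (q r + 6 q²), residues modulo 12 decide squares modulo 24; those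
  -- prime to 6 are 1, 5, 7, 11, with squares 1, 25, 49, 121.
  coprime-6-square : ∀ x → ¬ 2 ∣ x → ¬ 3 ∣ x → ∃ λ i → x * x ≡ 24 * i + 1
  coprime-6-square x 2∤x 3∤x = cases (x % 12) (x / 12) (m%n<n x 12) (m≡m%n+[m/n]*n x 12)
    where
    two : ∀ r q → 2 * r + q * 12 ≡ (r + q * 6) * 2
    two = solve-∀
    three : ∀ r q → 3 * r + q * 12 ≡ (r + q * 4) * 3
    three = solve-∀
    unit : ∀ r s q → r * r ≡ 24 * s + 1 → x ≡ r + q * 12 → ∃ λ i → x * x ≡ 24 * i + 1
    unit r s q rr eq = s + q * r + 6 * (q * q) , (begin
      x * x                                    ≡⟨ cong₂ _*_ eq eq ⟩
      (r + q * 12) * (r + q * 12)              ≡⟨ identity r q ⟩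
      r * r + 24 * (q * r + 6 * (q * q))       ≡⟨ cong (_+ 24 * (q * r + 6 * (q * q))) rr ⟩
      24 * s + 1 + 24 * (q * r + 6 * (q * q))  ≡⟨ identity′ s (q * r) (6 * (q * q)) ⟩
      24 * (s + q * r + 6 * (q * q)) + 1 ∎)
      where
      identity : ∀ r q → (r + q * 12) * (r + q * 12) ≡ r * r + 24 * (q * r + 6 * (q * q))
      identity = solve-∀
      identity′ : ∀ s t u → 24 * s + 1 + 24 * (t + u) ≡ 24 * (s + t + u) + 1
      identity′ = solve-∀
    bad₂ : ∀ r q → x ≡ 2 * r + q * 12 → ∃ λ i → x * x ≡ 24 * i + 1
    bad₂ r q eq = ⊥-elim (2∤x (divides (r + q * 6) (trans eq (two r q))))
    bad₃ : ∀ r q → x ≡ 3 * r + q * 12 → ∃ λ i → x * x ≡ 24 * i + 1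
    bad₃ r q eq = ⊥-elim (3∤x (divides (r + q * 4) (trans eq (three r q))))
    cases : ∀ r q → r < 12 → x ≡ r + q * 12 → ∃ λ i → x * x ≡ 24 * i + 1
    cases 0 q _ eq = bad₂ 0 q eq
    cases 1 q _ eq = unit 1 0 q refl eq
    cases 2 q _ eq = bad₂ 1 q eq
    cases 3 q _ eq = bad₃ 1 q eq
    cases 4 q _ eq = bad₂ 2 q eq
    cases 5 q _ eq = unit 5 1 q refl eq
    cases 6 q _ eq = bad₂ 3 q eq
    cases 7 q _ eq = unit 7 2 q refl eq
    cases 8 q _ eq = bad₂ 4 q eq
    cases 9 q _ eq = bad₃ 3 q eq
    cases 10 q _ eq = bad₂ 5 q eq
    cases 11 q _ eq = unit 11 5 q refl eq
    cases (suc (suc (suc (suc (suc (suc (suc (suc (suc (suc (suc (suc _)))))))))))) q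
      (s≤s (s≤s (s≤s (s≤s (s≤s (s≤s (s≤s (s≤s (s≤s (s≤s (s≤s (s≤s ())))))))))))) eq

  3∣square : ∀ y → 3 ∣ y * y → 3 ∣ y
  3∣square y 3∣ = [ id , id ]′ (euclidsLemma y y prime[3] 3∣)

  dilate-1 : ∀ f → dilate 1 f ≗ f
  dilate-1 f n = trans (cong (dilate 1 f) (sym (*-identityʳ n))) (dilate-* 1 f n)

  2∣-odd : ∀ k → ¬ 2 ∣ suc (2 * k)
  2∣-odd k (divides q eq) = even≢odd q k (trans (*-comm 2 q) (sym eq))

  odd⇒2∤ : ∀ {x} k → x ≡ suc (2 * k) → ¬ 2 ∣ x
  odd⇒2∤ k refl = 2∣-odd k

  -- The common setting of both identities: 24 n + 1 + d = (1 + d) M, with M = 8 n + 1 for d = 2 and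
  -- M = 4 n + 1 for d = 5. Oddness of x and y is left to each case; coprimality to 3 follows from
  -- `Roots`.
  module ThetaProduct (d n M : ℕ) .{{_ : NonZero d}} .{{_ : NonZero M}}
    (3∣1+d : 3 ∣ suc d) (size : suc d * M ≡ 24 * n + suc d)
    (lift : ∀ x y → Abs (Diag 1 d (suc d * M)) (x , y) → ℤ.+ 3 ℤD.∣ x ℤ.- y → ℤ.+ suc d ℤD.∣ x ℤ.- y)
    (¬xAxis : ∀ u → ¬ Axis 9 (suc d * M) u) (¬yAxis : ∀ t → ¬ Axis (9 * d) (suc d * M) t)
    (odd-x : ∀ x y → Diag 1 d (suc d * M) (x , y) → ¬ 2 ∣ x)
    (odd-y : ∀ x y → Diag 1 d (suc d * M) (x , y) → ¬ 2 ∣ y) where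

    open NormForm d M 3∣1+d lift ¬xAxis ¬yAxis using (Roots; roots-parity)

    private
      root⇒ : ∀ xy → RootPairs 1 d n xy → Roots xy
      root⇒ (x , y) (i , j , p , q , s) = eq , λ 3∣y → ∤24k+1 3 8 j refl (s≤s (s≤s z≤n)) (subst (3 ∣_) q (∣m⇒∣m*n y 3∣y))
        where
        identity : ∀ i j d → 1 * (24 * i + 1) + d * (24 * j + 1) ≡ 24 * (i * 1 + j * d) + suc d
        identity = solve-∀
        eq : 1 * (x * x) + d * (y * y) ≡ suc d * M
        eq = trans (cong₂ (λ u v → 1 * u + d * v) p q) (trans (identity i j d) (trans (cong (λ v → 24 * v + suc d) s) (sym size)))

      root⇐ : ∀ xy → Roots xy → RootPairs 1 d n xy
      root⇐ (x , y) (eq , 3∤y) =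
        let i , p = coprime-6-square x (odd-x x y eq) 3∤x
            j , q = coprime-6-square y (odd-y x y eq) 3∤y
        in i , j , p , q , *-cancelˡ-≡ _ n 24 (+-cancelʳ-≡ (suc d) _ _ (trans (sym (identity i j d))
             (trans (cong₂ (λ u v → 1 * u + d * v) (sym p) (sym q)) (trans eq size))))
        where
        identity : ∀ i j d → 1 * (24 * i + 1) + d * (24 * j + 1) ≡ 24 * (i * 1 + j * d) + suc d
        identity = solve-∀
        swap-sides : ∀ u v d → (1 * u + d * v) + v ≡ u + suc d * v
        swap-sides = solve-∀
        3∤x : ¬ 3 ∣ x
        3∤x 3∣x = 3∤y (3∣square y (∣m+n∣m⇒∣n
          (subst (3 ∣_) (sym (trans (cong (_+ y * y) (sym eq)) (swap-sides (x * x) (y * y) d))) (∣m∣n⇒∣m+n (∣m⇒∣m*n x 3∣x) (∣m⇒∣m*n (y * y) 3∣1+d)))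
          (∣m⇒∣m*n M 3∣1+d)))

      roots : ∃ (Card Roots)
      roots = Card-box (λ (x , y) → (_ ≟ _) ×-dec ¬? (3 ∣? y)) (suc d * M) (λ x y (eq , _) → Diag-bound 1 d (suc d * M) x y eq)

    coefficient : (θ ⊛ dilate d θ) n ≡ does (axis? 1 M) xor does (axis? d M)
    coefficient =
      let j , J = roots
          α , A , pα = Card-Axis 1 M
          γ , C , pγ = Card-Axis d M
      in trans (⊛-cong {g = dilate d θ} (λ k → sym (dilate-1 θ k)) (λ _ → refl) n)
         (trans (θθ-parity 1 d n (Card-image J id root⇐ (λ _ _ _ _ eq → eq) (λ xy p → xy , root⇒ xy p , refl)))
         (trans (roots-parity J A C) (cong₂ _xor_ pα pγ)))

  2∣⇒double : ∀ {x} → 2 ∣ x → ∃ λ k → x ≡ 2 * k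
  2∣⇒double (divides k eq) = k , trans eq (*-comm k 2)

  prime-∣-square : ∀ {p} → Prime p → ∀ i → ℤ.+ p ℤD.∣ i ℤ.* i → ℤ.+ p ℤD.∣ i
  prime-∣-square pr i p∣ = [ id , id ]′ (prime-∣-* pr i i p∣)

  2∣3∣⇒6∣ : ∀ i → ℤ.+ 2 ℤD.∣ i → ℤ.+ 3 ℤD.∣ i → ℤ.+ 6 ℤD.∣ i
  2∣3∣⇒6∣ i (ℤD.divides q refl) 3∣i = [ six , (λ 3∣2 → ⊥-elim (>⇒∤ (s≤s (s≤s (s≤s z≤n))) (ℤD.∣⇒∣ᵤ 3∣2))) ]′
    (prime-∣-* prime[3] q (ℤ.+ 2) 3∣i)
    where
    six : ℤ.+ 3 ℤD.∣ q → ℤ.+ 6 ℤD.∣ q ℤ.* ℤ.+ 2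
    six (ℤD.divides r refl) = ℤD.divides r (ℤP.*-assoc r (ℤ.+ 3) (ℤ.+ 2))

  2∣odd-multiple : ∀ c x → 2 ∣ suc (2 * c) * (x * x) → 2 ∣ x
  2∣odd-multiple c x 2∣ with euclidsLemma (suc (2 * c)) (x * x) prime[2] 2∣
  ... | inj₁ 2∣c = ⊥-elim (2∣-odd c 2∣c)
  ... | inj₂ 2∣xx with even⊎odd x
  ... | inj₁ (k , refl) = m∣m*n k
  ... | inj₂ (k , refl) = ⊥-elim (odd⇒2∤ (2 * (k * k) + 2 * k) (identity k) 2∣xx)
    where
    identity : ∀ k → suc (2 * k) * suc (2 * k) ≡ suc (2 * (2 * (k * k) + 2 * k))
    identity = solve-∀

  -- The series ∑ q^(k(k+1)/2), because 8 n + 1 is a square exactly for triangular n.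
  ψ : Series
  ψ n = does (axis? 1 (suc (8 * n)))

  θθ₂ : θ ⊛ dilate 2 θ ≗ ψ
  θθ₂ n = trans coefficient (trans (cong (ψ n xor_) (dec-false (axis? 2 (suc (8 * n))) ¬axis)) (xor-identityʳ (ψ n)))
    where
    ¬axis : ¬ ∃ (Axis 2 (suc (8 * n)))
    ¬axis (z , eq) = even≢odd (z * z) (4 * n) (trans eq (identity n))
      where
      identity : ∀ n → suc (8 * n) ≡ suc (2 * (4 * n))
      identity = solve-∀
    -- The equation is 3 u² = 8 n + 1, impossible modulo 4, where the left side is 0 or 3.
    ¬xAxis : ∀ u → ¬ Axis 9 (3 * suc (8 * n)) u
    ¬xAxis u eq with even⊎odd u
    ... | inj₁ (k , refl) = even≢odd (18 * (k * k)) (12 * n + 1) (trans (i₁ k) (trans eq (i₂ n)))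
      where
      i₁ : ∀ k → 2 * (18 * (k * k)) ≡ 9 * ((2 * k) * (2 * k))
      i₁ = solve-∀
      i₂ : ∀ n → 3 * suc (8 * n) ≡ suc (2 * (12 * n + 1))
      i₂ = solve-∀
    ... | inj₂ (k , refl) = even≢odd (2 * n) (3 * (k * k) + 3 * k) (*-cancelˡ-≡ _ _ 6 (+-cancelˡ-≡ 3 _ _ (trans (i₁ n) (trans (sym eq) (i₂ k)))))
      where
      i₁ : ∀ n → 3 + 6 * (2 * (2 * n)) ≡ 3 * suc (8 * n)
      i₁ = solve-∀
      i₂ : ∀ k → 9 * (suc (2 * k) * suc (2 * k)) ≡ 3 + 6 * suc (2 * (3 * (k * k) + 3 * k))
      i₂ = solve-∀
    ¬yAxis : ∀ t → ¬ Axis 18 (3 * suc (8 * n)) t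
    ¬yAxis t eq = even≢odd (9 * (t * t)) (12 * n + 1) (trans (i₁ t) (trans eq (i₂ n)))
      where
      i₁ : ∀ t → 2 * (9 * (t * t)) ≡ 18 * (t * t)
      i₁ = solve-∀
      i₂ : ∀ n → 3 * suc (8 * n) ≡ suc (2 * (12 * n + 1))
      i₂ = solve-∀
    odd-x : ∀ x y → Diag 1 2 (3 * suc (8 * n)) (x , y) → ¬ 2 ∣ x
    odd-x x y eq 2∣x = odd⇒2∤ (12 * n + 1) (identity n) (subst (2 ∣_) eq (∣m∣n⇒∣m+n (∣n⇒∣m*n 1 (∣m⇒∣m*n x 2∣x)) (m∣m*n (y * y))))
      where
      identity : ∀ n → 3 * suc (8 * n) ≡ suc (2 * (12 * n + 1))
      identity = solve-∀
    odd-y : ∀ x y → Diag 1 2 (3 * suc (8 * n)) (x , y) → ¬ 2 ∣ y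
    odd-y x y eq 2∣y with 2∣⇒double 2∣y | even⊎odd x
    ... | _ | inj₁ (k , refl) = odd-x (2 * k) y eq (m∣m*n k)
    ... | l , refl | inj₂ (k , refl) = even≢odd (k * k + k + 2 * (l * l)) (6 * n)
        (*-cancelˡ-≡ _ _ 2 (+-cancelˡ-≡ 1 _ _ (trans (i₁ k l) (trans eq (i₂ n)))))
      where
      i₁ : ∀ k l → 1 + 2 * (2 * (k * k + k + 2 * (l * l))) ≡ 1 * (suc (2 * k) * suc (2 * k)) + 2 * ((2 * l) * (2 * l))
      i₁ = solve-∀
      i₂ : ∀ n → 3 * suc (8 * n) ≡ 1 + 2 * suc (2 * (6 * n))
      i₂ = solve-∀
    size : 3 * suc (8 * n) ≡ 24 * n + 3
    size = identity n
      where
      identity : ∀ n → 3 * suc (8 * n) ≡ 24 * n + 3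
      identity = solve-∀
    open ThetaProduct 2 n (suc (8 * n)) (divides 1 refl) size (λ _ _ _ c → c) ¬xAxis ¬yAxis odd-x odd-y

  θθ₅-axes : ∀ n → (θ ⊛ dilate 5 θ) n ≡ does (axis? 1 (suc (4 * n))) xor does (axis? 5 (suc (4 * n)))
  θθ₅-axes n = coefficient
    where
    size : 6 * suc (4 * n) ≡ 24 * n + 6
    size = identity n
      where
      identity : ∀ n → 6 * suc (4 * n) ≡ 24 * n + 6
      identity = solve-∀
    -- Modulo 4 the number 6 (4 n + 1) is 2, and an odd multiple of a square never is. The odd
    -- factors 9 and 45 that occur belong to the two axes after division of the coordinates by 3.
    halved : ∀ c u → suc (2 * c) * (u * u) ≡ 6 * suc (4 * n) → ⊥
    halved c u eq with 2∣⇒double (2∣odd-multiple c u (subst (2 ∣_) (sym eq) (divides (3 * suc (4 * n)) (i₁ n))))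
      where
      i₁ : ∀ n → 6 * suc (4 * n) ≡ 3 * suc (4 * n) * 2
      i₁ = solve-∀
    ... | k , refl = even≢odd (suc (2 * c) * (k * k)) (6 * n + 1) (*-cancelˡ-≡ _ _ 2 (trans (i₁ c k) (trans eq (i₂ n))))
      where
      i₁ : ∀ c k → 2 * (2 * (suc (2 * c) * (k * k))) ≡ suc (2 * c) * ((2 * k) * (2 * k))
      i₁ = solve-∀
      i₂ : ∀ n → 6 * suc (4 * n) ≡ 2 * suc (2 * (6 * n + 1))
      i₂ = solve-∀
    not-both-even : ∀ x y → Diag 1 5 (6 * suc (4 * n)) (x , y) → 2 ∣ x → 2 ∣ y → ⊥
    not-both-even x y eq 2∣x 2∣y with 2∣⇒double 2∣x | 2∣⇒double 2∣y
    ... | k , refl | l , refl = even≢odd (k * k + 5 * (l * l)) (6 * n + 1) (*-cancelˡ-≡ _ _ 2 (trans (i₁ k l) (trans eq (i₂ n))))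
      where
      i₁ : ∀ k l → 2 * (2 * (k * k + 5 * (l * l))) ≡ 1 * ((2 * k) * (2 * k)) + 5 * ((2 * l) * (2 * l))
      i₁ = solve-∀
      i₂ : ∀ n → 6 * suc (4 * n) ≡ 2 * suc (2 * (6 * n + 1))
      i₂ = solve-∀
    2∣6M : 2 ∣ 6 * suc (4 * n)
    2∣6M = ∣m⇒∣m*n (suc (4 * n)) (divides 3 refl)
    odd-x : ∀ x y → Diag 1 5 (6 * suc (4 * n)) (x , y) → ¬ 2 ∣ x
    odd-x x y eq 2∣x = not-both-even x y eq 2∣x
      (2∣odd-multiple 2 y (∣m+n∣m⇒∣n (subst (2 ∣_) (sym eq) 2∣6M) (∣n⇒∣m*n 1 (∣m⇒∣m*n x 2∣x))))
    odd-y : ∀ x y → Diag 1 5 (6 * suc (4 * n)) (x , y) → ¬ 2 ∣ y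
    odd-y x y eq 2∣y = not-both-even x y eq
      (2∣odd-multiple 0 x (∣m+n∣m⇒∣n (subst (2 ∣_) (trans (sym eq) (+-comm (1 * (x * x)) (5 * (y * y)))) 2∣6M) (∣n⇒∣m*n 5 (∣m⇒∣m*n y 2∣y)))) 2∣y
    -- Since x² + 5 y² - 2 y (x + 2 y) = (x - y)² and 6 M is even, x ≡ y modulo 2 holds on every
    -- point.
    lift : ∀ x y → Abs (Diag 1 5 (6 * suc (4 * n))) (x , y) → ℤ.+ 3 ℤD.∣ x ℤ.- y → ℤ.+ 6 ℤD.∣ x ℤ.- y
    lift x y p 3∣x-y = 2∣3∣⇒6∣ (x ℤ.- y) (prime-∣-square prime[2] (x ℤ.- y) (subst (ℤ.+ 2 ℤD.∣_) square
        (ℤD.∣m∣n⇒∣m-n (ℤD.∣ᵤ⇒∣ {ℤ.+ 2} {ℤ.+ (6 * suc (4 * n))} 2∣6M) (ℤD.∣m⇒∣m*n {ℤ.+ 2} {ℤ.+ 2} r (ℤD.divides (ℤ.+ 1) refl))))) 3∣x-y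
      where
      r = y ℤ.* (x ℤ.+ ℤ.+ 2 ℤ.* y)
      identity : ∀ x y → (ℤ.+ 1 ℤ.* (x ℤ.* x) ℤ.+ ℤ.+ 5 ℤ.* (y ℤ.* y)) ℤ.- ℤ.+ 2 ℤ.* (y ℤ.* (x ℤ.+ ℤ.+ 2 ℤ.* y)) ≡ (x ℤ.- y) ℤ.* (x ℤ.- y)
      identity = ℤSolver.solve-∀
      square : ℤ.+ (6 * suc (4 * n)) ℤ.- ℤ.+ 2 ℤ.* r ≡ (x ℤ.- y) ℤ.* (x ℤ.- y)
      square = trans (cong (λ v → v ℤ.- ℤ.+ 2 ℤ.* r) (sym (Diag⇒ℤ 1 5 (6 * suc (4 * n)) x y p))) (identity x y)
    open ThetaProduct 5 n (suc (4 * n)) (divides 2 refl) size lift (halved 4) (halved 22) odd-x odd-y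

  odd-square : ∀ m → suc (2 * m) * suc (2 * m) ≡ suc (8 * tri m)
  odd-square m = trans (i₁ m) (trans (cong (λ v → suc (4 * v)) (sym (tri-closed m))) (i₂ (tri m)))
    where
    i₁ : ∀ m → suc (2 * m) * suc (2 * m) ≡ suc (4 * (m * suc m))
    i₁ = solve-∀
    i₂ : ∀ t → suc (4 * (t + t)) ≡ suc (8 * t)
    i₂ = solve-∀

  ψ-tri : ∀ m → ψ (tri m) ≡ true
  ψ-tri m = dec-true (axis? 1 (suc (8 * tri m))) (suc (2 * m) , trans (*-identityˡ (suc (2 * m) * suc (2 * m))) (odd-square m))

  ψ-true : ∀ k → ψ k ≡ true → ∃ λ x → x * x ≡ suc (8 * k)
  ψ-true k p = let x , eq = does-true⇒ (axis? 1 (suc (8 * k))) p in x , trans (sym (*-identityˡ (x * x))) eq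

  axis₁-tri : ∀ n x → Axis 1 (suc (4 * n)) x → ∃ λ m → n ≡ tri m * 2
  axis₁-tri n x eq with even⊎odd x
  ... | inj₁ (k , refl) = ⊥-elim (even≢odd (2 * (k * k)) (2 * n) (trans (i₁ k) (trans eq (i₂ n))))
    where
    i₁ : ∀ k → 2 * (2 * (k * k)) ≡ 1 * ((2 * k) * (2 * k))
    i₁ = solve-∀
    i₂ : ∀ n → suc (4 * n) ≡ suc (2 * (2 * n))
    i₂ = solve-∀
  ... | inj₂ (m , refl) = m , *-cancelˡ-≡ n (tri m * 2) 4 (suc-injective
      (trans (sym eq) (trans (*-identityˡ (suc (2 * m) * suc (2 * m))) (trans (odd-square m) (identity (tri m))))))
    where
    identity : ∀ t → suc (8 * t) ≡ suc (4 * (t * 2))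
    identity = solve-∀

  -- Here 5 (8 t + 1) = 4 (10 t + 1) + 1 is the origin of the factor q and of the exponent 10 in the
  -- identity for θ(q) θ(q⁵).
  axis₅-tri : ∀ n x → Axis 5 (suc (4 * n)) x → ∃ λ m → n ≡ suc (tri m * 10)
  axis₅-tri n x eq with even⊎odd x
  ... | inj₁ (k , refl) = ⊥-elim (even≢odd (10 * (k * k)) (2 * n) (trans (i₁ k) (trans eq (i₂ n))))
    where
    i₁ : ∀ k → 2 * (10 * (k * k)) ≡ 5 * ((2 * k) * (2 * k))
    i₁ = solve-∀
    i₂ : ∀ n → suc (4 * n) ≡ suc (2 * (2 * n))
    i₂ = solve-∀
  ... | inj₂ (m , refl) = m , *-cancelˡ-≡ n (suc (tri m * 10)) 4 (suc-injective
      (trans (sym eq) (trans (cong (5 *_) (odd-square m)) (identity (tri m)))))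
    where
    identity : ∀ t → 5 * suc (8 * t) ≡ suc (4 * suc (t * 10))
    identity = solve-∀

  axis₁ : ∀ n → does (axis? 1 (suc (4 * n))) ≡ dilate 2 ψ n
  axis₁ n = Bool-ext
    (λ p → let x , eq = does-true⇒ (axis? 1 (suc (4 * n))) p
               m , n≡ = axis₁-tri n x eq
           in trans (cong (dilate 2 ψ) n≡) (trans (dilate-* 2 ψ (tri m)) (ψ-tri m)))
    (λ p → let k , k*2≡n , q = dilate-true 2 ψ {n} p
               x , eq = ψ-true k q
           in dec-true (axis? 1 (suc (4 * n))) (x , trans (*-identityˡ (x * x)) (trans eq (trans (identity k) (cong (λ v → suc (4 * v)) k*2≡n)))))
    where
    identity : ∀ k → suc (8 * k) ≡ suc (4 * (k * 2))
    identity = solve-∀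

  axis₅ : ∀ n → does (axis? 5 (suc (4 * n))) ≡ shift 1 (dilate 10 ψ) n
  axis₅ n = Bool-ext
    (λ p → let x , eq = does-true⇒ (axis? 5 (suc (4 * n))) p
               m , n≡ = axis₅-tri n x eq
           in trans (cong (shift 1 (dilate 10 ψ)) n≡) (trans (dilate-* 10 ψ (tri m)) (ψ-tri m)))
    (from n)
    where
    identity : ∀ k → 5 * suc (8 * k) ≡ suc (4 * suc (k * 10))
    identity = solve-∀
    from : ∀ n → shift 1 (dilate 10 ψ) n ≡ true → does (axis? 5 (suc (4 * n))) ≡ true
    from (suc n) p =
      let k , k*10≡n , q = dilate-true 10 ψ {n} p
          x , eq = ψ-true k q
      in dec-true (axis? 5 (suc (4 * suc n))) (x , trans (cong (5 *_) eq) (trans (identity k) (cong (λ v → suc (4 * suc v)) k*10≡n)))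

  -- The x axis yields ψ(q²) and the y axis q ψ(q^10). Turning ψ back into θ(q) θ(q²) keeps
  -- everything a product of theta series, so that the later divisions by θ come out.
  θθ₅ : θ ⊛ dilate 5 θ ≗ dilate 2 (θ ⊛ dilate 2 θ) ⊕ shift 1 (dilate 2 (dilate 5 θ ⊛ dilate 10 θ))
  θθ₅ n = trans (θθ₅-axes n) (cong₂ _xor_ (trans (axis₁ n) (dilate-cong 2 (λ k → sym (θθ₂ k)) n))
    (trans (axis₅ n) (shift-cong 1 rewrite-ψ n)))
    where
    rewrite-ψ : dilate 10 ψ ≗ dilate 2 (dilate 5 θ ⊛ dilate 10 θ)
    rewrite-ψ k = trans (sym (dilate-dilate 2 5 ψ k)) (dilate-cong 2 (λ i → trans (dilate-cong 5 (λ j → sym (θθ₂ j)) i)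
      (trans (dilate-⊛ 5 θ (dilate 2 θ) i) (⊛-cong {f = dilate 5 θ} (λ _ → refl) (dilate-dilate 5 2 θ) i))) k)

  even-dilate : ∀ f → even (dilate 2 f) ≗ f
  even-dilate f n = dilate-* 2 f n

  even-shift-dilate : ∀ f → even (shift 1 (dilate 2 f)) ≗ (λ _ → false)
  even-shift-dilate f zero = refl
  even-shift-dilate f (suc n) = odd-dilate f n

  -- In θ(q²) X = U(q²) + q V(q²) the exponents of each parity can be compared separately; once they
  -- are halved, θ(q²) has become θ(q).
  module Dissect (X U V : Series) (eq : dilate 2 θ ⊛ X ≗ dilate 2 U ⊕ shift 1 (dilate 2 V)) where

    even-part : θ ⊛ even X ≗ U
    even-part n = trans (sym (even-dilate-⊛ θ X n)) (trans (eq (n * 2))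
      (trans (cong₂ _xor_ (even-dilate U n) (even-shift-dilate V n)) (xor-identityʳ (U n))))

    odd-part : θ ⊛ odd X ≗ V
    odd-part n = trans (sym (odd-dilate-⊛ θ X n)) (trans (eq (suc (n * 2)))
      (cong₂ _xor_ (odd-dilate U n) (even-dilate V n)))

  θ-cancel : ∀ f g → θ ⊛ f ≗ θ ⊛ g → f ≗ g
  θ-cancel f g = ⊛-cancelˡ θ f g refl

  -- Multiplication by θ turns the denominator θ of X into θ² = θ(q²), a series in q², as `Dissect`
  -- requires.
  θ²-⊛ : ∀ X Y → θ ⊛ X ≗ Y → dilate 2 θ ⊛ X ≗ θ ⊛ Y
  θ²-⊛ X Y eq n = trans (⊛-cong {g = X} (λ k → sym (frobenius θ k)) (λ _ → refl) n)
    (trans (⊛-assoc θ θ X n) (⊛-cong {f = θ} (λ _ → refl) eq n))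

  θ₅ θ₁₀ β₅ β₂₀ : Series
  θ₅ = dilate 5 θ
  θ₁₀ = dilate 10 θ
  β₅ = Regular.β 5
  β₂₀ = Regular.β 20

  module First = Dissect β₅ (θ ⊛ dilate 2 θ) (θ₅ ⊛ θ₁₀)
    (λ n → trans (θ²-⊛ β₅ θ₅ (Regular.θ-⊛-β 5) n) (θθ₅ n))

  -- Because θ(q^10) is a series in q², multiplying by it leaves the identity for θ(q) θ(q⁵)
  -- separated by parity; this makes the second dissection possible.
  θθ₅θ₁₀ : θ ⊛ (θ₅ ⊛ θ₁₀) ≗ dilate 2 ((θ ⊛ dilate 2 θ) ⊛ θ₅) ⊕ shift 1 (dilate 2 ((θ₅ ⊛ θ₁₀) ⊛ θ₅))
  θθ₅θ₁₀ n = begin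
    (θ ⊛ (θ₅ ⊛ θ₁₀)) n
      ≡⟨ sym (⊛-assoc θ θ₅ θ₁₀ n) ⟩
    ((θ ⊛ θ₅) ⊛ θ₁₀) n
      ≡⟨ ⊛-cong θθ₅ (λ k → sym (dilate-dilate 2 5 θ k)) n ⟩
    ((U ⊕ shift 1 V) ⊛ dilate 2 θ₅) n
      ≡⟨ ⊛-distribʳ U (shift 1 V) (dilate 2 θ₅) n ⟩
    (U ⊛ dilate 2 θ₅) n xor (shift 1 V ⊛ dilate 2 θ₅) n
      ≡⟨ cong₂ _xor_ (sym (dilate-⊛ 2 (θ ⊛ dilate 2 θ) θ₅ n))
                     (trans (shift-⊛ 1 V (dilate 2 θ₅) n) (shift-cong 1 (λ k → sym (dilate-⊛ 2 (θ₅ ⊛ θ₁₀) θ₅ k)) n)) ⟩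
    dilate 2 ((θ ⊛ dilate 2 θ) ⊛ θ₅) n xor shift 1 (dilate 2 ((θ₅ ⊛ θ₁₀) ⊛ θ₅)) n ∎
    where
    U = dilate 2 (θ ⊛ dilate 2 θ)
    V = dilate 2 (θ₅ ⊛ θ₁₀)

  module Second = Dissect (odd β₅) ((θ ⊛ dilate 2 θ) ⊛ θ₅) ((θ₅ ⊛ θ₁₀) ⊛ θ₅)
    (λ n → trans (θ²-⊛ (odd β₅) (θ₅ ⊛ θ₁₀) First.odd-part n) (θθ₅θ₁₀ n))

  β₅-even : even β₅ ≗ dilate 2 θ
  β₅-even = θ-cancel (even β₅) (dilate 2 θ) First.even-part

  β₅-1mod4 : even (odd β₅) ≗ dilate 2 θ ⊛ θ₅
  β₅-1mod4 = θ-cancel (even (odd β₅)) (dilate 2 θ ⊛ θ₅)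
    (λ n → trans (Second.even-part n) (⊛-assoc θ (dilate 2 θ) θ₅ n))

  -- By Frobenius θ(q⁵)² θ(q^10) = θ(q^10)² = θ(q^20), and this is θ times the generating function
  -- of b₂₀ modulo 2.
  β₅-3mod4 : odd (odd β₅) ≗ β₂₀
  β₅-3mod4 = θ-cancel (odd (odd β₅)) β₂₀ (λ n → trans (Second.odd-part n) (trans (collapse n) (sym (Regular.θ-⊛-β 20 n))))
    where
    collapse : (θ₅ ⊛ θ₁₀) ⊛ θ₅ ≗ dilate 20 θ
    collapse n = begin
      ((θ₅ ⊛ θ₁₀) ⊛ θ₅) n  ≡⟨ ⊛-comm (θ₅ ⊛ θ₁₀) θ₅ n ⟩
      (θ₅ ⊛ (θ₅ ⊛ θ₁₀)) n  ≡⟨ sym (⊛-assoc θ₅ θ₅ θ₁₀ n) ⟩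
      ((θ₅ ⊛ θ₅) ⊛ θ₁₀) n  ≡⟨ ⊛-cong {g = θ₁₀} (λ k → trans (frobenius θ₅ k) (dilate-dilate 2 5 θ k)) (λ _ → refl) n ⟩
      (θ₁₀ ⊛ θ₁₀) n        ≡⟨ frobenius θ₁₀ n ⟩
      dilate 2 θ₁₀ n       ≡⟨ dilate-dilate 2 10 θ n ⟩
      dilate 20 θ n ∎

  β₅-0mod4 : ∀ n → β₅ ((n * 2) * 2) ≡ θ n
  β₅-0mod4 n = trans (β₅-even (n * 2)) (even-dilate θ n)

  β₅-2mod4 : ∀ n → β₅ (suc (n * 2) * 2) ≡ false
  β₅-2mod4 n = trans (β₅-even (suc (n * 2))) (odd-dilate θ n)

open ThetaProducts

-- Reduction of forms of determinant 10, and primes dividing exactly once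

module Determinant10 where

  open import Data.Bool using (false)
  open import Data.Nat as ℕ using (ℕ; zero; suc; z≤n; s≤s; NonZero)
  import Data.Nat.Properties as ℕP
  import Data.Nat.Divisibility as ℕD
  open import Data.Nat.Induction using (<-rec)
  import Data.Nat.Tactic.RingSolver as ℕSolver
  open import Data.Integer using (ℤ; +_; -[1+_]; +0; -_; _+_; _-_; _*_; ∣_∣)
  import Data.Integer.Properties as ℤP
  import Data.Integer.DivMod as ℤM
  open import Data.Integer.Tactic.RingSolver using (solve-∀)
  open import Data.Product using (∃; ∃₂; _×_; _,_; proj₁; proj₂; swap)
  open import Data.Sum using (_⊎_; inj₁; inj₂; [_,_]′; map₂)
  open import Data.Empty using (⊥; ⊥-elim)
  open import Function using (id)
  open import Relation.Nullary using (¬_; yes; no)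
  open import Relation.Nullary.Decidable using (from-yes; from-no)
  open import Relation.Binary.PropositionalEquality using (_≡_; _≢_; refl; sym; trans; cong; cong₂; subst; module ≡-Reasoning)
  open import Data.List using ([]; _∷_)
  open import Data.List.Relation.Unary.Any using (here)
  open import Data.Nat.Coprimality using (Coprime; coprime-Bézout)
  open import Data.Nat.GCD using (module Bézout)
  open import Data.Nat.Primality using (Prime; prime⇒irreducible; prime⇒nonZero)
  open import Data.Integer.Divisibility.Signed using (divides; ∣⇒∣ᵤ; ∣ᵤ⇒∣; ∣m∣n⇒∣m+n; ∣m∣n⇒∣m-n; ∣m⇒∣-m; ∣m⇒∣m*n; ∣n⇒∣m*n) renaming (_∣_ to _∣ᶻ_; _∣?_ to _∣ᶻ?_)
  open ≡-Reasoning

  -- Binary forms A x² + 2 B x y + C y² of determinant A C − B² = 10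

  Form : ℤ → ℤ → ℤ → ℕ → ℤ × ℤ → Set
  Form A B C M (x , y) = A * (x * x) + + 2 * (B * (x * y)) + C * (y * y) ≡ + M

  Card-shear : ∀ A B C M {n} k → Card (Form A (B + k * A) (C + + 2 * (k * B) + k * k * A) M) n → Card (Form A B C M) n
  Card-shear A B C M k K = Card-image K (λ (x , y) → x + k * y , y)
    (λ (x , y) p → trans (sheared A B C k x y) p)
    (λ { (x , y) (x′ , y′) _ _ eq → inj x y x′ y′ (cong proj₁ eq) (cong proj₂ eq) })
    (λ (x , y) p → (x - k * y , y) , trans (sym (sheared A B C k (x - k * y) y)) (trans (cong (λ v → A * (v * v) + + 2 * (B * (v * y)) + C * (y * y)) (undo x (k * y))) p) ,
      cong (_, y) (undo x (k * y)))
    where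
    sheared : ∀ A B C k x y → A * ((x + k * y) * (x + k * y)) + + 2 * (B * ((x + k * y) * y)) + C * (y * y)
            ≡ A * (x * x) + + 2 * ((B + k * A) * (x * y)) + (C + + 2 * (k * B) + k * k * A) * (y * y)
    sheared = solve-∀
    undo : ∀ x z → x - z + z ≡ x
    undo = solve-∀
    redo : ∀ x z → x + z - z ≡ x
    redo = solve-∀
    inj : ∀ x y x′ y′ → x + k * y ≡ x′ + k * y′ → y ≡ y′ → (x , y) ≡ (x′ , y′)
    inj x y x′ .y e refl = cong (_, y) (trans (sym (redo x (k * y))) (trans (cong (_- k * y) e) (redo x′ (k * y))))

  Card-flip : ∀ A B C M {n} → Card (Form C B A M) n → Card (Form A B C M) n
  Card-flip A B C M K = Card-image K swap
    (λ (x , y) p → trans (flipped A B C x y) p) (λ { _ _ _ _ refl → refl })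
    (λ (x , y) p → (y , x) , trans (sym (flipped A B C y x)) p , refl)
    where
    flipped : ∀ A B C x y → A * (y * y) + + 2 * (B * (y * x)) + C * (x * x) ≡ C * (x * x) + + 2 * (B * (x * y)) + A * (y * y)
    flipped = solve-∀

  Card-diagonal : ∀ a c M {n} → Card (Abs (Diag a c M)) n → Card (Form (+ a) +0 (+ c) M) n
  Card-diagonal a c M K = Card-image K id
    (λ (x , y) p → trans (drop (+ a) (+ c) x y) (Diag⇒ℤ a c M x y p)) (λ _ _ _ _ eq → eq)
    (λ (x , y) p → (x , y) , ℤ⇒Diag a c M x y (trans (sym (drop (+ a) (+ c) x y)) p) , refl)
    where
    drop : ∀ A C x y → A * (x * x) + + 2 * (+0 * (x * y)) + C * (y * y) ≡ A * (x * x) + C * (y * y)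
    drop = solve-∀

  balanced-remainder : ∀ a .{{_ : NonZero a}} B → ∃ λ k → 2 ℕ.* ∣ B + k * + a ∣ ℕ.≤ a
  balanced-remainder a B with 2 ℕ.* (B ℤM.%ℕ a) ℕ.≤? a
  ... | yes small = - q , subst (λ v → 2 ℕ.* ∣ v ∣ ℕ.≤ a) (sym (trans (cong (_+ - q * + a) (ℤM.a≡a%ℕn+[a/ℕn]*n B a)) (identity (+ r) q (+ a)))) small
    where
    q = B ℤM./ℕ a
    r = B ℤM.%ℕ a
    identity : ∀ r q a → r + q * a + - q * a ≡ r
    identity = solve-∀
  ... | no large = - q - + 1 , subst (λ v → 2 ℕ.* ∣ v ∣ ℕ.≤ a) (sym (trans (cong (_+ (- q - + 1) * + a) (ℤM.a≡a%ℕn+[a/ℕn]*n B a)) (identity (+ r) q (+ a)))) bound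
    where
    q = B ℤM./ℕ a
    r = B ℤM.%ℕ a
    identity : ∀ r q a → r + q * a + (- q - + 1) * a ≡ r - a
    identity = solve-∀
    r≤a : r ℕ.≤ a
    r≤a = ℕP.<⇒≤ (ℤM.n%ℕd<d B a)
    abs : ∣ + r - + a ∣ ≡ a ℕ.∸ r
    abs = trans (cong ∣_∣ (ℤP.m-n≡m⊖n r a)) (trans (ℤP.∣m⊖n∣≡∣n⊖m∣ r a) (cong ∣_∣ (ℤP.⊖-≥ r≤a)))
    bound : 2 ℕ.* ∣ + r - + a ∣ ℕ.≤ a
    bound = subst (λ v → 2 ℕ.* v ℕ.≤ a) (sym abs) (subst (ℕ._≤ a) (sym (ℕP.*-distribˡ-∸ 2 a r))
      (ℕP.≤-trans (ℕP.∸-monoʳ-≤ (2 ℕ.* a) (ℕP.<⇒≤ (ℕP.≰⇒> large))) (ℕP.≤-reflexive (trans (cong (ℕ._∸ a) (cong (a ℕ.+_) (ℕP.+-identityʳ a))) (ℕP.m+n∸n≡m a a)))))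

  positive-cofactor : ∀ a n C → + a * C ≡ + suc n → ∃ λ c → C ≡ + c
  positive-cofactor a n (+ c) _ = c , refl
  positive-cofactor zero n -[1+ c ] ()
  positive-cofactor (suc a) n -[1+ c ] ()

  -- The coefficient a must divide 10 + β², which rules out a = 3 (against 10 and 11) and a = 2 with
  -- β = 1. The two forms left represent the two classes of discriminant -40.
  reduced-forms : ∀ a β c → a ℕ.≤ 3 → 2 ℕ.* β ℕ.≤ a → a ℕ.* c ≡ 10 ℕ.+ β ℕ.* β →
                  β ≡ 0 × (a ≡ 1 × c ≡ 10 ⊎ a ≡ 2 × c ≡ 5)
  reduced-forms a (suc (suc β)) c a≤3 le _ = ⊥-elim (ℕP.<⇒≱ (ℕP.*-monoʳ-≤ 2 {2} (s≤s (s≤s z≤n))) (ℕP.≤-trans le a≤3))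
  reduced-forms zero zero c _ _ ()
  reduced-forms 1 zero c _ _ eq = refl , inj₁ (refl , trans (sym (ℕP.*-identityˡ c)) eq)
  reduced-forms 2 zero c _ _ eq = refl , inj₂ (refl , ℕP.*-cancelˡ-≡ c 5 2 eq)
  reduced-forms 3 zero c _ _ eq = ⊥-elim (from-no (3 ℕD.∣? 10) (ℕD.divides c (trans (sym eq) (ℕP.*-comm 3 c))))
  reduced-forms zero 1 c _ () _
  reduced-forms 1 1 c _ (s≤s ()) _
  reduced-forms 2 1 c _ _ eq = ⊥-elim (from-no (2 ℕD.∣? 11) (ℕD.divides c (trans (sym eq) (ℕP.*-comm 2 c))))
  reduced-forms 3 1 c _ _ eq = ⊥-elim (from-no (3 ℕD.∣? 11) (ℕD.divides c (trans (sym eq) (ℕP.*-comm 3 c))))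
  reduced-forms (suc (suc (suc (suc _)))) _ c (s≤s (s≤s (s≤s ()))) _ _

  module FormReduction (M : ℕ) .{{_ : NonZero M}}
    (¬1 : ∀ x → ¬ Axis 1 M x) (¬10 : ∀ x → ¬ Axis 10 M x) (¬2 : ∀ x → ¬ Axis 2 M x) (¬5 : ∀ x → ¬ Axis 5 M x) where

    -- Invariance under unimodular substitutions makes this a property of the class; for both
    -- reduced forms it holds by `Card-Diag`, as the hypotheses exclude all their axis points.
    FourDivides : ℤ → ℤ → ℤ → Set
    FourDivides A B C = ∃ λ k → Card (Form A B C M) ((k ℕ.+ k) ℕ.+ (k ℕ.+ k))

    private
      diagonal : ∀ a c .{{_ : NonZero a}} .{{_ : NonZero c}} → (∀ x → ¬ Axis a M x) → (∀ x → ¬ Axis c M x) → FourDivides (+ a) +0 (+ c)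
      diagonal a c ¬a ¬c = let k , K = Card-Diag a c M (Card-empty ¬a) (Card-empty ¬c) in
        k , Card-diagonal a c M (subst (Card _) (ℕP.+-identityʳ _) K)

      small : ∀ a B c → a ℕ.≤ 3 → 2 ℕ.* ∣ B ∣ ℕ.≤ a → a ℕ.* c ≡ 10 ℕ.+ ∣ B ∣ ℕ.* ∣ B ∣ → FourDivides (+ a) B (+ c)
      small a B c a≤3 le eq with reduced-forms a ∣ B ∣ c a≤3 le eq
      ... | β≡0 , shape with ℤP.∣i∣≡0⇒i≡0 {B} β≡0 | shape
      ... | refl | inj₁ (refl , refl) = diagonal 1 10 ¬1 ¬10
      ... | refl | inj₂ (refl , refl) = diagonal 2 5 ¬2 ¬5

      -- If a ≤ c, then 4 a² ≤ 4 a c = 40 + (2 β)² ≤ 40 + a², so 3 a² ≤ 40, whereas a ≥ 4 makes it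
      -- at least 48. Hence the reduction stops only at a ≤ 3.
      descend : ∀ a c β → 4 ℕ.≤ a → 2 ℕ.* β ℕ.≤ a → a ℕ.* c ≡ 10 ℕ.+ β ℕ.* β → c ℕ.< a
      descend a c β 4≤a le eq = ℕP.≰⇒> λ a≤c → ℕP.<⇒≱ (ℕP.≤-trans (from-yes (41 ℕ.≤? 48)) (ℕP.*-monoʳ-≤ 3 (ℕP.*-mono-≤ 4≤a 4≤a)))
        (ℕP.+-cancelˡ-≤ (a ℕ.* a) (3 ℕ.* (a ℕ.* a)) 40 (quadruple a≤c))
        where
        i₁ : ∀ a → a ℕ.* a ℕ.+ 3 ℕ.* (a ℕ.* a) ≡ 4 ℕ.* (a ℕ.* a)
        i₁ = ℕSolver.solve-∀
        i₂ : ∀ β → 4 ℕ.* (10 ℕ.+ β ℕ.* β) ≡ (2 ℕ.* β) ℕ.* (2 ℕ.* β) ℕ.+ 40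
        i₂ = ℕSolver.solve-∀
        quadruple : a ℕ.≤ c → a ℕ.* a ℕ.+ 3 ℕ.* (a ℕ.* a) ℕ.≤ a ℕ.* a ℕ.+ 40
        quadruple a≤c = ℕP.≤-trans (ℕP.≤-reflexive (i₁ a)) (ℕP.≤-trans (ℕP.*-monoʳ-≤ 4 (ℕP.*-monoʳ-≤ a a≤c))
          (ℕP.≤-trans (ℕP.≤-reflexive (trans (cong (4 ℕ.*_) eq) (i₂ β))) (ℕP.+-monoˡ-≤ 40 (ℕP.*-mono-≤ le le))))

      shear : ∀ A B C k → FourDivides A (B + k * A) (C + + 2 * (k * B) + k * k * A) → FourDivides A B C
      shear A B C k (n , K) = n , Card-shear A B C M k K

      flip : ∀ A B C → FourDivides C B A → FourDivides A B C
      flip A B C (n , K) = n , Card-flip A B C M K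

      determinant : ∀ A B C k → A * C ≡ + 10 + B * B → A * (C + + 2 * (k * B) + k * k * A) ≡ + 10 + (B + k * A) * (B + k * A)
      determinant A B C k eq = trans (i₁ A B C k) (trans (cong (_+ (+ 2 * (k * (A * B)) + k * k * (A * A))) eq) (i₂ A B k))
        where
        i₁ : ∀ A B C k → A * (C + + 2 * (k * B) + k * k * A) ≡ A * C + (+ 2 * (k * (A * B)) + k * k * (A * A))
        i₁ = solve-∀
        i₂ : ∀ A B k → + 10 + B * B + (+ 2 * (k * (A * B)) + k * k * (A * A)) ≡ + 10 + (B + k * A) * (B + k * A)
        i₂ = solve-∀

      natural-cofactor : ∀ a B C → + a * C ≡ + 10 + B * B → ∃ λ c → C ≡ + c × a ℕ.* c ≡ 10 ℕ.+ ∣ B ∣ ℕ.* ∣ B ∣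
      natural-cofactor a B C eq with trans eq (cong (λ v → + 10 + v) (sym (abs-square B)))
      ... | eq′ with positive-cofactor a (9 ℕ.+ ∣ B ∣ ℕ.* ∣ B ∣) C eq′
      ... | c , refl = c , refl , ℤP.+-injective (trans (ℤP.pos-* a c) eq′)

    reduce : ∀ a .{{_ : NonZero a}} B C → + a * C ≡ + 10 + B * B → FourDivides (+ a) B C
    reduce = λ a B C → <-rec Goal step a B C
      where
      Goal : ℕ → Set
      Goal a = ∀ B C .{{_ : NonZero a}} → + a * C ≡ + 10 + B * B → FourDivides (+ a) B C
      step : ∀ a → (∀ {c} → c ℕ.< a → Goal c) → Goal a
      step a ih B C det with balanced-remainder a B
      ... | k , le with natural-cofactor a (B + k * + a) (C + + 2 * (k * B) + k * k * + a) (determinant (+ a) B C k det)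
      ... | c , C′≡c , eq with a ℕ.≤? 3
      ... | yes a≤3 = shear (+ a) B C k (subst (FourDivides (+ a) (B + k * + a)) (sym C′≡c) (small a (B + k * + a) c a≤3 le eq))
      -- After the shear c < a, so exchanging the variables puts the smaller coefficient first and
      -- the induction continues there.
      ... | no a≰3 = shear (+ a) B C k (subst (FourDivides (+ a) (B + k * + a)) (sym C′≡c) (flip (+ a) (B + k * + a) (+ c)
          (ih (descend a c ∣ B + k * + a ∣ (ℕP.≰⇒> a≰3) le eq) (B + k * + a) (+ a) {{c≢0}} det′)))
        where
        c≢0 : NonZero c
        c≢0 = ℕ.≢-nonZero λ { refl → ℕP.0≢1+n (trans (sym (ℕP.*-zeroʳ a)) eq) }
        det′ : + c * + a ≡ + 10 + (B + k * + a) * (B + k * + a)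
        det′ = trans (ℤP.*-comm (+ c) (+ a)) (trans (cong (+ a *_) (sym C′≡c)) (determinant (+ a) B C k det))

  prime∤⇒coprime : ∀ {p y} → Prime p → ¬ p ℕD.∣ y → Coprime p y
  prime∤⇒coprime pr p∤y (d∣p , d∣y) with prime⇒irreducible pr d∣p
  ... | inj₁ d≡1 = d≡1
  ... | inj₂ refl = ⊥-elim (p∤y d∣y)

  inverse-mod : ∀ {p y} → Prime p → ¬ p ℕD.∣ y → ∃ λ v → + p ∣ᶻ + 1 - v * + y
  inverse-mod {p} {y} pr p∤y with coprime-Bézout (prime∤⇒coprime pr p∤y)
  ... | Bézout.+- u v eq = - (+ v) , divides (+ u) (begin
      + 1 - - (+ v) * + y   ≡⟨ identity (+ v) (+ y) ⟩
      + 1 + + v * + y       ≡⟨ cong (λ w → + 1 + w) (sym (ℤP.pos-* v y)) ⟩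
      + (1 ℕ.+ v ℕ.* y)     ≡⟨ cong +_ eq ⟩
      + (u ℕ.* p)           ≡⟨ ℤP.pos-* u p ⟩
      + u * + p ∎)
    where
    identity : ∀ v y → + 1 - - v * y ≡ + 1 + v * y
    identity = solve-∀
  ... | Bézout.-+ u v eq = + v , divides (- (+ u)) (begin
      + 1 - + v * + y            ≡⟨ cong (λ w → + 1 - w) (sym (ℤP.pos-* v y)) ⟩
      + 1 - + (v ℕ.* y)          ≡⟨ cong (λ w → + 1 - + w) (sym eq) ⟩
      + 1 - (+ 1 + + (u ℕ.* p))  ≡⟨ cong (λ w → + 1 - (+ 1 + w)) (ℤP.pos-* u p) ⟩
      + 1 - (+ 1 + + u * + p)    ≡⟨ identity (+ u) (+ p) ⟩
      - (+ u) * + p ∎)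
    where
    identity : ∀ u p → + 1 - (+ 1 + u * p) ≡ - u * p
    identity = solve-∀

  -- If the prime p divides N = 2 x² + 5 y² exactly once, then x ≡ ± t y (mod p) for a fixed t, and the points
  -- with x ≡ t y form a lattice on which (2 x² + 5 y²) / p is a form of determinant 10.
  module ExactPrime {p M : ℕ} (pr : Prime p) .{{_ : NonZero M}}
    (p∤2 : ¬ p ℕD.∣ 2) (p∤5 : ¬ p ℕD.∣ 5) (p∤M : ¬ p ℕD.∣ M)
    (¬1 : ∀ x → ¬ Axis 1 M x) (¬10 : ∀ x → ¬ Axis 10 M x) (¬2 : ∀ x → ¬ Axis 2 M x) (¬5 : ∀ x → ¬ Axis 5 M x) where

    open FormReduction M ¬1 ¬10 ¬2 ¬5

    N : ℕ
    N = p ℕ.* M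

    private
      instance
        p≢0 : NonZero p
        p≢0 = prime⇒nonZero pr

      p∣N : + p ∣ᶻ + N
      p∣N = ∣ᵤ⇒∣ {+ p} {+ N} (ℕD.m∣m*n M)

      cancel : ∀ c → ¬ p ℕD.∣ c → ∀ i → + p ∣ᶻ + c * i → + p ∣ᶻ i
      cancel c p∤c i p∣ = [ (λ q → ⊥-elim (p∤c (∣⇒∣ᵤ q))) , id ]′ (prime-∣-* pr (+ c) i p∣)

      root : ∀ i → + p ∣ᶻ i * i → + p ∣ᶻ i
      root i p∣ = [ id , id ]′ (prime-∣-* pr i i p∣)

      p∣y⇒p∣x : ∀ x y → Abs (Diag 2 5 N) (x , y) → + p ∣ᶻ y → + p ∣ᶻ x
      p∣y⇒p∣x x y eq p∣y = root x (cancel 2 p∤2 (x * x) (subst (+ p ∣ᶻ_) rearrange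
        (∣m∣n⇒∣m-n p∣N (∣n⇒∣m*n (+ 5) {y * y} (∣m⇒∣m*n y p∣y)))))
        where
        identity : ∀ u v → u + v - v ≡ u
        identity = solve-∀
        rearrange : + N - + 5 * (y * y) ≡ + 2 * (x * x)
        rearrange = trans (cong (_- + 5 * (y * y)) (sym (Diag⇒ℤ 2 5 N x y eq))) (identity (+ 2 * (x * x)) (+ 5 * (y * y)))

      quotients : ∀ x y u v → x ≡ u * + p → y ≡ v * + p → Abs (Diag 2 5 N) (x , y) → + M ≡ (+ 2 * (u * u) + + 5 * (v * v)) * + p
      quotients x y u v x≡ y≡ eq = ℤP.*-cancelˡ-≡ (+ p) (+ M) ((+ 2 * (u * u) + + 5 * (v * v)) * + p)
        (trans (sym (ℤP.pos-* p M)) (trans (sym (Diag⇒ℤ 2 5 N x y eq))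
          (trans (cong₂ (λ i j → + 2 * (i * i) + + 5 * (j * j)) x≡ y≡) (identity u v (+ p)))))
        where
        identity : ∀ u v p → + 2 * (u * p * (u * p)) + + 5 * (v * p * (v * p)) ≡ p * ((+ 2 * (u * u) + + 5 * (v * v)) * p)
        identity = solve-∀

      -- Divisibility of y would pass to x, hence p² ∣ N, against p not dividing M = N / p.
      p∤y : ∀ x y → Abs (Diag 2 5 N) (x , y) → ¬ + p ∣ᶻ y
      p∤y x y eq p∣y =
        let divides u x≡ = p∣y⇒p∣x x y eq p∣y
            divides v y≡ = p∣y
        in p∤M (∣⇒∣ᵤ {+ p} {+ M} (divides (+ 2 * (u * u) + + 5 * (v * v)) (quotients x y u v x≡ y≡ eq)))

      p∣x⇒p∣y : ∀ x y → Abs (Diag 2 5 N) (x , y) → + p ∣ᶻ x → + p ∣ᶻ y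
      p∣x⇒p∣y x y eq p∣x = root y (cancel 5 p∤5 (y * y) (subst (+ p ∣ᶻ_) rearrange
        (∣m∣n⇒∣m-n p∣N (∣n⇒∣m*n (+ 2) {x * x} (∣m⇒∣m*n x p∣x)))))
        where
        identity : ∀ u v → u + v - u ≡ v
        identity = solve-∀
        rearrange : + N - + 2 * (x * x) ≡ + 5 * (y * y)
        rearrange = trans (cong (_- + 2 * (x * x)) (sym (Diag⇒ℤ 2 5 N x y eq))) (identity (+ 2 * (x * x)) (+ 5 * (y * y)))

      p∣0 : + p ∣ᶻ +0
      p∣0 = divides +0 refl

      nonzero : ∀ x y → Diag 2 5 N (x , y) → x ≢ 0 × y ≢ 0
      nonzero x y eq = (λ { refl → p∤y (+ 0) (+ y) eq (p∣x⇒p∣y (+ 0) (+ y) eq p∣0) }) ,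
                       (λ { refl → p∤y (+ x) (+ 0) eq p∣0 })

      -- Modulo p, t is a square root of -5/2. The cofactor c becomes the coefficient of y² in the
      -- quotient form, whose determinant is 2 p c - (2 t)² = 2 (2 t² + 5) - 4 t² = 10.
      module Slope (t c : ℤ) (tt : + 2 * (t * t) + + 5 ≡ c * + p) where

        On : ℤ × ℤ → Set
        On (x , y) = + p ∣ᶻ x - t * y

        On-neg : ∀ x y → On (x , y) → On (- x , - y)
        On-neg x y on = subst (+ p ∣ᶻ_) (identity t x y) (∣m⇒∣-m on)
          where
          identity : ∀ t x y → - (x - t * y) ≡ - x - t * - y
          identity = solve-∀

        On-some : ∀ x y → Abs (Diag 2 5 N) (x , y) → On (x , y) ⊎ On (- x , y)
        On-some x y eq = map₂ (λ on → subst (+ p ∣ᶻ_) (opposite t x y) (∣m⇒∣-m on))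
          (prime-∣-* pr (x - t * y) (x + t * y) (cancel 2 p∤2 _ (subst (+ p ∣ᶻ_) product
            (∣m∣n⇒∣m-n p∣N (∣m⇒∣m*n {+ p} {c * + p} (y * y) (divides c refl))))))
          where
          opposite : ∀ t x y → - (x + t * y) ≡ - x - t * y
          opposite = solve-∀
          identity : ∀ t x y → (+ 2 * (x * x) + + 5 * (y * y)) - (+ 2 * (t * t) + + 5) * (y * y) ≡ + 2 * ((x - t * y) * (x + t * y))
          identity = solve-∀
          product : + N - c * + p * (y * y) ≡ + 2 * ((x - t * y) * (x + t * y))
          product = trans (cong₂ (λ u v → u - v * (y * y)) (sym (Diag⇒ℤ 2 5 N x y eq)) (sym tt)) (identity t x y)

        On-excl : ∀ x y → Abs (Diag 2 5 N) (x , y) → On (x , y) → On (- x , y) → ⊥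
        On-excl x y eq on on′ = [ p∤t , p∤y x y eq ]′ (prime-∣-* pr t y (cancel 2 p∤2 (t * y)
            (subst (+ p ∣ᶻ_) (identity t x y) (∣m⇒∣-m (∣m∣n⇒∣m+n on on′)))))
          where
          identity : ∀ t x y → - ((x - t * y) + (- x - t * y)) ≡ + 2 * (t * y)
          identity = solve-∀
          solve5 : ∀ u → u + + 5 - u ≡ + 5
          solve5 = solve-∀
          p∤t : ¬ + p ∣ᶻ t
          p∤t p∣t = p∤5 (∣⇒∣ᵤ {+ p} {+ 5} (subst (+ p ∣ᶻ_) (trans (cong (_- + 2 * (t * t)) (sym tt)) (solve5 (+ 2 * (t * t))))
            (∣m∣n⇒∣m-n {+ p} {c * + p} (divides c refl) (∣n⇒∣m*n (+ 2) {t * t} (∣m⇒∣m*n t p∣t)))))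

        -- On x = t y + p z one has 2 x² + 5 y² = p (2 p z² + 4 t z y + c y²), the coefficient of y²
        -- being divisible by p through the choice of t.
        lattice : ∀ {k} → Card (Form (+ (2 ℕ.* p)) (+ 2 * t) c M) k → Card (λ xy → Abs (Diag 2 5 N) xy × On xy) k
        lattice K = Card-image K point
          (λ (z , y) eq → ℤ⇒Diag 2 5 N (t * y + + p * z) y (trans (value z y) (trans (cong (+ p *_) eq) (sym (ℤP.pos-* p M)))) ,
                          divides z (difference t y (+ p) z))
          (λ (z , y) (z′ , y′) _ _ e → inj z y z′ y′ (cong proj₁ e) (cong proj₂ e))
          surj
          where
          point : ℤ × ℤ → ℤ × ℤ
          point (z , y) = t * y + + p * z , y
          difference : ∀ t y p z → t * y + p * z - t * y ≡ z * p
          difference = solve-∀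
          i₁ : ∀ t y p z → + 2 * ((t * y + p * z) * (t * y + p * z)) + + 5 * (y * y)
               ≡ p * (+ 2 * p * (z * z) + + 2 * (+ 2 * t * (z * y))) + (+ 2 * (t * t) + + 5) * (y * y)
          i₁ = solve-∀
          i₂ : ∀ u c p y → p * u + c * p * (y * y) ≡ p * (u + c * (y * y))
          i₂ = solve-∀
          value : ∀ z y → + 2 * ((t * y + + p * z) * (t * y + + p * z)) + + 5 * (y * y)
                  ≡ + p * (+ (2 ℕ.* p) * (z * z) + + 2 * (+ 2 * t * (z * y)) + c * (y * y))
          value z y = begin
            + 2 * ((t * y + + p * z) * (t * y + + p * z)) + + 5 * (y * y)
              ≡⟨ i₁ t y (+ p) z ⟩
            + p * (+ 2 * + p * (z * z) + + 2 * (+ 2 * t * (z * y))) + (+ 2 * (t * t) + + 5) * (y * y)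
              ≡⟨ cong (λ v → + p * (+ 2 * + p * (z * z) + + 2 * (+ 2 * t * (z * y))) + v * (y * y)) tt ⟩
            + p * (+ 2 * + p * (z * z) + + 2 * (+ 2 * t * (z * y))) + c * + p * (y * y)
              ≡⟨ i₂ (+ 2 * + p * (z * z) + + 2 * (+ 2 * t * (z * y))) c (+ p) y ⟩
            + p * (+ 2 * + p * (z * z) + + 2 * (+ 2 * t * (z * y)) + c * (y * y))
              ≡⟨ cong (λ v → + p * (v * (z * z) + + 2 * (+ 2 * t * (z * y)) + c * (y * y))) (sym (ℤP.pos-* 2 p)) ⟩
            + p * (+ (2 ℕ.* p) * (z * z) + + 2 * (+ 2 * t * (z * y)) + c * (y * y)) ∎
          inj : ∀ z y z′ y′ → t * y + + p * z ≡ t * y′ + + p * z′ → y ≡ y′ → (z , y) ≡ (z′ , y′)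
          inj z y z′ .y e refl = cong (_, y) (ℤP.*-cancelʳ-≡ z z′ (+ p) (trans (sym (difference t y (+ p) z))
            (trans (cong (_- t * y) e) (difference t y (+ p) z′))))
          restore : ∀ x u → u + (x - u) ≡ x
          restore = solve-∀
          surj : ∀ xy → Abs (Diag 2 5 N) xy × On xy → ∃ λ zy → Form (+ (2 ℕ.* p)) (+ 2 * t) c M zy × point zy ≡ xy
          surj (x , y) (eq , divides z x-ty) = (z , y) ,
            ℤP.*-cancelˡ-≡ (+ p) _ _ (trans (sym (value z y)) (trans (cong (λ v → + 2 * (v * v) + + 5 * (y * y)) x≡) (trans (Diag⇒ℤ 2 5 N x y eq) (ℤP.pos-* p M)))) ,
            cong (_, y) x≡
            where
            x≡ : t * y + + p * z ≡ x
            x≡ = trans (cong (λ v → t * y + v) (trans (ℤP.*-comm (+ p) z) (sym x-ty))) (restore x (t * y))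

        -- Exactly two of the sign choices of each positive solution lie on the lattice, whose
        -- points number 4 k; hence 2 j = 4 k.
        half : ∀ {j} → Card (Diag 2 5 N) j → parity j ≡ false
        half {j} J =
          let k , K = reduce (2 ℕ.* p) {{ℕP.m*n≢0 2 p}} (+ 2 * t) c determinant
              eq = Card-unique (Card-half {C = On} (λ (x , y) → + p ∣ᶻ? (x - t * y)) nonzero On-neg On-some On-excl J) (lattice K)
          in trans (cong parity (double-injective {j} {k ℕ.+ k} eq)) (parity-double k)
          where
          i₁ : ∀ c p → + 2 * p * c ≡ + 2 * (c * p)
          i₁ = solve-∀
          i₂ : ∀ t → + 2 * (+ 2 * (t * t) + + 5) ≡ + 10 + + 2 * t * (+ 2 * t)
          i₂ = solve-∀
          determinant : + (2 ℕ.* p) * c ≡ + 10 + + 2 * t * (+ 2 * t)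
          determinant = trans (cong (_* c) (ℤP.pos-* 2 p)) (trans (i₁ c (+ p)) (trans (cong (+ 2 *_) (sym tt)) (i₂ t)))

      -- Take t = x v with v an inverse of y modulo p: multiply N = 2 x² + 5 y² by v² and correct v²
      -- y² to 1.
      slope-equation : ∀ x y v → Diag 2 5 N (x , y) → + p ∣ᶻ + 1 - v * + y → + p ∣ᶻ + 2 * (+ x * v * (+ x * v)) + + 5
      slope-equation x y v eq p∣ = subst (+ p ∣ᶻ_) (sym expand) (∣m∣n⇒∣m+n {+ p} {+ N * (v * v)} {+ 5 * ((+ 1 - v * + y) * (+ 1 + v * + y))}
          (∣m⇒∣m*n {+ p} {+ N} (v * v) p∣N) (∣n⇒∣m*n (+ 5) {(+ 1 - v * + y) * (+ 1 + v * + y)} (∣m⇒∣m*n {+ p} {+ 1 - v * + y} (+ 1 + v * + y) p∣)))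
        where
        identity : ∀ x y v → + 2 * (x * v * (x * v)) + + 5 ≡
               (+ 2 * (x * x) + + 5 * (y * y)) * (v * v) + + 5 * ((+ 1 - v * y) * (+ 1 + v * y))
        identity = solve-∀
        expand : + 2 * (+ x * v * (+ x * v)) + + 5 ≡ + N * (v * v) + + 5 * ((+ 1 - v * + y) * (+ 1 + v * + y))
        expand = trans (identity (+ x) (+ y) v)
          (cong (λ w → w * (v * v) + + 5 * ((+ 1 - v * + y) * (+ 1 + v * + y))) (Diag⇒ℤ 2 5 N (+ x) (+ y) eq))

      slope : ∀ x y → Diag 2 5 N (x , y) → ∃₂ λ t c → + 2 * (t * t) + + 5 ≡ c * + p
      slope x y eq =
        let v , p∣1-vy = inverse-mod {p} {y} pr (λ p∣y → p∤y (+ x) (+ y) eq (∣ᵤ⇒∣ {+ p} {+ y} p∣y))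
            divides c e = slope-equation x y v eq p∣1-vy
        in + x * v , c , e

    representations-even : ∀ {j} → Card (Diag 2 5 N) j → parity j ≡ false
    -- One solution is enough to produce a slope t; if there is none, the count is 0 and already
    -- even.
    representations-even {j} J with Card.elements J | Card.sound J | Card.size J
    ... | [] | _ | 0≡j = cong parity (sym 0≡j)
    ... | (x , y) ∷ _ | sound | _ = let t , c , tt = slope x y (sound (here refl)) in Slope.half t c tt J

open Determinant10

-- Counting functions, and the primes as a set of density zero

module PrimeCounting where

  open import Data.Bool using (Bool; true; false; if_then_else_)
  open import Data.Nat using (ℕ; zero; suc; _+_; _*_; _∸_; _^_; _≤_; _<_; z≤n; s≤s; NonZero; _!; ≢-nonZero; ≢-nonZero⁻¹; nonTrivial⇒≢1)
  open import Data.Nat.Properties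
  open import Data.Nat.Divisibility
  open import Data.Nat.DivMod using (m/n*n≡m)
  open import Data.Nat.Combinatorics using (_C_; nCk+nC[k+1]≡[n+1]C[k+1]; nCn≡1; nCk≡nC[n∸k]; k>n⇒nCk≡0; nCk≡n!/k![n-k]!; k![n∸k]!∣n!)
  open import Data.Nat.Primality using (Prime; prime?; euclidsLemma; prime⇒nonTrivial)
  open import Data.Nat.Tactic.RingSolver using (solve-∀)
  open import Data.List using (List; []; _∷_; length)
  open import Data.List.Relation.Unary.Unique.Propositional using (Unique)
  open import Data.List.Relation.Unary.AllPairs using ([]; _∷_)
  open import Data.List.Relation.Unary.All as All using (All; []; _∷_)
  open import Data.List.Relation.Unary.Any using (here; there)
  open import Data.List.Membership.Propositional using (_∈_)
  open import Data.Product using (∃; _×_; _,_; proj₁)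
  open import Data.Sum using (inj₁; inj₂; [_,_]′)
  open import Data.Empty using (⊥-elim)
  open import Relation.Nullary using (¬_; yes; no)
  open import Relation.Nullary.Decidable using (does)
  open import Relation.Binary.PropositionalEquality using (_≡_; refl; sym; trans; cong; subst; subst₂)
  support : (ℕ → Bool) → ℕ → List ℕ
  support f zero = []
  support f (suc x) = if f x then x ∷ support f x else support f x

  count : (ℕ → Bool) → ℕ → ℕ
  count f x = length (support f x)

  support-sound : ∀ f x {n} → n ∈ support f x → n < x × f n ≡ true
  support-sound f (suc x) n∈ with f x in eq
  support-sound f (suc x) (here refl) | true = n<1+n x , eq
  support-sound f (suc x) (there n∈) | true = let n<x , p = support-sound f x n∈ in m<n⇒m<1+n n<x , p
  support-sound f (suc x) n∈ | false = let n<x , p = support-sound f x n∈ in m<n⇒m<1+n n<x , p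

  support-complete : ∀ f x {n} → n < x → f n ≡ true → n ∈ support f x
  support-complete f (suc x) {n} n<x p with f x in eq | m≤n⇒m<n∨m≡n (≤-pred n<x)
  ... | true | inj₁ n<x′ = there (support-complete f x n<x′ p)
  ... | true | inj₂ refl = here refl
  ... | false | inj₁ n<x′ = support-complete f x n<x′ p
  ... | false | inj₂ refl = ⊥-elim (false≢true (trans (sym eq) p))

  support-unique : ∀ f x → Unique (support f x)
  support-unique f zero = []
  support-unique f (suc x) with f x
  ... | true = All.tabulate (λ n∈ → >⇒≢ (proj₁ (support-sound f x n∈))) ∷ support-unique f x
  ... | false = support-unique f x

  count-suc-≤ : ∀ f x → count f x ≤ count f (suc x)
  count-suc-≤ f x with f x
  ... | true = n≤1+n _
  ... | false = ≤-refl

  count-mono : ∀ f {x y} → x ≤ y → count f x ≤ count f y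
  count-mono f {x} {y} x≤y = subst (λ v → count f x ≤ count f v) (m∸n+n≡m x≤y) (go (y ∸ x))
    where
    go : ∀ k → count f x ≤ count f (k + x)
    go zero = ≤-refl
    go (suc k) = ≤-trans (go k) (count-suc-≤ f (k + x))

  isPrime : ℕ → Bool
  isPrime n = does (prime? n)

  -- Chebyshev's bound: the primes in (m , 2 m] divide the central binomial coefficient.

  module PrimesAbove (m : ℕ) where

    primorial : ℕ → ℕ
    primorial zero = 1
    primorial (suc j) = if isPrime (suc j + m) then (suc j + m) * primorial j else primorial j

    prime∣primorial : ∀ j {q} → Prime q → q ∣ primorial j → q ≤ j + m
    prime∣primorial zero pr q∣1 = ⊥-elim (nonTrivial⇒≢1 {{prime⇒nonTrivial pr}} (∣1⇒≡1 q∣1))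
    prime∣primorial (suc j) {q} pr q∣ with prime? (suc j + m)
    ... | no _ = m≤n⇒m≤1+n (prime∣primorial j pr q∣)
    ... | yes _ with euclidsLemma (suc j + m) (primorial j) pr q∣
    ... | inj₁ q∣p = ∣⇒≤ q∣p
    ... | inj₂ q∣P = m≤n⇒m≤1+n (prime∣primorial j pr q∣P)

    -- The newest prime exceeds every prime factor of the product so far, so it must divide the
    -- cofactor.
    primorial∣ : ∀ B j → (∀ q → Prime q → m < q → q ≤ j + m → q ∣ B) → primorial j ∣ B
    primorial∣ B zero _ = 1∣ B
    primorial∣ B (suc j) all with prime? (suc j + m) | primorial∣ B j (λ q pr m<q q≤ → all q pr m<q (m≤n⇒m≤1+n q≤))
    ... | no _ | P∣B = P∣B
    ... | yes pr | divides r refl with euclidsLemma r (primorial j) pr (all (suc j + m) pr (s≤s (m≤n+m m j)) ≤-refl)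
    ... | inj₁ (divides s refl) = divides s (*-assoc s (suc j + m) (primorial j))
    ... | inj₂ q∣P = ⊥-elim (<-irrefl refl (prime∣primorial j pr q∣P))

    -- All k primes in (m , m + j] exceed m. Fixing k by an equation between counts avoids truncated
    -- subtraction in the recursion.
    primorial-≥ : ∀ j k → count isPrime (suc (j + m)) ≡ k + count isPrime (suc m) → m ^ k ≤ primorial j
    primorial-≥ zero k eq = subst (λ k → m ^ k ≤ 1) (+-cancelʳ-≡ (count isPrime (suc m)) 0 k eq) ≤-refl
    primorial-≥ (suc j) k eq with prime? (suc j + m)
    ... | no _ = primorial-≥ j k eq
    primorial-≥ (suc j) zero eq | yes pr = ⊥-elim (<-irrefl refl (≤-trans (s≤s (count-mono isPrime (s≤s (m≤n+m m j)))) (≤-reflexive eq)))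
    primorial-≥ (suc j) (suc k) eq | yes pr = *-mono-≤ (m≤n+m m (suc j)) (primorial-≥ j k (suc-injective eq))

  nC0≡1 : ∀ n → n C 0 ≡ 1
  nC0≡1 n = trans (nCk≡nC[n∸k] {0} {n} z≤n) (nCn≡1 n)

  nCk≤2^n : ∀ n k → n C k ≤ 2 ^ n
  nCk≤2^n zero zero = ≤-reflexive (nC0≡1 0)
  nCk≤2^n zero (suc k) = ≤-trans (≤-reflexive (k>n⇒nCk≡0 {0} {suc k} (s≤s z≤n))) z≤n
  nCk≤2^n (suc n) zero = ≤-trans (≤-reflexive (nC0≡1 (suc n))) (m^n>0 2 (suc n))
  nCk≤2^n (suc n) (suc k) = subst (_≤ 2 ^ suc n) (nCk+nC[k+1]≡[n+1]C[k+1] n k)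
    (+-mono-≤ (nCk≤2^n n k) (≤-trans (nCk≤2^n n (suc k)) (≤-reflexive (sym (+-identityʳ (2 ^ n))))))

  prime∤! : ∀ {q} → Prime q → ∀ m → m < q → ¬ q ∣ m !
  prime∤! pr zero _ q∣1 = nonTrivial⇒≢1 {{prime⇒nonTrivial pr}} (∣1⇒≡1 q∣1)
  prime∤! pr (suc m) m<q q∣ with euclidsLemma (suc m) (m !) pr q∣
  ... | inj₁ q∣sm = <⇒≱ m<q (∣⇒≤ q∣sm)
  ... | inj₂ q∣m! = prime∤! pr m (<-trans (n<1+n m) m<q) q∣m!

  central : ∀ m → ((m + m) C m) * (m ! * m !) ≡ (m + m) !
  central m = subst (λ v → ((m + m) C m) * (m ! * v !) ≡ (m + m) !) (m+n∸n≡m m m)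
    (trans (cong (_* (m ! * (m + m ∸ m) !)) (nCk≡n!/k![n-k]! {m + m} {m} (m≤m+n m m)))
           (m/n*n≡m {{m !* (m + m ∸ m) !≢0}} (k![n∸k]!∣n! (m≤m+n m m))))

  central≢0 : ∀ m → NonZero ((m + m) C m)
  central≢0 m = ≢-nonZero λ eq → ≢-nonZero⁻¹ ((m + m) !) {{(m + m) !≢0}} (trans (sym (central m)) (cong (_* (m ! * m !)) eq))

  prime∣central : ∀ m q → Prime q → m < q → q ≤ m + m → q ∣ (m + m) C m
  prime∣central m q pr m<q q≤2m with euclidsLemma ((m + m) C m) (m ! * m !) pr (subst (q ∣_) (sym (central m)) (∣-trans (self∣! q m<q) (m≤n⇒m!∣n! q≤2m)))
    where
    self∣! : ∀ n → m < n → n ∣ n !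
    self∣! (suc n) _ = m∣m*n (n !)
  ... | inj₁ q∣C = q∣C
  ... | inj₂ q∣m!m! = ⊥-elim ([ prime∤! pr m m<q , prime∤! pr m m<q ]′ (euclidsLemma (m !) (m !) pr q∣m!m!))

  prime-count-doubling : ∀ m k → count isPrime (suc (m + m)) ≡ k + count isPrime (suc m) → m ^ k ≤ 2 ^ (m + m)
  prime-count-doubling m k eq = ≤-trans (primorial-≥ m k eq)
    (≤-trans (∣⇒≤ {{central≢0 m}} (primorial∣ ((m + m) C m) m (prime∣central m))) (nCk≤2^n (m + m) m))
    where open PrimesAbove m

  π : ℕ → ℕ
  π k = count isPrime (suc (2 ^ k))

  -- At m = 2^k doubling reads 2^(k r) ≤ 2^(2^(k+1)) for the r primes in (2^k , 2^(k+1)], so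
  -- exponents can be compared directly.
  π-suc : ∀ k → k * π (suc k) ≤ k * π k + 2 ^ suc k
  π-suc k = ≤-trans (≤-reflexive (trans (cong (k *_) (trans (cong (λ v → count isPrime (suc (m + v))) (+-identityʳ m)) grow)) (trans (*-distribˡ-+ k r (π k)) (+-comm (k * r) (k * π k)))))
    (+-monoʳ-≤ (k * π k) (^-cancelʳ-≤ (k * r) (2 ^ suc k) bound))
    where
    m = 2 ^ k
    r = count isPrime (suc (m + m)) ∸ π k
    grow : count isPrime (suc (m + m)) ≡ r + π k
    grow = sym (m∸n+n≡m (count-mono isPrime (s≤s (m≤m+n m m))))
    bound : 2 ^ (k * r) ≤ 2 ^ (2 ^ suc k)
    bound = subst₂ _≤_ (^-*-assoc 2 k r) (cong (λ v → 2 ^ (m + v)) (sym (+-identityʳ m))) (prime-count-doubling m r grow)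
    ^-cancelʳ-≤ : ∀ a c → 2 ^ a ≤ 2 ^ c → a ≤ c
    ^-cancelʳ-≤ a c le = ≮⇒≥ λ c<a → <⇒≱ (^-monoʳ-< 2 (s≤s (s≤s z≤n)) c<a) le

  -- The increment at k carries the weight k ≥ K; keeping only the fixed weight K lets increments be
  -- added up, and the powers of 2 form a geometric sum.
  π-linear : ∀ K j → K * π (j + K) ≤ 2 ^ suc (j + K) + K * π K
  π-linear K zero = m≤n+m (K * π K) (2 ^ suc K)
  π-linear K (suc j) = ≤-trans (step K (π (suc (j + K))) (π (j + K)) (2 ^ suc (j + K)) (j + K) (m≤n+m K j) (π-mono (j + K)) (π-suc (j + K)))
    (≤-trans (+-monoˡ-≤ (2 ^ suc (j + K)) (π-linear K j)) (≤-reflexive (identity (2 ^ suc (j + K)) (K * π K))))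
    where
    identity : ∀ a c → a + c + a ≡ 2 * a + c
    identity = solve-∀
    π-mono : ∀ i → π i ≤ π (suc i)
    π-mono i = count-mono isPrime (s≤s (m≤m+n (2 ^ i) _))
    step : ∀ K p′ p e k → K ≤ k → p ≤ p′ → k * p′ ≤ k * p + e → K * p′ ≤ K * p + e
    step K p′ p e k K≤k p≤p′ le = subst (λ v → K * v ≤ K * p + e) (m+[n∸m]≡n p≤p′)
      (subst (_≤ K * p + e) (sym (*-distribˡ-+ K p d)) (+-monoʳ-≤ (K * p) (≤-trans (*-monoˡ-≤ d K≤k)
        (+-cancelˡ-≤ (k * p) (k * d) e (subst (_≤ k * p + e) (trans (cong (k *_) (sym (m+[n∸m]≡n p≤p′))) (*-distribˡ-+ k p d)) le)))))
      where d = p′ ∸ p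

  binary-scale : ∀ X → ∃ λ j → 2 ^ j ≤ suc X × suc X < 2 ^ suc j
  binary-scale zero = 0 , ≤-refl , s≤s (s≤s z≤n)
  binary-scale (suc X) with binary-scale X
  ... | j , lo , hi with m≤n⇒m<n∨m≡n hi
  ... | inj₁ hi′ = j , m≤n⇒m≤1+n lo , hi′
  ... | inj₂ eq = suc j , ≤-reflexive (sym eq) , subst (_< 2 ^ suc (suc j)) (sym eq) (^-monoʳ-< 2 (s≤s (s≤s z≤n)) (n<1+n (suc j)))

  primes-sparse : ∀ K → ∃ λ X₀ → ∀ X → X₀ ≤ X → K * count isPrime (suc X) ≤ X
  primes-sparse K = 2 ^ K′ + K′ * π K′ , bound
    where
    -- Here 5 = 4 + 1: for 2^j ≤ X < 2^(j+1), `π-linear` at j + 1 costs 2^(j+2) ≤ 4 X, and its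
    -- constant term is absorbed by one more X.
    K′ = 5 * K
    bound : ∀ X → 2 ^ K′ + K′ * π K′ ≤ X → K * count isPrime (suc X) ≤ X
    bound zero le = ⊥-elim (<⇒≱ (m^n>0 2 K′) (≤-trans (m≤m+n (2 ^ K′) _) le))
    bound (suc X) le with binary-scale X
    ... | j , lo , hi = *-cancelˡ-≤ 5 (begin
        5 * (K * count isPrime (suc (suc X)))   ≡⟨ sym (*-assoc 5 K _) ⟩
        K′ * count isPrime (suc (suc X))        ≤⟨ *-monoʳ-≤ K′ (count-mono isPrime (s≤s (<⇒≤ hi))) ⟩
        K′ * π (suc j)                          ≡⟨ cong (λ v → K′ * π v) (sym (m∸n+n≡m K′≤)) ⟩
        K′ * π (suc j ∸ K′ + K′)                ≤⟨ π-linear K′ (suc j ∸ K′) ⟩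
        2 ^ suc (suc j ∸ K′ + K′) + K′ * π K′   ≡⟨ cong (λ v → 2 ^ suc v + K′ * π K′) (m∸n+n≡m K′≤) ⟩
        2 ^ suc (suc j) + K′ * π K′             ≤⟨ +-mono-≤ (*-monoʳ-≤ 2 (*-monoʳ-≤ 2 lo)) (≤-trans (m≤n+m _ (2 ^ K′)) le) ⟩
        2 * (2 * suc X) + suc X                 ≡⟨ identity (suc X) ⟩
        5 * suc X ∎)
      where
      open ≤-Reasoning
      identity : ∀ X → 2 * (2 * X) + X ≡ 5 * X
      identity = solve-∀
      K′≤ : K′ ≤ suc j
      K′≤ = ≮⇒≥ λ sj<K′ → <⇒≱ hi (≤-trans (^-monoʳ-≤ 2 (<⇒≤ sj<K′)) (≤-trans (m≤m+n (2 ^ K′) _) le))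

open PrimeCounting

-- Numbers without a usable prime divisor form a set of density zero

module SparseNumbers where

  open import Data.Bool using (Bool; true)
  open import Data.Nat using (ℕ; zero; suc; _+_; _*_; _∸_; _≤_; _<_; z≤n; s≤s; NonZero; _≤?_; _/_; ≢-nonZero; ≢-nonZero⁻¹; >-nonZero; >-nonZero⁻¹; nonTrivial⇒n>1; _≟_)
  open import Data.Nat.Properties
  open import Data.Nat.Divisibility
  open import Data.Nat.DivMod using (m/n*n≤m; m*n/n≡m; /-monoˡ-≤)
  open import Data.Nat.GCD using (gcd; gcd[m,n]∣m; gcd[m,n]∣n; gcd-greatest)
  open import Data.Nat.Induction using (<-rec)
  open import Data.Nat.ListAction using (product)
  open import Data.Nat.Primality using (Prime; prime?; euclidsLemma; prime⇒nonZero; prime⇒nonTrivial)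
  open import Data.Nat.Primality.Factorisation using (factorise)
  open import Data.Nat.Tactic.RingSolver using (solve-∀)
  open import Data.List using (List; []; _∷_; _++_; length; map; upTo)
  open import Data.List.Properties using (length-++; length-map; length-upTo)
  open import Data.List.Relation.Unary.All using ([]; _∷_)
  open import Data.List.Membership.Propositional using (_∈_)
  open import Data.List.Membership.Propositional.Properties using (∈-++⁺ˡ; ∈-++⁺ʳ; ∈-map⁺; ∈-map⁻; ∈-upTo⁺)
  open import Data.Product using (∃; ∃₂; _×_; _,_; proj₁; proj₂)
  open import Data.Sum using (_⊎_; inj₁; inj₂; [_,_]′)
  open import Data.Empty using (⊥-elim)
  open import Function using (_∘_)
  open import Relation.Nullary using (¬_; yes; no)
  open import Relation.Nullary.Decidable using (dec-true)
  open import Relation.Binary.PropositionalEquality using (_≡_; _≢_; refl; sym; trans; cong; cong₂; subst; subst₂)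
  -- These are the N that the parity argument does not reach. In the first kind s may still contain
  -- squares; s ≤ 5 t is what remains of s ∣ 5 t, and it gives N ≤ 5 t³.
  SmallSquarefreePart PrimeTimesSquare Sparse : ℕ → Set
  SmallSquarefreePart N = ∃₂ λ s t → N ≡ s * (t * t) × s ≤ 5 * t
  PrimeTimesSquare N = ∃₂ λ p u → Prime p × (N ≡ p * (u * u) ⊎ N ≡ 5 * (p * (u * u)))
  Sparse N = SmallSquarefreePart N ⊎ PrimeTimesSquare N

  ExactDivisor : ℕ → Set
  ExactDivisor N = ∃₂ λ p M → Prime p × N ≡ p * M × ¬ p ∣ M × ¬ p ∣ 5

  prime-factor : ∀ n .{{_ : NonZero n}} → n ≢ 1 → ∃ λ p → Prime p × p ∣ n
  prime-factor n n≢1 with factorise n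
  ... | record { factors = [] ; isFactorisation = n≡1 } = ⊥-elim (n≢1 n≡1)
  ... | record { factors = p ∷ ps ; isFactorisation = n≡ ; factorsPrime = pr ∷ _ } = p , pr , subst (p ∣_) (sym n≡) (m∣m*n (product ps))

  -- Starting from s = N and t = 1, squares of primes move from s into t. If s does not divide 5 t,
  -- take a prime p dividing s / gcd(s , 5 t): either p² ∣ s and the descent continues, or p divides
  -- s once and is prime to 5 t, so it divides N exactly once.
  decompose : ∀ N .{{_ : NonZero N}} → SmallSquarefreePart N ⊎ ExactDivisor N
  decompose N = <-rec Goal step N 1 (sym (*-identityʳ N))
    where
    Goal : ℕ → Set
    Goal s = ∀ t → N ≡ s * (t * t) → SmallSquarefreePart N ⊎ ExactDivisor N
    regroup : ∀ s p t → s * (p * p) * (t * t) ≡ s * ((p * t) * (p * t))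
    regroup = solve-∀
    step : ∀ s → (∀ {s′} → s′ < s → Goal s′) → Goal s
    step s ih t N≡ = go (gcd[m,n]∣m s (5 * t))
      where
      s≢0 : s ≢ 0
      s≢0 refl = ≢-nonZero⁻¹ N N≡
      t≢0 : t ≢ 0
      t≢0 refl = ≢-nonZero⁻¹ N (trans N≡ (*-zeroʳ s))
      square-divisor : ∀ {p} → Prime p → p * p ∣ s → SmallSquarefreePart N ⊎ ExactDivisor N
      square-divisor {p} pr (divides s′ s≡) = ih s′<s (p * t) (trans N≡ (trans (cong (_* (t * t)) s≡) (regroup s′ p t)))
        where
        s′≢0 : s′ ≢ 0
        s′≢0 refl = s≢0 s≡
        s′<s : s′ < s
        s′<s = subst (s′ <_) (sym s≡) (m<m*n s′ (p * p) {{≢-nonZero s′≢0}} (<-≤-trans (nonTrivial⇒n>1 p {{prime⇒nonTrivial pr}}) (m≤m*n p p {{prime⇒nonZero pr}})))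
      go : gcd s (5 * t) ∣ s → SmallSquarefreePart N ⊎ ExactDivisor N
      go (divides h s≡hg) with h ≟ 1
      ... | yes refl = inj₁ (s , t , N≡ , ∣⇒≤ {{m*n≢0 5 t {{_}} {{≢-nonZero t≢0}}}} (subst (_∣ 5 * t) (sym (trans s≡hg (+-identityʳ _))) (gcd[m,n]∣n s (5 * t))))
      ... | no h≢1 with prime-factor h {{≢-nonZero (λ { refl → s≢0 s≡hg })}} h≢1
      ... | p , pr , p∣h with p ∣? 5 * t
      ... | yes p∣5t = square-divisor pr (subst (p * p ∣_) (sym s≡hg) (*-pres-∣ p∣h (gcd-greatest p∣s p∣5t)))
        where
        p∣s : p ∣ s
        p∣s = subst (p ∣_) (sym s≡hg) (∣m⇒∣m*n (gcd s (5 * t)) p∣h)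
      ... | no p∤5t with p * p ∣? s
      ... | yes pp∣s = square-divisor pr pp∣s
      ... | no pp∤s with subst (p ∣_) (sym s≡hg) (∣m⇒∣m*n (gcd s (5 * t)) p∣h)
      ... | divides m s≡mp = inj₂ (p , m * (t * t) , pr ,
              trans N≡ (trans (cong (_* (t * t)) (trans s≡mp (*-comm m p))) (*-assoc p m (t * t))) ,
              p∤M , λ p∣5 → p∤5t (∣m⇒∣m*n t p∣5))
        where
        p∤m : ¬ p ∣ m
        p∤m p∣m = pp∤s (subst (p * p ∣_) (sym s≡mp) (*-pres-∣ p∣m ∣-refl))
        p∤t : ¬ p ∣ t
        p∤t p∣t = p∤5t (∣n⇒∣m*n 5 p∣t)
        p∤M : ¬ p ∣ m * (t * t)
        p∤M p∣M = [ p∤m , [ p∤t , p∤t ]′ ∘ euclidsLemma t t pr ]′ (euclidsLemma m (t * t) pr p∣M)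

  squareMultiples : ℕ → ℕ → ℕ → List ℕ
  squareMultiples X T zero = []
  squareMultiples X T (suc j) = map (λ i → suc i * (t * t)) (upTo (X / (t * t))) ++ squareMultiples X T j
    where t = suc (j + T)

  -- The sum of X / t² over T < t ≤ T + j is at most X (1/T - 1/(T + j)) = X j / (T (T + j)), by
  -- comparison with the telescoping 1 / (t (t - 1)); denominators are cleared.
  length-squareMultiples : ∀ X T .{{_ : NonZero T}} j → length (squareMultiples X T j) * (T * (j + T)) ≤ X * j
  length-squareMultiples X T zero = z≤n
  length-squareMultiples X T (suc j) = *-cancelʳ-≤ _ _ (j + T) {{>-nonZero (≤-trans (>-nonZero⁻¹ T) (m≤n+m T j))}} (begin
    length (squareMultiples X T (suc j)) * (T * t) * (j + T)
      ≡⟨ cong (λ v → v * (T * t) * (j + T)) (trans (length-++ (map (λ i → suc i * (t * t)) (upTo (X / (t * t))))) (cong (_+ S) (trans (length-map (λ i → suc i * (t * t)) (upTo (X / (t * t)))) (length-upTo (X / (t * t)))))) ⟩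
    (a + S) * (T * t) * (j + T)
      ≡⟨ i₁ a S T t (j + T) ⟩
    (a * (t * (j + T))) * T + (S * (T * (j + T))) * t
      ≤⟨ +-mono-≤ (*-monoˡ-≤ T (≤-trans (*-monoʳ-≤ a (*-monoʳ-≤ t (n≤1+n (j + T)))) (m/n*n≤m X (t * t)))) (*-monoˡ-≤ t (length-squareMultiples X T j)) ⟩
    X * T + X * j * t
      ≡⟨ i₂ X T j ⟩
    X * suc j * (j + T) ∎)
    where
    open ≤-Reasoning
    t = suc (j + T)
    S = length (squareMultiples X T j)
    a = X / (t * t)
    i₁ : ∀ a S T t w → (a + S) * (T * t) * w ≡ (a * (t * w)) * T + (S * (T * w)) * t
    i₁ = solve-∀
    i₂ : ∀ X T j → X * T + X * j * suc (j + T) ≡ X * suc j * (j + T)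
    i₂ = solve-∀

  squareMultiples-bound : ∀ X T .{{_ : NonZero T}} j → T * length (squareMultiples X T j) ≤ X
  squareMultiples-bound X T j = *-cancelʳ-≤ _ _ (j + T) {{>-nonZero (≤-trans (>-nonZero⁻¹ T) (m≤n+m T j))}}
    (≤-trans (≤-reflexive (identity T (length (squareMultiples X T j)) (j + T)))
      (≤-trans (length-squareMultiples X T j) (*-monoʳ-≤ X (m≤m+n j T))))
    where
    identity : ∀ T S w → T * S * w ≡ S * (T * w)
    identity = solve-∀

  ∈-squareMultiples : ∀ X T J j s → j < J → 0 < s → s * (suc (j + T) * suc (j + T)) ≤ X →
                      s * (suc (j + T) * suc (j + T)) ∈ squareMultiples X T J
  ∈-squareMultiples X T (suc J) j (suc i) j<J _ le with m≤n⇒m<n∨m≡n (≤-pred j<J)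
  ... | inj₁ j<J′ = ∈-++⁺ʳ (map (λ i → suc i * (suc (J + T) * suc (J + T))) (upTo (X / (suc (J + T) * suc (J + T))))) (∈-squareMultiples X T J j (suc i) j<J′ (s≤s z≤n) le)
  ... | inj₂ refl = ∈-++⁺ˡ (∈-map⁺ (λ i → suc i * (suc (j + T) * suc (j + T))) (∈-upTo⁺ (subst (_≤ X / (suc (j + T) * suc (j + T))) (m*n/n≡m (suc i) (suc (j + T) * suc (j + T))) (/-monoˡ-≤ (suc (j + T) * suc (j + T)) le))))

  primeMultiples : ℕ → ℕ → List ℕ
  primeMultiples X zero = []
  primeMultiples X (suc T) = map (λ p → p * (T * T)) (support isPrime (suc X)) ++ (map (λ p → 5 * (p * (T * T))) (support isPrime (suc X)) ++ primeMultiples X T)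

  length-primeMultiples : ∀ X T → length (primeMultiples X T) ≡ T * (2 * count isPrime (suc X))
  length-primeMultiples X zero = refl
  length-primeMultiples X (suc T) = trans (length-++ (map (λ p → p * (T * T)) ps)) (trans (cong₂ _+_ (length-map _ ps)
    (trans (length-++ (map (λ p → 5 * (p * (T * T))) ps)) (cong₂ _+_ (length-map _ ps) (length-primeMultiples X T)))) (identity (length ps) T))
    where
    ps = support isPrime (suc X)
    identity : ∀ c T → c + (c + T * (2 * c)) ≡ suc T * (2 * c)
    identity = solve-∀

  ∈-primeMultiples : ∀ X T p u → u < T → Prime p → p ≤ X → (p * (u * u) ∈ primeMultiples X T) × (5 * (p * (u * u)) ∈ primeMultiples X T)
  ∈-primeMultiples X (suc T) p u u<T pr p≤X with m≤n⇒m<n∨m≡n (≤-pred u<T)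
  ... | inj₁ u<T′ = let q , r = ∈-primeMultiples X T p u u<T′ pr p≤X in
    ∈-++⁺ʳ (map (λ p → p * (T * T)) ps) (∈-++⁺ʳ (map (λ p → 5 * (p * (T * T))) ps) q) ,
    ∈-++⁺ʳ (map (λ p → p * (T * T)) ps) (∈-++⁺ʳ (map (λ p → 5 * (p * (T * T))) ps) r)
    where ps = support isPrime (suc X)
  ... | inj₂ refl = ∈-++⁺ˡ (∈-map⁺ (λ p → p * (T * T)) p∈) ,
    ∈-++⁺ʳ (map (λ p → p * (T * T)) (support isPrime (suc X))) (∈-++⁺ˡ (∈-map⁺ (λ p → 5 * (p * (T * T))) p∈))
    where
    p∈ : p ∈ support isPrime (suc X)
    p∈ = support-complete isPrime (suc X) (s≤s p≤X) (dec-true (prime? p) pr)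

  -- The cut T makes three lists: N ≤ 5 T³ if t ≤ T, multiples of t² if t > T, and p u² or 5 p u²
  -- with u ≤ T. Larger u fall under the second list again.
  cover : ℕ → ℕ → List ℕ
  cover X T = upTo (suc (5 * T * (T * T))) ++ (squareMultiples X T X ++ primeMultiples X (suc T))

  length-cover : ∀ X T → length (cover X T) ≡ suc (5 * T * (T * T)) + (length (squareMultiples X T X) + suc T * (2 * count isPrime (suc X)))
  length-cover X T = trans (length-++ (upTo (suc (5 * T * (T * T))))) (cong₂ _+_ (length-upTo (suc (5 * T * (T * T))))
    (trans (length-++ (squareMultiples X T X)) (cong (length (squareMultiples X T X) +_) (length-primeMultiples X (suc T)))))

  ∈-cover : ∀ X T N .{{_ : NonZero N}} → N ≤ X → Sparse N → N ∈ cover X T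
  ∈-cover X T N N≤X sparse = cases sparse
    where
    factor≤ : ∀ s t → N ≡ s * (t * t) → t ≤ N × s ≤ N × 0 < s
    factor≤ zero t N≡ = ⊥-elim (≢-nonZero⁻¹ N N≡)
    factor≤ (suc s) zero N≡ = ⊥-elim (≢-nonZero⁻¹ N (trans N≡ (*-zeroʳ (suc s))))
    factor≤ (suc s) (suc t) N≡ =
      subst (suc t ≤_) (sym N≡) (≤-trans (m≤m*n (suc t) (suc t)) (m≤n*m (suc t * suc t) (suc s))) ,
      subst (suc s ≤_) (sym N≡) (m≤m*n (suc s) (suc t * suc t)) , s≤s z≤n
    large : ∀ s t → N ≡ s * (t * t) → T < t → N ∈ cover X T
    large s t N≡ T<t = let t≤N , _ , 0<s = factor≤ s t N≡ in
      ∈-++⁺ʳ (upTo (suc (5 * T * (T * T)))) (∈-++⁺ˡ {xs = squareMultiples X T X} (subst (_∈ squareMultiples X T X) (trans (cong (λ v → s * (v * v)) t≡) (sym N≡))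
        (∈-squareMultiples X T X j s (j<X t≤N) 0<s (subst (_≤ X) (trans N≡ (cong (λ v → s * (v * v)) (sym t≡))) N≤X))))
      where
      j = t ∸ suc T
      t≡ : suc (j + T) ≡ t
      t≡ = trans (sym (+-suc j T)) (m∸n+n≡m T<t)
      j<X : t ≤ N → j < X
      j<X t≤N = <-≤-trans (s≤s (m≤m+n j T)) (≤-trans (≤-reflexive t≡) (≤-trans t≤N N≤X))
    cases : Sparse N → N ∈ cover X T
    cases (inj₁ (s , t , N≡ , s≤5t)) with t ≤? T
    ... | yes t≤T = ∈-++⁺ˡ (∈-upTo⁺ (s≤s (subst (_≤ 5 * T * (T * T)) (sym N≡) (*-mono-≤ (≤-trans s≤5t (*-monoʳ-≤ 5 t≤T)) (*-mono-≤ t≤T t≤T)))))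
    ... | no t≰T = large s t N≡ (≰⇒> t≰T)
    cases (inj₂ (p , u , pr , shape)) with u ≤? T
    cases (inj₂ (p , u , pr , inj₁ N≡)) | no u≰T = large p u N≡ (≰⇒> u≰T)
    cases (inj₂ (p , u , pr , inj₂ N≡)) | no u≰T = large (5 * p) u (trans N≡ (sym (*-assoc 5 p (u * u)))) (≰⇒> u≰T)
    cases (inj₂ (p , u , pr , inj₁ N≡)) | yes u≤T = ∈-++⁺ʳ (upTo (suc (5 * T * (T * T)))) (∈-++⁺ʳ (squareMultiples X T X)
      (subst (_∈ primeMultiples X (suc T)) (sym N≡) (proj₁ (∈-primeMultiples X (suc T) p u (s≤s u≤T) pr (≤-trans (proj₁ (proj₂ (factor≤ p u N≡))) N≤X)))))
    cases (inj₂ (p , u , pr , inj₂ N≡)) | yes u≤T = ∈-++⁺ʳ (upTo (suc (5 * T * (T * T)))) (∈-++⁺ʳ (squareMultiples X T X)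
      (subst (_∈ primeMultiples X (suc T)) (sym N≡) (proj₂ (∈-primeMultiples X (suc T) p u (s≤s u≤T) pr
        (≤-trans (m≤n*m p 5) (≤-trans (proj₁ (proj₂ (factor≤ (5 * p) u (trans N≡ (sym (*-assoc 5 p (u * u))))))) N≤X))))))

  DensityZero : (ℕ → Bool) → Set
  DensityZero f = ∀ K → ∃ λ x₀ → ∀ x → x₀ ≤ x → K * count f x ≤ x

  sparse-density : ∀ f c → c ≤ 7 → (∀ n → f n ≡ true → NonZero (24 * n + c) × Sparse (24 * n + c)) → DensityZero f
  sparse-density f c c≤7 sparse K = x₀ , bound
    where
    -- The N in question are at most 24 x + 7 ≤ 31 x, and each list may contribute a quarter of the
    -- allowed x; hence 124 = 4 * 31, and 4 * 31 in D. `suc K` keeps T nonzero.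
    T = 124 * suc K
    A = suc (5 * T * (T * T))
    D = 4 * 31 * (K * (suc T * 2))
    x₀ = 1 + 4 * (K * A) + proj₁ (primes-sparse D)
    bound : ∀ x → x₀ ≤ x → K * count f x ≤ x
    bound x x₀≤x = *-cancelˡ-≤ 4 (begin
      4 * (K * count f x)
        ≤⟨ *-monoʳ-≤ 4 (*-monoʳ-≤ K covered) ⟩
      4 * (K * (A + (S + suc T * (2 * P))))
        ≡⟨ i₁ K A S T P ⟩
      4 * (K * A) + (4 * (K * S) + 4 * (K * (suc T * 2)) * P)
        ≤⟨ +-mono-≤ A≤ (+-mono-≤ S≤ P≤) ⟩
      x + (x + x)
        ≤⟨ m≤n+m (x + (x + x)) x ⟩
      x + (x + (x + x))
        ≡⟨ i₂ x ⟩
      4 * x ∎)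
      where
      open ≤-Reasoning
      X = 24 * x + 7
      S = length (squareMultiples X T X)
      P = count isPrime (suc X)
      i₁ : ∀ K A S T P → 4 * (K * (A + (S + suc T * (2 * P)))) ≡ 4 * (K * A) + (4 * (K * S) + 4 * (K * (suc T * 2)) * P)
      i₁ = solve-∀
      i₂ : ∀ x → x + (x + (x + x)) ≡ 4 * x
      i₂ = solve-∀
      1≤x : 1 ≤ x
      1≤x = ≤-trans (s≤s z≤n) x₀≤x
      X≤31x : X ≤ 31 * x
      X≤31x = ≤-trans (+-monoʳ-≤ (24 * x) (*-monoʳ-≤ 7 1≤x)) (≤-reflexive (identity x))
        where
        identity : ∀ x → 24 * x + 7 * x ≡ 31 * x
        identity = solve-∀
      x≤X : x ≤ X
      x≤X = ≤-trans (m≤n*m x 24) (m≤m+n (24 * x) 7)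
      A≤ : 4 * (K * A) ≤ x
      A≤ = ≤-trans (≤-trans (n≤1+n _) (m≤m+n (1 + 4 * (K * A)) _)) x₀≤x
      S≤ : 4 * (K * S) ≤ x
      S≤ = *-cancelˡ-≤ 31 (≤-trans (≤-trans (≤-reflexive (identity K S)) (*-monoˡ-≤ S (*-monoʳ-≤ 124 (n≤1+n K)))) (≤-trans (squareMultiples-bound X T X) X≤31x))
        where
        identity : ∀ K S → 31 * (4 * (K * S)) ≡ 124 * K * S
        identity = solve-∀
      P≤ : 4 * (K * (suc T * 2)) * P ≤ x
      P≤ = *-cancelˡ-≤ 31 (≤-trans (≤-reflexive (identity (K * (suc T * 2)) P)) (≤-trans (proj₂ (primes-sparse D) X (≤-trans (≤-trans (m≤n+m _ (1 + 4 * (K * A))) x₀≤x) x≤X)) X≤31x))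
        where
        identity : ∀ w P → 31 * (4 * w * P) ≡ 4 * 31 * w * P
        identity = solve-∀
      covered : count f x ≤ A + (S + suc T * (2 * P))
      covered = subst₂ _≤_ (length-map (λ n → 24 * n + c) (support f x)) (length-cover X T)
        (length-⊆ (map-unique (λ n → 24 * n + c) (λ {m} {n} _ _ eq → *-cancelˡ-≡ m n 24 (+-cancelʳ-≡ c (24 * m) (24 * n) eq)) (support-unique f x))
          λ {N} N∈ → member (∈-map⁻ (λ n → 24 * n + c) N∈))
        where
        member : ∀ {N} → (∃ λ n → n ∈ support f x × N ≡ 24 * n + c) → N ∈ cover X T
        member (n , n∈ , refl) =
          let n<x , fn = support-sound f x n∈
              N≢0 , sp = sparse n fn
          in ∈-cover X T (24 * n + c) {{N≢0}} (+-mono-≤ (*-monoʳ-≤ 24 (<⇒≤ n<x)) c≤7) sp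

open SparseNumbers

-- Sparsity of the odd coefficients of θ(q) and of θ(q²) θ(q⁵)

module ThetaSparsity where

  open import Data.Bool using (true; false)
  open import Data.Nat using (ℕ; zero; suc; _+_; _*_; _≤_; z≤n; s≤s; NonZero; _≟_; ≢-nonZero; nonTrivial⇒≢1)
  open import Data.Nat.Properties
  open import Data.Nat.Divisibility
  open import Data.Nat.Primality using (Prime; prime[2]; prime⇒irreducible; prime⇒nonTrivial)
  open import Data.Nat.Tactic.RingSolver using (solve-∀)
  open import Data.Product using (∃; _,_)
  open import Data.Sum using (_⊎_; inj₁; inj₂)
  open import Data.Empty using (⊥; ⊥-elim)
  open import Function using (_∘_; id)
  open import Relation.Nullary using (¬_; yes; no; Dec)
  open import Relation.Nullary.Decidable using (from-no)
  open import Relation.Binary.PropositionalEquality using (_≡_; refl; sym; trans; cong; cong₂; subst)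
  24n+7-odd : ∀ n → ¬ 2 ∣ 24 * n + 7
  24n+7-odd n = odd⇒2∤ (12 * n + 3) (identity n)
    where
    identity : ∀ n → 24 * n + 7 ≡ suc (2 * (12 * n + 3))
    identity = solve-∀

  square-mod-3 : ∀ y → ∃ λ q → y * y ≡ 3 * q ⊎ y * y ≡ 3 * q + 1
  square-mod-3 zero = 0 , inj₁ refl
  square-mod-3 (suc zero) = 0 , inj₂ refl
  square-mod-3 (suc (suc zero)) = 1 , inj₂ refl
  square-mod-3 (suc (suc (suc y))) with square-mod-3 y
  ... | q , inj₁ eq = q + (2 * y + 3) , inj₁ (trans (expand y) (trans (cong (_+ 3 * (2 * y + 3)) eq) (sym (*-distribˡ-+ 3 q (2 * y + 3)))))
    where
    expand : ∀ y → suc (suc (suc y)) * suc (suc (suc y)) ≡ y * y + 3 * (2 * y + 3)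
    expand = solve-∀
  ... | q , inj₂ eq = q + (2 * y + 3) , inj₂ (trans (expand y) (trans (cong (_+ 3 * (2 * y + 3)) eq) (regroup q (2 * y + 3))))
    where
    expand : ∀ y → suc (suc (suc y)) * suc (suc (suc y)) ≡ y * y + 3 * (2 * y + 3)
    expand = solve-∀
    regroup : ∀ q r → 3 * q + 1 + 3 * r ≡ 3 * (q + r) + 1
    regroup = solve-∀

  -- Solutions are automatically prime to 6, so all of them are root pairs: a factor 3 in one
  -- coordinate would make the square of the other 2 modulo 3; y is odd, and an even x would make
  -- the left side 1 modulo 4 instead of 3.
  module _ (n x y : ℕ) (eq : Diag 2 5 (24 * n + 7) (x , y)) where

    private
      -- The offset c stands in for a subtraction modulo 3: it is chosen so that 3 divides r + c but
      -- not 7 + c.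
      remainder : ∀ c k r → 24 * n + 7 ≡ 3 * k + r → ¬ 3 ∣ (7 + c) → 3 ∣ r + c → ⊥
      remainder c k r e 3∤ 3∣ = 3∤ (∣m+n∣m⇒∣n (subst (3 ∣_) (trans (sym (+-assoc (3 * k) r c)) (trans (cong (_+ c) (sym e)) (+-assoc (24 * n) 7 c)))
        (∣m∣n⇒∣m+n (m∣m*n k) 3∣)) (∣m⇒∣m*n n (divides 8 refl)))

    roots-2∤y : ¬ 2 ∣ y
    roots-2∤y 2∣y = 24n+7-odd n (subst (2 ∣_) eq (∣m∣n⇒∣m+n (m∣m*n (x * x)) (∣n⇒∣m*n 5 (∣m⇒∣m*n y 2∣y))))

    roots-2∤x : ¬ 2 ∣ x
    roots-2∤x 2∣x with 2∣⇒double 2∣x | even⊎odd y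
    ... | _ | inj₁ (l , y≡) = roots-2∤y (subst (2 ∣_) (sym y≡) (m∣m*n l))
    ... | k , x≡ | inj₂ (l , y≡) = even≢odd (2 * (k * k) + 5 * (l * l + l)) (6 * n) (*-cancelˡ-≡ _ _ 2 (+-cancelʳ-≡ 5 _ _
        (trans (i₁ k l) (trans (cong₂ (λ u v → 2 * (u * u) + 5 * (v * v)) (sym x≡) (sym y≡)) (trans eq (i₂ n))))))
      where
      i₁ : ∀ k l → 2 * (2 * (2 * (k * k) + 5 * (l * l + l))) + 5 ≡ 2 * ((2 * k) * (2 * k)) + 5 * (suc (2 * l) * suc (2 * l))
      i₁ = solve-∀
      i₂ : ∀ n → 24 * n + 7 ≡ 2 * suc (2 * (6 * n)) + 5
      i₂ = solve-∀

    roots-3∤x : ¬ 3 ∣ x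
    roots-3∤x (divides k x≡) with square-mod-3 y
    ... | q , inj₁ yy = remainder 0 (2 * (k * x) + 5 * q) 0 (trans (sym eq) (trans (cong₂ (λ u v → 2 * (u * x) + 5 * v) x≡ yy) (identity k x q))) (from-no (3 ∣? 7)) (3 ∣0)
      where
      identity : ∀ k x q → 2 * (k * 3 * x) + 5 * (3 * q) ≡ 3 * (2 * (k * x) + 5 * q) + 0
      identity = solve-∀
    ... | q , inj₂ yy = remainder 1 (2 * (k * x) + 5 * q) 5 (trans (sym eq) (trans (cong₂ (λ u v → 2 * (u * x) + 5 * v) x≡ yy) (identity k x q))) (from-no (3 ∣? 8)) (divides 2 refl)
      where
      identity : ∀ k x q → 2 * (k * 3 * x) + 5 * (3 * q + 1) ≡ 3 * (2 * (k * x) + 5 * q) + 5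
      identity = solve-∀

    roots-3∤y : ¬ 3 ∣ y
    roots-3∤y (divides k y≡) with square-mod-3 x
    ... | q , inj₁ xx = remainder 0 (2 * q + 5 * (k * y)) 0 (trans (sym eq) (trans (cong₂ (λ u v → 2 * u + 5 * (v * y)) xx y≡) (identity k y q))) (from-no (3 ∣? 7)) (3 ∣0)
      where
      identity : ∀ k y q → 2 * (3 * q) + 5 * (k * 3 * y) ≡ 3 * (2 * q + 5 * (k * y)) + 0
      identity = solve-∀
    ... | q , inj₂ xx = remainder 1 (2 * q + 5 * (k * y)) 2 (trans (sym eq) (trans (cong₂ (λ u v → 2 * u + 5 * (v * y)) xx y≡) (identity k y q))) (from-no (3 ∣? 8)) (divides 1 refl)
      where
      identity : ∀ k y q → 2 * (3 * q + 1) + 5 * (k * 3 * y) ≡ 3 * (2 * q + 5 * (k * y)) + 2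
      identity = solve-∀

  rootpairs-25 : ∀ i j → 2 * (24 * i + 1) + 5 * (24 * j + 1) ≡ 24 * (i * 2 + j * 5) + 7
  rootpairs-25 = solve-∀

  diag⇒rootpairs : ∀ n xy → Diag 2 5 (24 * n + 7) xy → RootPairs 2 5 n xy
  diag⇒rootpairs n (x , y) eq =
    let i , p = coprime-6-square x (roots-2∤x n x y eq) (roots-3∤x n x y eq)
        j , q = coprime-6-square y (roots-2∤y n x y eq) (roots-3∤y n x y eq)
    in i , j , p , q , *-cancelˡ-≡ (i * 2 + j * 5) n 24 (+-cancelʳ-≡ 7 (24 * (i * 2 + j * 5)) (24 * n)
         (trans (sym (rootpairs-25 i j)) (trans (cong₂ (λ u v → 2 * u + 5 * v) (sym p) (sym q)) eq)))

  rootpairs⇒diag : ∀ n xy → RootPairs 2 5 n xy → Diag 2 5 (24 * n + 7) xy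
  rootpairs⇒diag n (x , y) (i , j , p , q , s) =
    trans (cong₂ (λ u v → 2 * u + 5 * v) p q) (trans (rootpairs-25 i j) (cong (λ v → 24 * v + 7) s))

  θ₂θ₅ : Series
  θ₂θ₅ = dilate 2 θ ⊛ θ₅

  -- As 24 n + 7 is odd, so are p and M. This excludes the axes with coefficients 2 and 10; those
  -- with 1 and 5 remain as the exceptions.
  θ₂θ₅-exact : ∀ n p M → Prime p → 24 * n + 7 ≡ p * M → ¬ p ∣ M → ¬ p ∣ 5 →
               (∀ x → ¬ Axis 1 M x) → (∀ x → ¬ Axis 5 M x) → θ₂θ₅ n ≡ false
  θ₂θ₅-exact n p M pr N≡ p∤M p∤5 ¬1 ¬5 =
    let j , J = Card-box {P = Diag 2 5 (24 * n + 7)} (λ (x , y) → _ ≟ _) (24 * n + 7) (λ x y → Diag-bound 2 5 (24 * n + 7) x y)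
    in trans (θθ-parity 2 5 n (Card-image J id (diag⇒rootpairs n) (λ _ _ _ _ e → e) (λ xy r → xy , rootpairs⇒diag n xy r , refl)))
         (ExactPrime.representations-even pr {{M≢0}} p∤2 p∤5 p∤M ¬1 ¬10 ¬2 ¬5 (subst (λ N → Card (Diag 2 5 N) j) N≡ J))
    where
    M≢0 : NonZero M
    M≢0 = ≢-nonZero λ { refl → p∤M (p ∣0) }
    2∤M : ¬ 2 ∣ M
    2∤M 2∣M = 24n+7-odd n (subst (2 ∣_) (sym N≡) (∣n⇒∣m*n p 2∣M))
    p∤2 : ¬ p ∣ 2
    p∤2 p∣2 with prime⇒irreducible prime[2] p∣2
    ... | inj₁ p≡1 = nonTrivial⇒≢1 {{prime⇒nonTrivial pr}} p≡1
    ... | inj₂ p≡2 = 24n+7-odd n (subst (2 ∣_) (sym N≡) (∣m⇒∣m*n M (subst (2 ∣_) (sym p≡2) ∣-refl)))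
    ¬2 : ∀ x → ¬ Axis 2 M x
    ¬2 x e = 2∤M (subst (2 ∣_) e (m∣m*n (x * x)))
    ¬10 : ∀ x → ¬ Axis 10 M x
    ¬10 x e = 2∤M (subst (2 ∣_) e (∣m⇒∣m*n (x * x) (divides 5 refl)))

  θ₂θ₅-sparse : ∀ n → θ₂θ₅ n ≡ true → Sparse (24 * n + 7)
  θ₂θ₅-sparse n t = cases (decompose (24 * n + 7) {{≢-nonZero λ e → 24n+7-odd n (subst (2 ∣_) (sym e) (2 ∣0))}})
    where
    swap-5 : ∀ p z → p * (5 * z) ≡ 5 * (p * z)
    swap-5 = solve-∀
    cases : SmallSquarefreePart (24 * n + 7) ⊎ ExactDivisor (24 * n + 7) → Sparse (24 * n + 7)
    cases (inj₁ s) = inj₁ s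
    cases (inj₂ (p , M , pr , N≡ , p∤M , p∤5)) = go (axis? 1 M) (axis? 5 M)
      where
      go : Dec (∃ (Axis 1 M)) → Dec (∃ (Axis 5 M)) → Sparse (24 * n + 7)
      go (yes (w , e)) _ = inj₂ (p , w , pr , inj₁ (trans N≡ (cong (p *_) (trans (sym e) (*-identityˡ (w * w))))))
      go (no _) (yes (z , e)) = inj₂ (p , z , pr , inj₂ (trans N≡ (trans (cong (p *_) (sym e)) (swap-5 p (z * z)))))
      go (no ¬1) (no ¬5) = ⊥-elim (false≢true (trans (sym (θ₂θ₅-exact n p M pr N≡ p∤M p∤5 (λ x e → ¬1 (x , e)) (λ x e → ¬5 (x , e)))) t))

  θ₂θ₅-density : DensityZero θ₂θ₅
  θ₂θ₅-density = sparse-density θ₂θ₅ 7 ≤-refl (λ n t → ≢-nonZero (λ e → 24n+7-odd n (subst (2 ∣_) (sym e) (2 ∣0))) , θ₂θ₅-sparse n t)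

  θ-density : DensityZero θ
  θ-density = sparse-density θ 1 (s≤s z≤n) (λ n t → let x , e = does-true⇒ (square? (24 * n + 1)) t in
    ≢-nonZero (1+n≢0 ∘ trans (+-comm 1 (24 * n))) ,
    inj₁ (1 , x , trans (sym e) (sym (*-identityˡ (x * x))) , ≤-trans (positive x n e) (m≤n*m x 5)))
    where
    positive : ∀ x n → x * x ≡ 24 * n + 1 → 1 ≤ x
    positive zero n e = ⊥-elim (1+n≢0 (trans (+-comm 1 (24 * n)) (sym e)))
    positive (suc x) n e = s≤s z≤n

open ThetaSparsity

-- Comparison of the two densities

open import Data.Bool using (Bool; true; false; not)
open import Data.Nat as ℕ using (ℕ; zero; suc; z≤n; s≤s; _%_)
import Data.Nat.Properties as ℕP
import Data.Nat.Tactic.RingSolver as ℕSolver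
open import Data.Integer as ℤ using (+_; -[1+_]; _⊖_)
import Data.Integer.Properties as ℤP
import Data.Integer.Tactic.RingSolver as ℤSolver
open import Data.List using (upTo)
open import Data.List.Membership.Propositional.Properties using (∈-filter⁺; ∈-filter⁻; ∈-upTo⁺; ∈-upTo⁻)
open import Data.List.Relation.Unary.Unique.Propositional.Properties using (filter⁺; upTo⁺)
open import Data.Rational using (ℚ; mkℚ; _/_; _-_; _+_; _*_; -_; _<_; _≤_; ∣_∣; Positive; 0ℚ; ½; toℚᵘ)
import Data.Rational.Properties as ℚP
open import Data.Rational.Unnormalised as ℚᵘ using (mkℚᵘ; *≡*; *<*; *≤*) renaming (_≃_ to _≃ᵘ_)
import Data.Rational.Unnormalised.Properties as ℚᵘP
open import Data.Rational.Solver using (module +-*-Solver)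
open import Data.Product using (∃; _×_; _,_; proj₁; proj₂)
open import Data.Sum using (inj₁; inj₂)
open import Data.Empty using (⊥-elim)
open import Function using (_∘_)
open import Relation.Nullary using (¬?)
open import Relation.Binary.PropositionalEquality using (_≡_; _≢_; refl; sym; trans; cong; cong₂; subst; subst₂)
bit : Bool → ℕ
bit true = 1
bit false = 0

bit≤1 : ∀ c → bit c ℕ.≤ 1
bit≤1 true = s≤s z≤n
bit≤1 false = z≤n

count-suc : ∀ f x → count f (suc x) ≡ bit (f x) ℕ.+ count f x
count-suc f x with f x
... | true = refl
... | false = refl

count≤ : ∀ f x → count f x ℕ.≤ x
count≤ f zero = z≤n
count≤ f (suc x) = subst (ℕ._≤ suc x) (sym (count-suc f x)) (ℕP.+-mono-≤ (bit≤1 (f x)) (count≤ f x))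

parity⇒odd : ∀ k → parity k ≡ true → k % 2 ≢ 0
parity⇒odd (suc zero) _ ()
parity⇒odd (suc (suc k)) p = parity⇒odd k (trans (sym (not-not (parity k))) p)
  where
  not-not : ∀ c → not (not c) ≡ c
  not-not true = refl
  not-not false = refl

odd⇒parity : ∀ k → k % 2 ≢ 0 → parity k ≡ true
odd⇒parity zero k%2≢0 = ⊥-elim (k%2≢0 refl)
odd⇒parity (suc zero) _ = refl
odd⇒parity (suc (suc k)) k%2≢0 = trans (cong (not ∘ not) (odd⇒parity k k%2≢0)) refl

oddCount-count : ∀ m x → oddCount m x ≡ count (parity ∘ b m) (suc x)
oddCount-count m x = ℕP.≤-antisym
  (length-⊆ (filter⁺ odd? (upTo⁺ (suc x))) λ {n} n∈ → let n∈upTo , p = ∈-filter⁻ odd? {xs = upTo (suc x)} n∈ in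
    support-complete (parity ∘ b m) (suc x) (∈-upTo⁻ n∈upTo) (odd⇒parity (b m n) p))
  (length-⊆ (support-unique (parity ∘ b m) (suc x)) λ {n} n∈ → let n<x , p = support-sound (parity ∘ b m) (suc x) n∈ in
    ∈-filter⁺ odd? (∈-upTo⁺ n<x) (parity⇒odd (b m n) p))
  where
  odd? = λ n → ¬? (b m n % 2 ℕ.≟ 0)

-- One step of x adds the indices 4 x, ..., 4 x + 3, where the parities are those of θ, `θ₂θ₅`, 0
-- and `β₂₀` at x.
count-mod4 : ∀ x → count β₅ (x ℕ.* 2 ℕ.* 2) ≡ (count θ x ℕ.+ count θ₂θ₅ x) ℕ.+ count β₂₀ x
count-mod4 zero = refl
count-mod4 (suc x) = trans
  (trans (count-suc β₅ (3 ℕ.+ n)) (cong₂ ℕ._+_ (cong bit (β₅-3mod4 x))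
    (trans (count-suc β₅ (2 ℕ.+ n)) (cong₂ ℕ._+_ (cong bit (β₅-2mod4 x))
      (trans (count-suc β₅ (1 ℕ.+ n)) (cong₂ ℕ._+_ (cong bit (β₅-1mod4 x))
        (trans (count-suc β₅ n) (cong₂ ℕ._+_ (cong bit (β₅-0mod4 x)) (count-mod4 x)))))))))
  (trans (identity (bit (θ x)) (bit (θ₂θ₅ x)) (bit (β₂₀ x)) (count θ x) (count θ₂θ₅ x) (count β₂₀ x))
    (sym (cong₂ ℕ._+_ (cong₂ ℕ._+_ (count-suc θ x) (count-suc θ₂θ₅ x)) (count-suc β₂₀ x))))
  where
  n = x ℕ.* 2 ℕ.* 2
  identity : ∀ t h d a c e → d ℕ.+ (0 ℕ.+ (h ℕ.+ (t ℕ.+ ((a ℕ.+ c) ℕ.+ e)))) ≡ ((t ℕ.+ a) ℕ.+ (h ℕ.+ c)) ℕ.+ (d ℕ.+ e)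
  identity = ℕSolver.solve-∀

-- quarter x is the index of the term of ratio with denominator 4 (x + 1).
quarter : ℕ → ℕ
quarter x = 3 ℕ.+ x ℕ.* 2 ℕ.* 2

-- The additional 1 pays for the endpoint: `oddCount` includes n = x, while `count` stops before x.
excess : ℕ → ℕ
excess y = suc (count θ y ℕ.+ count θ₂θ₅ y)

oddCount₅-upper : ∀ x → oddCount 5 (suc (quarter x)) ℕ.≤ count β₂₀ (suc x) ℕ.+ excess (suc x)
oddCount₅-upper x = begin
  oddCount 5 (suc (quarter x))                ≡⟨ trans (oddCount-count 5 (suc (quarter x))) (count-suc β₅ (suc x ℕ.* 2 ℕ.* 2)) ⟩
  c ℕ.+ count β₅ (suc x ℕ.* 2 ℕ.* 2)          ≤⟨ ℕP.+-mono-≤ (bit≤1 (β₅ (suc x ℕ.* 2 ℕ.* 2))) (ℕP.≤-reflexive (count-mod4 (suc x))) ⟩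
  1 ℕ.+ (E ℕ.+ count β₂₀ (suc x))             ≡⟨ ℕP.+-comm (1 ℕ.+ E) (count β₂₀ (suc x)) ⟩
  count β₂₀ (suc x) ℕ.+ excess (suc x) ∎
  where
  open ℕP.≤-Reasoning
  c = bit (β₅ (suc x ℕ.* 2 ℕ.* 2))
  E = count θ (suc x) ℕ.+ count θ₂θ₅ (suc x)

oddCount₅≤ : ∀ x → oddCount 5 (suc (quarter x)) ℕ.≤ oddCount 20 (suc x) ℕ.+ excess (suc x)
oddCount₅≤ x = ℕP.≤-trans (oddCount₅-upper x) (ℕP.+-monoˡ-≤ (excess (suc x))
  (subst (count β₂₀ (suc x) ℕ.≤_) (sym (oddCount-count 20 (suc x))) (count-suc-≤ β₂₀ (suc x))))

oddCount₂₀≤ : ∀ x → oddCount 20 (suc x) ℕ.≤ oddCount 5 (suc (quarter x)) ℕ.+ excess (suc x)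
oddCount₂₀≤ x = begin
  oddCount 20 (suc x)                                     ≡⟨ trans (oddCount-count 20 (suc x)) (count-suc β₂₀ (suc x)) ⟩
  bit (β₂₀ (suc x)) ℕ.+ count β₂₀ (suc x)                 ≤⟨ ℕP.+-mono-≤ (bit≤1 (β₂₀ (suc x))) (ℕP.≤-trans (ℕP.m≤n+m _ E) (ℕP.≤-reflexive (sym (count-mod4 (suc x))))) ⟩
  1 ℕ.+ count β₅ (suc x ℕ.* 2 ℕ.* 2)                      ≤⟨ ℕP.+-mono-≤ {1} {excess (suc x)} (s≤s z≤n) (count-suc-≤ β₅ (suc x ℕ.* 2 ℕ.* 2)) ⟩
  excess (suc x) ℕ.+ count β₅ (suc (suc x ℕ.* 2 ℕ.* 2))   ≡⟨ trans (ℕP.+-comm (excess (suc x)) _) (cong (ℕ._+ excess (suc x)) (sym (oddCount-count 5 (suc (quarter x))))) ⟩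
  oddCount 5 (suc (quarter x)) ℕ.+ excess (suc x) ∎
  where
  open ℕP.≤-Reasoning
  E = count θ (suc x) ℕ.+ count θ₂θ₅ (suc x)

excess-sparse : ∀ K → ∃ λ y₀ → ∀ y → y₀ ℕ.≤ y → K ℕ.* excess y ℕ.≤ 3 ℕ.* y
excess-sparse K = K ℕ.+ (proj₁ (θ-density K) ℕ.+ proj₁ (θ₂θ₅-density K)) , λ y le → begin
    K ℕ.* excess y                                           ≡⟨ identity K (count θ y) (count θ₂θ₅ y) ⟩
    K ℕ.+ (K ℕ.* count θ y ℕ.+ K ℕ.* count θ₂θ₅ y)           ≤⟨ ℕP.+-mono-≤ (ℕP.≤-trans (ℕP.m≤m+n K _) le) (ℕP.+-mono-≤
        (proj₂ (θ-density K) y (ℕP.≤-trans (ℕP.≤-trans (ℕP.m≤m+n (proj₁ (θ-density K)) _) (ℕP.m≤n+m _ K)) le))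
        (proj₂ (θ₂θ₅-density K) y (ℕP.≤-trans (ℕP.≤-trans (ℕP.m≤n+m (proj₁ (θ₂θ₅-density K)) (proj₁ (θ-density K))) (ℕP.m≤n+m _ K)) le))) ⟩
    y ℕ.+ (y ℕ.+ y)                                          ≡⟨ identity′ y ⟩
    3 ℕ.* y ∎
  where
  open ℕP.≤-Reasoning
  identity : ∀ K a c → K ℕ.* suc (a ℕ.+ c) ≡ K ℕ.+ (K ℕ.* a ℕ.+ K ℕ.* c)
  identity = ℕSolver.solve-∀
  identity′ : ∀ y → y ℕ.+ (y ℕ.+ y) ≡ 3 ℕ.* y
  identity′ = ℕSolver.solve-∀

∣⊖∣-≤ : ∀ m n e → m ℕ.≤ n ℕ.+ e → n ℕ.≤ m ℕ.+ e → ℤ.∣ m ⊖ n ∣ ℕ.≤ e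
∣⊖∣-≤ m n e m≤ n≤ with ℕP.≤-total m n
... | inj₁ m≤n = subst (ℕ._≤ e) (sym (trans (ℤP.∣m⊖n∣≡∣n⊖m∣ m n) (cong ℤ.∣_∣ (ℤP.⊖-≥ m≤n)))) (ℕP.m≤n+o⇒m∸n≤o n m n≤)
... | inj₂ n≤m = subst (ℕ._≤ e) (sym (cong ℤ.∣_∣ (ℤP.⊖-≥ n≤m))) (ℕP.m≤n+o⇒m∸n≤o m n m≤)

4*suc : ∀ x → + suc (quarter x) ≡ + suc x ℤ.* + 4
4*suc x = trans (cong +_ (ℕP.*-assoc (suc x) 2 2)) (ℤP.pos-* (suc x) 4)

-- The factor ¼ brings the denominator x + 1 to 4 (x + 1), that of the other fraction; unnormalised
-- rationals keep this common denominator visible.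
difference-ᵘ : ∀ a c x → mkℚᵘ (+ a) (quarter x) ℚᵘ.- (mkℚᵘ (+ 1) 3 ℚᵘ.* mkℚᵘ (+ c) x) ≃ᵘ mkℚᵘ (a ⊖ c) (quarter x)
difference-ᵘ a c x = *≡* (trans
  (cong₂ (λ u v → (+ a ℤ.* v ℤ.+ ℤ.- (+ 1 ℤ.* + c) ℤ.* u) ℤ.* u) (4*suc x) (ℤP.pos-* 4 (suc x)))
  (trans (identity (+ a) (+ c) (+ suc x))
    (sym (cong₂ ℤ._*_ (sym (ℤP.m-n≡m⊖n a c)) (trans (ℤP.pos-* (suc (quarter x)) (4 ℕ.* suc x)) (cong₂ ℤ._*_ (4*suc x) (ℤP.pos-* 4 (suc x))))))))
  where
  identity : ∀ a c y → (a ℤ.* (+ 4 ℤ.* y) ℤ.+ ℤ.- (+ 1 ℤ.* c) ℤ.* (y ℤ.* + 4)) ℤ.* (y ℤ.* + 4) ≡ (a ℤ.- c) ℤ.* ((y ℤ.* + 4) ℤ.* (+ 4 ℤ.* y))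
  identity = ℤSolver.solve-∀

toℚᵘ-/ : ∀ a k → toℚᵘ (+ a / suc k) ≃ᵘ mkℚᵘ (+ a) k
toℚᵘ-/ a k = ℚP.toℚᵘ-fromℚᵘ (mkℚᵘ (+ a) k)

difference-abs : ∀ a c x → toℚᵘ ∣ + a / suc (quarter x) - ¼ * (+ c / suc x) ∣ ≃ᵘ mkℚᵘ (+ ℤ.∣ a ⊖ c ∣) (quarter x)
difference-abs a c x = begin
  toℚᵘ ∣ p - ¼ * q ∣                          ≈⟨ ℚP.toℚᵘ-homo-∣-∣ (p - ¼ * q) ⟩
  ℚᵘ.∣ toℚᵘ (p - ¼ * q) ∣                     ≈⟨ ℚᵘP.∣-∣-cong (begin
    toℚᵘ (p - ¼ * q)                           ≈⟨ ℚP.toℚᵘ-homo-+ p (- (¼ * q)) ⟩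
    toℚᵘ p ℚᵘ.+ toℚᵘ (- (¼ * q))               ≈⟨ ℚᵘP.+-cong (toℚᵘ-/ a (quarter x)) (ℚᵘP.≃-trans (ℚP.toℚᵘ-homo‿- (¼ * q)) (ℚᵘP.-‿cong (ℚᵘP.≃-trans (ℚP.toℚᵘ-homo-* ¼ q) (ℚᵘP.*-cong (toℚᵘ-/ 1 3) (toℚᵘ-/ c x))))) ⟩
    mkℚᵘ (+ a) (quarter x) ℚᵘ.- (mkℚᵘ (+ 1) 3 ℚᵘ.* mkℚᵘ (+ c) x) ≈⟨ difference-ᵘ a c x ⟩
    mkℚᵘ (a ⊖ c) (quarter x) ∎) ⟩
  mkℚᵘ (+ ℤ.∣ a ⊖ c ∣) (quarter x) ∎
  where
  open import Relation.Binary.Reasoning.Setoid ℚᵘP.≃-setoid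
  p = + a / suc (quarter x)
  q = + c / suc x

module _ (ε : ℚ) (ε>0 : Positive ε) where

  private
    denominator : ℕ
    denominator = ℚ.denominatorℕ ε

  difference-small : ∀ a c e x → denominator ℕ.* e ℕ.≤ 3 ℕ.* suc x → a ℕ.≤ c ℕ.+ e → c ℕ.≤ a ℕ.+ e →
                     ∣ + a / suc (quarter x) - ¼ * (+ c / suc x) ∣ < ε
  difference-small a c e x small a≤ c≤ = ℚP.toℚᵘ-cancel-< (ℚᵘP.<-respˡ-≃ (ℚᵘP.≃-sym (difference-abs a c x)) (below ε ε>0 small))
    where
    below : ∀ ε → Positive ε → ℚ.denominatorℕ ε ℕ.* e ℕ.≤ 3 ℕ.* suc x → mkℚᵘ (+ ℤ.∣ a ⊖ c ∣) (quarter x) ℚᵘ.< toℚᵘ ε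
    below (mkℚ (+ suc n) d _) _ small = *<* (subst₂ ℤ._<_ (ℤP.pos-* ℤ.∣ a ⊖ c ∣ (suc d)) (ℤP.pos-* (suc n) (suc (quarter x))) (ℤ.+<+ (begin-strict
      ℤ.∣ a ⊖ c ∣ ℕ.* suc d       ≤⟨ ℕP.*-monoˡ-≤ (suc d) (∣⊖∣-≤ a c e a≤ c≤) ⟩
      e ℕ.* suc d                 ≡⟨ ℕP.*-comm e (suc d) ⟩
      suc d ℕ.* e                 ≤⟨ small ⟩
      -- The 3 comes from the three terms in `excess-sparse`; being less than the 4 of the
      -- denominator, it makes the inequality strict.
      3 ℕ.* suc x                 <⟨ ℕP.*-monoˡ-< (suc x) {3} {4} (ℕP.n<1+n 3) ⟩
      4 ℕ.* suc x                 ≡⟨ trans (ℕP.*-comm 4 (suc x)) (sym (ℕP.*-assoc (suc x) 2 2)) ⟩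
      suc (quarter x)             ≤⟨ ℕP.m≤n*m (suc (quarter x)) (suc n) ⟩
      suc n ℕ.* suc (quarter x) ∎)))
      where open ℕP.≤-Reasoning
    below (mkℚ (+ zero) d _) (record { pos = () }) _
    below (mkℚ -[1+ n ] d _) (record { pos = () }) _

  -- The part x + 1 of a gives ¼ of 4 (x + 1), and e / (4 (x + 1)) stays below ε because ε is at
  -- least 1 / `denominator`.
  quarter-bound : ∀ a e x → denominator ℕ.* e ℕ.≤ 3 ℕ.* suc x → a ℕ.≤ suc x ℕ.+ e → + a / suc (quarter x) ≤ ¼ + ε
  quarter-bound a e x small a≤ = ℚP.toℚᵘ-cancel-≤ (ℚᵘP.≤-respˡ-≃ (ℚᵘP.≃-sym (toℚᵘ-/ a (quarter x)))
      (ℚᵘP.≤-respʳ-≃ (ℚᵘP.≃-sym (ℚᵘP.≃-trans (ℚP.toℚᵘ-homo-+ ¼ ε) (ℚᵘP.+-congˡ (toℚᵘ ε) (toℚᵘ-/ 1 3)))) (below ε ε>0 small)))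
    where
    below : ∀ ε → Positive ε → ℚ.denominatorℕ ε ℕ.* e ℕ.≤ 3 ℕ.* suc x → mkℚᵘ (+ a) (quarter x) ℚᵘ.≤ mkℚᵘ (+ 1) 3 ℚᵘ.+ toℚᵘ ε
    below (mkℚ (+ suc n) d _) _ small = *≤* (subst₂ ℤ._≤_ (ℤP.pos-* a (4 ℕ.* suc d)) cast (ℤ.+≤+ (begin
      a ℕ.* (4 ℕ.* suc d)                                ≤⟨ ℕP.*-monoˡ-≤ (4 ℕ.* suc d) a≤ ⟩
      (suc x ℕ.+ e) ℕ.* (4 ℕ.* suc d)                    ≡⟨ i₁ (suc x) e (suc d) ⟩
      4 ℕ.* (suc d ℕ.* suc x) ℕ.+ 4 ℕ.* (suc d ℕ.* e)    ≤⟨ ℕP.+-monoʳ-≤ (4 ℕ.* (suc d ℕ.* suc x)) (ℕP.*-monoʳ-≤ 4 (ℕP.≤-trans small (ℕP.*-monoˡ-≤ (suc x) (ℕP.≤-trans (ℕP.n≤1+n 3) (ℕP.m≤n*m 4 (suc n)))))) ⟩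
      4 ℕ.* (suc d ℕ.* suc x) ℕ.+ 4 ℕ.* (suc n ℕ.* 4 ℕ.* suc x) ≡⟨ i₂ (suc d) (suc n) (suc x) ⟩
      (1 ℕ.* suc d ℕ.+ suc n ℕ.* 4) ℕ.* (suc x ℕ.* 2 ℕ.* 2) ∎)))
      where
      open ℕP.≤-Reasoning
      i₁ : ∀ y e d → (y ℕ.+ e) ℕ.* (4 ℕ.* d) ≡ 4 ℕ.* (d ℕ.* y) ℕ.+ 4 ℕ.* (d ℕ.* e)
      i₁ = ℕSolver.solve-∀
      i₂ : ∀ d n y → 4 ℕ.* (d ℕ.* y) ℕ.+ 4 ℕ.* (n ℕ.* 4 ℕ.* y) ≡ (1 ℕ.* d ℕ.+ n ℕ.* 4) ℕ.* (y ℕ.* 2 ℕ.* 2)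
      i₂ = ℕSolver.solve-∀
      cast : + ((1 ℕ.* suc d ℕ.+ suc n ℕ.* 4) ℕ.* suc (quarter x)) ≡ (+ 1 ℤ.* + suc d ℤ.+ + suc n ℤ.* + 4) ℤ.* + suc (quarter x)
      cast = trans (ℤP.pos-* (1 ℕ.* suc d ℕ.+ suc n ℕ.* 4) (suc (quarter x))) (cong (ℤ._* + suc (quarter x)) (cong₂ ℤ._+_ (ℤP.pos-* 1 (suc d)) (ℤP.pos-* (suc n) 4)))
    below (mkℚ (+ zero) d _) (record { pos = () }) _
    below (mkℚ -[1+ n ] d _) (record { pos = () }) _

  ratio-close : ∃ λ N → ∀ x → N ℕ.≤ x → ∣ ratio 5 (quarter x) - ¼ * ratio 20 x ∣ < ε × ratio 5 (quarter x) ≤ ¼ + ε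
  ratio-close = let y₀ , small = excess-sparse denominator in y₀ , λ x y₀≤x →
    let s = small (suc x) (ℕP.m≤n⇒m≤1+n y₀≤x) in
    difference-small (oddCount 5 (suc (quarter x))) (oddCount 20 (suc x)) (excess (suc x)) x s (oddCount₅≤ x) (oddCount₂₀≤ x) ,
    quarter-bound (oddCount 5 (suc (quarter x))) (excess (suc x)) x s
      (ℕP.≤-trans (oddCount₅-upper x) (ℕP.+-monoˡ-≤ (excess (suc x)) (count≤ β₂₀ (suc x))))

x≤quarter : ∀ x → x ℕ.≤ quarter x
x≤quarter x = ℕP.≤-trans (ℕP.≤-trans (ℕP.m≤m*n x 2) (ℕP.m≤m*n (x ℕ.* 2) 2)) (ℕP.m≤n+m _ 3)

p≤∣p∣ : ∀ p → p ≤ ∣ p ∣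
p≤∣p∣ p with ℚP.≤-total 0ℚ p
... | inj₁ 0≤p = ℚP.≤-reflexive (sym (ℚP.0≤p⇒∣p∣≡p 0≤p))
... | inj₂ p≤0 = ℚP.≤-trans p≤0 (ℚP.0≤∣p∣ p)

half : ∀ ε → ½ * ε + ½ * ε ≡ ε
half ε = trans (sym (ℚP.*-distribʳ-+ ε ½ ½)) (ℚP.*-identityˡ ε)

theorem2p1 : Convergent (ratio 5) → Convergent (ratio 20) →
    TendsTo (λ x → ratio 5 x - ¼ * ratio 20 x) 0ℚ × EventuallyLe (ratio 5) ¼
theorem2p1 conv₅ _ = tends , eventually
  where
  open ℚP.≤-Reasoning
  telescope : ∀ p q r → p - r - 0ℚ ≡ (p - q) + (q - r)
  telescope = solve 3 (λ p q r → p :- r :- con 0ℚ := (p :- q) :+ (q :- r)) refl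
    where open +-*-Solver
  telescope′ : ∀ p q → p ≡ (p - q) + q
  telescope′ = solve 2 (λ p q → p := (p :- q) :+ q) refl
    where open +-*-Solver
  tends : TendsTo (λ x → ratio 5 x - ¼ * ratio 20 x) 0ℚ
  tends ε ε>0 =
    -- The Cauchy property of `ratio 5` moves from index x to `quarter x`, where the comparison with
    -- `ratio 20 x` is available; each of these two moves is granted ε / 2.
    let ½ε>0 = ℚP.pos*pos⇒pos ½ ε {{ε>0}}
        N₁ , cauchy = conv₅ (½ * ε) ½ε>0
        N₂ , close = ratio-close (½ * ε) ½ε>0
    in N₁ ℕ.+ N₂ , λ x N≤x →
      let N₁≤x = ℕP.≤-trans (ℕP.m≤m+n N₁ N₂) N≤x
          N₂≤x = ℕP.≤-trans (ℕP.m≤n+m N₂ N₁) N≤x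
          p = ratio 5 x
          q = ratio 5 (quarter x)
          r = ¼ * ratio 20 x
      in begin-strict
        ∣ p - r - 0ℚ ∣            ≡⟨ cong ∣_∣ (telescope p q r) ⟩
        ∣ (p - q) + (q - r) ∣     ≤⟨ ℚP.∣p+q∣≤∣p∣+∣q∣ (p - q) (q - r) ⟩
        ∣ p - q ∣ + ∣ q - r ∣     <⟨ ℚP.+-mono-< (cauchy x (quarter x) N₁≤x (ℕP.≤-trans N₁≤x (x≤quarter x))) (proj₁ (close x N₂≤x)) ⟩
        ½ * ε + ½ * ε             ≡⟨ half ε ⟩
        ε ∎
  eventually : EventuallyLe (ratio 5) ¼
  eventually ε ε>0 =
    -- The bound at `quarter x` takes all x + 1 values of `β₂₀` to be odd, out of 4 (x + 1) indices;
    -- the same two halves of ε are spent.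
    let ½ε>0 = ℚP.pos*pos⇒pos ½ ε {{ε>0}}
        N₁ , cauchy = conv₅ (½ * ε) ½ε>0
        N₂ , close = ratio-close (½ * ε) ½ε>0
    in N₁ ℕ.+ N₂ , λ x N≤x →
      let N₁≤x = ℕP.≤-trans (ℕP.m≤m+n N₁ N₂) N≤x
          N₂≤x = ℕP.≤-trans (ℕP.m≤n+m N₂ N₁) N≤x
          p = ratio 5 x
          q = ratio 5 (quarter x)
      in begin
        p                         ≡⟨ telescope′ p q ⟩
        (p - q) + q               ≤⟨ ℚP.+-mono-≤ (ℚP.≤-trans (p≤∣p∣ (p - q)) (ℚP.<⇒≤ (cauchy x (quarter x) N₁≤x (ℕP.≤-trans N₁≤x (x≤quarter x))))) (proj₂ (close x N₂≤x)) ⟩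
        ½ * ε + (¼ + ½ * ε)       ≡⟨ regroup (½ * ε) ¼ ⟩
        ¼ + (½ * ε + ½ * ε)       ≡⟨ cong (λ v → ¼ + v) (half ε) ⟩
        ¼ + ε ∎
    where
    regroup : ∀ h q → h + (q + h) ≡ q + (h + h)
    regroup = solve 2 (λ h q → h :+ (q :+ h) := q :+ (h :+ h)) refl
      where open +-*-Solver
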